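{- Let $G_1$ be an $r_1$-regular graph with $n_1$ vertices and $m_1$ edges and let $G_2$ be an arbitrary graph with $n_2$ vertices. Then the adjacency characteristic polynomial of the central edge neighborhood corona $G_1\underline{\boxdot}G_2$ is (as an identity of rational functions in $x$) $$f(A(G_1\underline{\boxdot}G_2),x)=x^{m_1}\prod_{j=1}^{n_2}(x-\lambda_j(G_2))^{m_1}\prod_{i=1}^{n_1}\Big(\big(x+1-r_1\chi_{A(G_2)}(x)-\tfrac{r_1}{x}\big)-P(\lambda_i(G_1))+\big(1-\chi_{A(G_2)}(x)-\tfrac1x\big)\lambda_i(G_1)\Big).$$
   Context: All graphs are finite, simple and connected. For a graph $G$ on $n$ vertices, $A(G)$ is its adjacency matrix with eigenvalues $\lambda_1(G)\ge\dots\ge\lambda_n(G)$ (with multiplicity). For an $n\times n$ matrix $M$, $f(M,x)=\det(xI_n-M)$, and $\chi_M(x)=\mathbf 1^T(xI_n-M)^{ -1}\mathbf 1$ is the sum of all entries of $(xI_n-M)^{ -1}$ (the $M$-coronal). $P$ denotes the polynomial associated with $G_1$: if $G_1$ is connected $r_1$-regular on $n_1$ vertices with distinct adjacency eigenvalues $r_1=\theta_1,\theta_2,\dots,\theta_t$, then $P(x)=n_1\prod_{k=2}^t\frac{x-\theta_k}{r_1-\theta_k}$; thus $P(A(G_1))$ is the all-ones matrix, $P(r_1)=n_1$ and $P(\theta_k)=0$ for $k\ge2$. The central graph $C(G)$ of $G$ is obtained from $G$ by subdividing each edge of $G$ exactly once and joining all pairs of distinct vertices of $G$ that are nonadjacent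 in $G$; $\tilde V(G)=V(C(G))\setminus V(G)$ is the set of subdivision vertices, corresponding to the edges of $G$. The central edge neighborhood corona $G_1\underline{\boxdot}G_2$ is obtained by taking $C(G_1)$ and $|\tilde V(G_1)|$ copies of $G_2$, and joining the neighbors in $C(G_1)$ of the $i$-th vertex of $\tilde V(G_1)$ to every vertex in the $i$-th copy of $G_2$, for each $i$. -}

module Defs where

open import Algebra.Bundles using (CommutativeRing; Semiring)
open import Algebra.Core using (Op₁; Op₂)
import Algebra.Consequences.Setoid as Consequences
import Algebra.Definitions
import Algebra.Definitions.RawSemiring
import Algebra.Properties.Ring as RingProperties
import Algebra.Solver.Ring.NaturalCoefficients.Default as Solver
open import Data.Bool.Base using (if_then_else_)
open import Data.Empty using (⊥)
open import Data.Fin.Base as Fin using (Fin; zero; suc; toℕ; punchIn)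
import Data.Fin.Properties as Fin
open import Data.List.Base as List using (List; []; _∷_; length; filter; deduplicate; allFin; cartesianProduct; lookup; tabulate)
open import Data.Nat.Base as ℕ using (ℕ; zero; suc)
open import Data.Product.Base using (_×_; _,_; proj₁; proj₂)
open import Data.Product.Function.NonDependent.Propositional using (_×-↔_)
open import Data.Sum.Base using (_⊎_; inj₁; inj₂)
open import Data.Sum.Function.Propositional using (_⊎-↔_)
open import Data.Vec.Functional using (Vector)
open import Function.Base using (_∘_)
open import Function.Bundles using (_↔_; Inverse)
open import Function.Construct.Composition using (_↔-∘_)
open import Function.Construct.Identity using (↔-id)
open import Level using (0ℓ; _⊔_) renaming (suc to lsuc)
open import Relation.Binary.Core using (Rel)
open import Relation.Binary.Bundles using (Setoid)
open import Relation.Binary.Construct.Closure.ReflexiveTransitive using (Star)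
open import Relation.Binary.Definitions using (Decidable; Symmetric; Irreflexive)
open import Relation.Binary.PropositionalEquality as ≡ using (_≡_)
open import Relation.Binary.Structures using (IsEquivalence; IsTotalOrder)
import Relation.Binary.Reasoning.Setoid as SetoidReasoning
open import Relation.Nullary using (¬_; Dec; yes; no; does; contradiction; ¬?; _×-dec_; _⊎-dec_)

-- Equality is decidable and inversion is total; nothing is assumed about
-- the value of 0# ⁻¹.
record Field c ℓ : Set (lsuc (c ⊔ ℓ)) where
  field
    commutativeRing : CommutativeRing c ℓ

  open CommutativeRing commutativeRing public

  infix  4 _≟_
  infixl 8 _⁻¹
  field
    _≟_         : Decidable _≈_
    1≉0         : 1# ≉ 0#
    _⁻¹         : Op₁ Carrier
    *-inverseʳ  : ∀ {x} → x ≉ 0# → x * x ⁻¹ ≈ 1#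

  infixl 7 _/_
  _/_ : Op₂ Carrier
  x / y = x * y ⁻¹

-- The real numbers are, classically, an ordered field in this sense, and
-- so is the field of real algebraic numbers.
record OrderedField c ℓ₁ ℓ₂ : Set (lsuc (c ⊔ ℓ₁ ⊔ ℓ₂)) where
  field
    baseField : Field c ℓ₁

  open Field baseField public

  infix 4 _≤_
  field
    _≤_          : Rel Carrier ℓ₂
    isTotalOrder : IsTotalOrder _≈_ _≤_
    +-monoˡ-≤    : ∀ {x y} z → x ≤ y → x + z ≤ y + z
    *-nonNeg     : ∀ {x y} → 0# ≤ x → 0# ≤ y → 0# ≤ x * y

-- A polynomial is the list of its coefficients, constant term first;
-- trailing zeros are immaterial.
module Polynomials {c ℓ} (R : CommutativeRing c ℓ) where

  private
    module R = CommutativeRing R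
    open R using (Carrier; _≈_; _+_; _*_; -_; 0#; 1#)
    open RingProperties R.ring using (-0#≈0#)
    open SetoidReasoning R.setoid

    open Solver R.commutativeSemiring using (solve; _:=_; _:+_; _:*_)

  Polynomial : Set c
  Polynomial = List Carrier

  coeff : Polynomial → ℕ → Carrier
  coeff []      _       = 0#
  coeff (a ∷ p) zero    = a
  coeff (a ∷ p) (suc k) = coeff p k

  infix 4 _≈ₚ_
  record _≈ₚ_ (p q : Polynomial) : Set ℓ where
    constructor mk≈
    field at : ∀ k → coeff p k ≈ coeff q k
  open _≈ₚ_ public

  infixl 6 _+ₚ_
  infixl 7 _*ₚ_
  infix  8 -ₚ_

  _+ₚ_ : Op₂ Polynomial
  []      +ₚ q       = q
  (a ∷ p) +ₚ []      = a ∷ p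
  (a ∷ p) +ₚ (b ∷ q) = a + b ∷ p +ₚ q

  -ₚ_ : Op₁ Polynomial
  -ₚ_ = List.map -_

  scale : Carrier → Polynomial → Polynomial
  scale a = List.map (a *_)

  _*ₚ_ : Op₂ Polynomial
  []      *ₚ q = []
  (a ∷ p) *ₚ q = scale a q +ₚ (0# ∷ p *ₚ q)

  constant : Carrier → Polynomial
  constant a = a ∷ []

  indeterminate : Polynomial
  indeterminate = 0# ∷ 1# ∷ []

  coeff-+ : ∀ p q k → coeff (p +ₚ q) k ≈ coeff p k + coeff q k
  coeff-+ []      q       k       = R.sym (R.+-identityˡ _)
  coeff-+ (a ∷ p) []      k       = R.sym (R.+-identityʳ _)
  coeff-+ (a ∷ p) (b ∷ q) zero    = R.refl
  coeff-+ (a ∷ p) (b ∷ q) (suc k) = coeff-+ p q k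

  coeff-neg : ∀ p k → coeff (-ₚ p) k ≈ - coeff p k
  coeff-neg []      k       = R.sym -0#≈0#
  coeff-neg (a ∷ p) zero    = R.refl
  coeff-neg (a ∷ p) (suc k) = coeff-neg p k

  coeff-scale : ∀ a p k → coeff (scale a p) k ≈ a * coeff p k
  coeff-scale a []      k       = R.sym (R.zeroʳ a)
  coeff-scale a (b ∷ p) zero    = R.refl
  coeff-scale a (b ∷ p) (suc k) = coeff-scale a p k

  private
    conv : (f g : ℕ → Carrier) → ℕ → Carrier
    conv f g zero    = f zero * g zero
    conv f g (suc k) = f zero * g (suc k) + conv (f ∘ suc) g k

    conv-cong : ∀ {f f′ g g′} → (∀ k → f k ≈ f′ k) → (∀ k → g k ≈ g′ k) →
                ∀ k → conv f g k ≈ conv f′ g′ k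
    conv-cong f≈ g≈ zero    = R.*-cong (f≈ zero) (g≈ zero)
    conv-cong f≈ g≈ (suc k) =
      R.+-cong (R.*-cong (f≈ zero) (g≈ (suc k))) (conv-cong (f≈ ∘ suc) g≈ k)

    conv-zeroˡ : ∀ g k → conv (λ _ → 0#) g k ≈ 0#
    conv-zeroˡ g zero    = R.zeroˡ _
    conv-zeroˡ g (suc k) =
      R.trans (R.+-cong (R.zeroˡ _) (conv-zeroˡ g k)) (R.+-identityˡ 0#)

    rearrange₁ : ∀ a b c d → a + b + (c + d) ≈ a + c + (b + d)
    rearrange₁ = solve 4 (λ a b c d → a :+ b :+ (c :+ d) := a :+ c :+ (b :+ d)) R.refl

    conv-distribˡ : ∀ f g h k → conv f (λ i → g i + h i) k ≈ conv f g k + conv f h k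
    conv-distribˡ f g h zero    = R.distribˡ _ _ _
    conv-distribˡ f g h (suc k) = R.trans
      (R.+-cong (R.distribˡ _ _ _) (conv-distribˡ (f ∘ suc) g h k))
      (rearrange₁ _ _ _ _)

    conv-suc : ∀ f g k → conv f g (suc k) ≈ conv f (g ∘ suc) k + f (suc k) * g zero
    conv-suc f g zero    = R.refl
    conv-suc f g (suc k) =
      R.trans (R.+-congˡ (conv-suc (f ∘ suc) g k)) (R.sym (R.+-assoc _ _ _))

    conv-comm : ∀ f g k → conv f g k ≈ conv g f k
    conv-comm f g zero    = R.*-comm _ _
    conv-comm f g (suc k) = begin
      f zero * g (suc k) + conv (f ∘ suc) g k ≈⟨ R.+-cong (R.*-comm _ _) (conv-comm (f ∘ suc) g k) ⟩
      g (suc k) * f zero + conv g (f ∘ suc) k ≈⟨ R.+-comm _ _ ⟩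
      conv g (f ∘ suc) k + g (suc k) * f zero ≈⟨ conv-suc g f k ⟨
      conv g f (suc k)                        ∎

    conv-distribʳ : ∀ f g h k → conv (λ i → g i + h i) f k ≈ conv g f k + conv h f k
    conv-distribʳ f g h k = begin
      conv (λ i → g i + h i) f k ≈⟨ conv-comm _ f k ⟩
      conv f (λ i → g i + h i) k ≈⟨ conv-distribˡ f g h k ⟩
      conv f g k + conv f h k    ≈⟨ R.+-cong (conv-comm f g k) (conv-comm f h k) ⟩
      conv g f k + conv h f k    ∎

    conv-scaleˡ : ∀ a f g k → conv (λ i → a * f i) g k ≈ a * conv f g k
    conv-scaleˡ a f g zero    = R.*-assoc _ _ _
    conv-scaleˡ a f g (suc k) = R.trans
      (R.+-cong (R.*-assoc _ _ _) (conv-scaleˡ a (f ∘ suc) g k))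
      (R.sym (R.distribˡ _ _ _))

    rearrange₂ : ∀ f g h u v → f * g * h + (f * u + v) ≈ f * (g * h + u) + v
    rearrange₂ = solve 5 (λ f g h u v →
      f :* g :* h :+ (f :* u :+ v) := f :* (g :* h :+ u) :+ v) R.refl

    conv-assoc : ∀ f g h k → conv (conv f g) h k ≈ conv f (conv g h) k
    conv-assoc f g h zero    = R.*-assoc _ _ _
    conv-assoc f g h (suc k) = begin
      f zero * g zero * h (suc k) + conv (λ i → f zero * g (suc i) + conv (f ∘ suc) g i) h k
        ≈⟨ R.+-congˡ (conv-distribʳ h _ _ k) ⟩
      f zero * g zero * h (suc k) + (conv (λ i → f zero * g (suc i)) h k + conv (conv (f ∘ suc) g) h k)
        ≈⟨ R.+-congˡ (R.+-cong (conv-scaleˡ _ _ h k) (conv-assoc (f ∘ suc) g h k)) ⟩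
      f zero * g zero * h (suc k) + (f zero * conv (g ∘ suc) h k + conv (f ∘ suc) (conv g h) k)
        ≈⟨ rearrange₂ _ _ _ _ _ ⟩
      f zero * (g zero * h (suc k) + conv (g ∘ suc) h k) + conv (f ∘ suc) (conv g h) k ∎

    coeff-*-conv : ∀ p q k → coeff (p *ₚ q) k ≈ conv (coeff p) (coeff q) k
    coeff-*-conv []      q k       = R.sym (conv-zeroˡ (coeff q) k)
    coeff-*-conv (a ∷ p) q zero    = begin
      coeff (scale a q +ₚ (0# ∷ p *ₚ q)) 0 ≈⟨ coeff-+ (scale a q) _ 0 ⟩
      coeff (scale a q) 0 + 0#             ≈⟨ R.+-identityʳ _ ⟩
      coeff (scale a q) 0                  ≈⟨ coeff-scale a q 0 ⟩
      a * coeff q 0                        ∎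
    coeff-*-conv (a ∷ p) q (suc k) = begin
      coeff (scale a q +ₚ (0# ∷ p *ₚ q)) (suc k)        ≈⟨ coeff-+ (scale a q) _ (suc k) ⟩
      coeff (scale a q) (suc k) + coeff (p *ₚ q) k      ≈⟨ R.+-cong (coeff-scale a q (suc k)) (coeff-*-conv p q k) ⟩
      a * coeff q (suc k) + conv (coeff p) (coeff q) k  ∎

  ≈ₚ-isEquivalence : IsEquivalence _≈ₚ_
  ≈ₚ-isEquivalence = record
    { refl  = mk≈ λ _ → R.refl
    ; sym   = λ p≈q → mk≈ λ k → R.sym (at p≈q k)
    ; trans = λ p≈q q≈r → mk≈ λ k → R.trans (at p≈q k) (at q≈r k)
    }

  private
    ≈ₚ-setoid : Setoid c ℓ
    ≈ₚ-setoid = record { isEquivalence = ≈ₚ-isEquivalence }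

    via-+ : ∀ {p q r s} → (∀ k → coeff p k + coeff q k ≈ coeff r k + coeff s k) → p +ₚ q ≈ₚ r +ₚ s
    via-+ {p} {q} {r} {s} eq = mk≈ λ k →
      R.trans (coeff-+ p q k) (R.trans (eq k) (R.sym (coeff-+ r s k)))

    +ₚ-assoc : ∀ p q r → (p +ₚ q) +ₚ r ≈ₚ p +ₚ (q +ₚ r)
    +ₚ-assoc p q r = via-+ {p +ₚ q} {r} {p} {q +ₚ r} λ k → begin
      coeff (p +ₚ q) k + coeff r k        ≈⟨ R.+-congʳ (coeff-+ p q k) ⟩
      coeff p k + coeff q k + coeff r k   ≈⟨ R.+-assoc _ _ _ ⟩
      coeff p k + (coeff q k + coeff r k) ≈⟨ R.+-congˡ (coeff-+ q r k) ⟨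
      coeff p k + coeff (q +ₚ r) k        ∎

    +ₚ-comm : ∀ p q → p +ₚ q ≈ₚ q +ₚ p
    +ₚ-comm p q = via-+ {p} {q} {q} {p} λ k → R.+-comm _ _

    +ₚ-inverseˡ : ∀ p → -ₚ p +ₚ p ≈ₚ []
    +ₚ-inverseˡ p = mk≈ λ k → begin
      coeff (-ₚ p +ₚ p) k         ≈⟨ coeff-+ (-ₚ p) p k ⟩
      coeff (-ₚ p) k + coeff p k  ≈⟨ R.+-congʳ (coeff-neg p k) ⟩
      - coeff p k + coeff p k     ≈⟨ R.-‿inverseˡ _ ⟩
      0#                          ∎

    via-* : ∀ p q r s → (∀ k → conv (coeff p) (coeff q) k ≈ conv (coeff r) (coeff s) k) →
            p *ₚ q ≈ₚ r *ₚ s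
    via-* p q r s eq = mk≈ λ k →
      R.trans (coeff-*-conv p q k) (R.trans (eq k) (R.sym (coeff-*-conv r s k)))

    *ₚ-comm : ∀ p q → p *ₚ q ≈ₚ q *ₚ p
    *ₚ-comm p q = via-* p q q p (conv-comm (coeff p) (coeff q))

    *ₚ-assoc : ∀ p q r → (p *ₚ q) *ₚ r ≈ₚ p *ₚ (q *ₚ r)
    *ₚ-assoc p q r = via-* (p *ₚ q) r p (q *ₚ r) λ k → begin
      conv (coeff (p *ₚ q)) (coeff r) k                ≈⟨ conv-cong (coeff-*-conv p q) (λ _ → R.refl) k ⟩
      conv (conv (coeff p) (coeff q)) (coeff r) k      ≈⟨ conv-assoc (coeff p) (coeff q) (coeff r) k ⟩
      conv (coeff p) (conv (coeff q) (coeff r)) k      ≈⟨ conv-cong {f = coeff p} (λ _ → R.refl) (coeff-*-conv q r) k ⟨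
      conv (coeff p) (coeff (q *ₚ r)) k                ∎

    *ₚ-distribˡ : ∀ p q r → p *ₚ (q +ₚ r) ≈ₚ p *ₚ q +ₚ p *ₚ r
    *ₚ-distribˡ p q r = mk≈ λ k → begin
      coeff (p *ₚ (q +ₚ r)) k                                      ≈⟨ coeff-*-conv p (q +ₚ r) k ⟩
      conv (coeff p) (coeff (q +ₚ r)) k                            ≈⟨ conv-cong {f = coeff p} (λ _ → R.refl) (coeff-+ q r) k ⟩
      conv (coeff p) (λ i → coeff q i + coeff r i) k               ≈⟨ conv-distribˡ (coeff p) (coeff q) (coeff r) k ⟩
      conv (coeff p) (coeff q) k + conv (coeff p) (coeff r) k      ≈⟨ R.+-cong (coeff-*-conv p q k) (coeff-*-conv p r k) ⟨
      coeff (p *ₚ q) k + coeff (p *ₚ r) k                          ≈⟨ coeff-+ (p *ₚ q) (p *ₚ r) k ⟨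
      coeff (p *ₚ q +ₚ p *ₚ r) k                                   ∎

    *ₚ-identityˡ : ∀ p → constant 1# *ₚ p ≈ₚ p
    *ₚ-identityˡ p = mk≈ λ where
      zero    → R.trans (coeff-*-conv (constant 1#) p 0) (R.*-identityˡ _)
      (suc k) → R.trans (coeff-*-conv (constant 1#) p (suc k))
        (R.trans (R.+-cong (R.*-identityˡ _) (conv-zeroˡ (coeff p) k)) (R.+-identityʳ _))

  polynomialRing : CommutativeRing c ℓ
  polynomialRing = record
    { Carrier = Polynomial
    ; _≈_     = _≈ₚ_
    ; _+_     = _+ₚ_
    ; _*_     = _*ₚ_
    ; -_      = -ₚ_
    ; 0#      = []
    ; 1#      = constant 1#
    ; isCommutativeRing = record
      { isRing = record
        { +-isAbelianGroup = record
          { isGroup = record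
            { isMonoid = record
              { isSemigroup = record
                { isMagma = record
                  { isEquivalence = ≈ₚ-isEquivalence
                  ; ∙-cong        = λ {p} {p′} {q} {q′} p≈ q≈ →
                      via-+ {p} {q} {p′} {q′} λ k → R.+-cong (at p≈ k) (at q≈ k)
                  }
                ; assoc = +ₚ-assoc
                }
              ; identity = comm∧idˡ⇒id +ₚ-comm (λ _ → mk≈ λ _ → R.refl)
              }
            ; inverse = comm∧invˡ⇒inv +ₚ-comm +ₚ-inverseˡ
            ; ⁻¹-cong = λ {p} {q} p≈q → mk≈ λ k →
                R.trans (coeff-neg p k) (R.trans (R.-‿cong (at p≈q k)) (R.sym (coeff-neg q k)))
            }
          ; comm = +ₚ-comm
          }
        ; *-cong     = λ {p} {p′} {q} {q′} p≈ q≈ → via-* p q p′ q′ (conv-cong (at p≈) (at q≈))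
        ; *-assoc    = *ₚ-assoc
        ; *-identity = comm∧idˡ⇒id *ₚ-comm *ₚ-identityˡ
        ; distrib    = comm∧distrˡ⇒distr +ₚ-cong *ₚ-comm *ₚ-distribˡ
        }
      ; *-comm = *ₚ-comm
      }
    }
    where
    open Consequences ≈ₚ-setoid
      using (comm∧idˡ⇒id; comm∧invˡ⇒inv; comm∧distrˡ⇒distr)
    +ₚ-cong : ∀ {p p′ q q′} → p ≈ₚ p′ → q ≈ₚ q′ → p +ₚ q ≈ₚ p′ +ₚ q′
    +ₚ-cong {p} {p′} {q} {q′} p≈ q≈ = via-+ {p} {q} {p′} {q′} λ k → R.+-cong (at p≈ k) (at q≈ k)

module PolynomialsOverField {c ℓ} (K : Field c ℓ) where

  open Field K
  open Polynomials commutativeRing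
  private module P = CommutativeRing polynomialRing

  *-≉0 : ∀ {x y} → x ≉ 0# → y ≉ 0# → x * y ≉ 0#
  *-≉0 {x} {y} x≉0 y≉0 xy≈0 = y≉0 (begin
    y                ≈⟨ *-identityˡ y ⟨
    1# * y           ≈⟨ *-congʳ (*-inverseʳ x≉0) ⟨
    x * x ⁻¹ * y     ≈⟨ *-congʳ (*-comm x (x ⁻¹)) ⟩
    x ⁻¹ * x * y     ≈⟨ *-assoc _ _ _ ⟩
    x ⁻¹ * (x * y)   ≈⟨ *-congˡ xy≈0 ⟩
    x ⁻¹ * 0#        ≈⟨ zeroʳ _ ⟩
    0#               ∎)
    where open SetoidReasoning setoid

  private
    shift-*ₚ : ∀ p q → (0# ∷ p) *ₚ q P.≈ 0# ∷ (p *ₚ q)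
    shift-*ₚ p q = mk≈ λ k → begin
      coeff (scale 0# q +ₚ (0# ∷ p *ₚ q)) k            ≈⟨ coeff-+ (scale 0# q) _ k ⟩
      coeff (scale 0# q) k + coeff (0# ∷ p *ₚ q) k     ≈⟨ +-congʳ (coeff-scale 0# q k) ⟩
      0# * coeff q k + coeff (0# ∷ p *ₚ q) k           ≈⟨ +-congʳ (zeroˡ _) ⟩
      0# + coeff (0# ∷ p *ₚ q) k                       ≈⟨ +-identityˡ _ ⟩
      coeff (0# ∷ p *ₚ q) k                            ∎
      where open SetoidReasoning setoid

    ∷-≈ : ∀ {a b p q} → a ≈ b → p P.≈ q → (a ∷ p) P.≈ (b ∷ q)
    ∷-≈ a≈b p≈q = mk≈ λ { zero → a≈b ; (suc k) → at p≈q k }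

    ∷≈0 : ∀ {a p} → a ≈ 0# → p P.≈ P.0# → (a ∷ p) P.≈ P.0#
    ∷≈0 a≈0 p≈0 = mk≈ λ { zero → a≈0 ; (suc k) → at p≈0 k }

    shift-≉0 : ∀ {a p q} → a ≈ 0# → (p *ₚ q) P.≉ P.0# → ((a ∷ p) *ₚ q) P.≉ P.0#
    shift-≉0 {a} {p} {q} a≈0 pq≉0 eq = pq≉0 (mk≈ λ k → at shifted≈0 (suc k))
      where
      shifted≈0 : 0# ∷ (p *ₚ q) P.≈ P.0#
      shifted≈0 = P.trans (P.sym (shift-*ₚ p q))
        (P.trans (P.*-congʳ (∷-≈ {p = p} (sym a≈0) P.refl)) eq)

  *ₚ-≉0 : ∀ p q → p P.≉ P.0# → q P.≉ P.0# → (p *ₚ q) P.≉ P.0#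
  *ₚ-≉0 []      q       p≉0 q≉0 = contradiction P.refl p≉0
  *ₚ-≉0 (a ∷ p) []      p≉0 q≉0 = contradiction P.refl q≉0
  *ₚ-≉0 (a ∷ p) (b ∷ q) p≉0 q≉0 = byCases (a ≟ 0#) (b ≟ 0#)
    (λ a≈0 → *ₚ-≉0 p (b ∷ q) (p≉0 ∘ ∷≈0 a≈0) q≉0)
    (λ b≈0 → *ₚ-≉0 (a ∷ p) q p≉0 (q≉0 ∘ ∷≈0 b≈0))
    where
    byCases : Dec (a ≈ 0#) → Dec (b ≈ 0#) →
              (a ≈ 0# → (p *ₚ (b ∷ q)) P.≉ P.0#) →
              (b ≈ 0# → ((a ∷ p) *ₚ q) P.≉ P.0#) →
              ((a ∷ p) *ₚ (b ∷ q)) P.≉ P.0#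
    byCases (yes a≈0) _ ih _ = shift-≉0 {p = p} a≈0 (ih a≈0)
    byCases (no _) (yes b≈0) _ ih eq =
      shift-≉0 {p = q} {a ∷ p} b≈0
        (λ eq′ → ih b≈0 (P.trans (P.*-comm (a ∷ p) q) eq′))
        (P.trans (P.*-comm (b ∷ q) (a ∷ p)) eq)
    byCases (no a≉0) (no b≉0) _ _ eq =
      *-≉0 a≉0 b≉0 (trans (sym (+-identityʳ _)) (at eq 0))

  infix 4 _≟ₚ0
  _≟ₚ0 : ∀ p → Dec (p P.≈ P.0#)
  []      ≟ₚ0 = yes P.refl
  (a ∷ p) ≟ₚ0 with a ≟ 0# | p ≟ₚ0
  ... | yes a≈0 | yes p≈0 = yes (∷≈0 a≈0 p≈0)
  ... | no  a≉0 | _       = no λ eq → a≉0 (at eq 0)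
  ... | yes _   | no p≉0  = no λ eq → p≉0 (mk≈ (at eq ∘ suc))

record IntegralDomain c ℓ : Set (lsuc (c ⊔ ℓ)) where
  field
    commutativeRing : CommutativeRing c ℓ

  open CommutativeRing commutativeRing public

  field
    _≟0  : ∀ x → Dec (x ≈ 0#)
    1≉0  : 1# ≉ 0#
    *-≉0 : ∀ x y → x ≉ 0# → y ≉ 0# → x * y ≉ 0#

module Fractions {c ℓ} (D : IntegralDomain c ℓ) where

  open IntegralDomain D

  record Fraction : Set (c ⊔ ℓ) where
    constructor fraction
    field
      num   : Carrier
      den   : Carrier
      den≉0 : den ≉ 0#
  open Fraction public

  infix 4 _≈ꟳ_
  record _≈ꟳ_ (p q : Fraction) : Set ℓ where
    constructor mk≈
    field cross : num p * den q ≈ num q * den p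
  open _≈ꟳ_ public

  infixl 6 _+ꟳ_
  infixl 7 _*ꟳ_
  infix  8 -ꟳ_

  _+ꟳ_ _*ꟳ_ : Op₂ Fraction
  p +ꟳ q = fraction (num p * den q + num q * den p) (den p * den q)
                    (*-≉0 _ _ (den≉0 p) (den≉0 q))
  p *ꟳ q = fraction (num p * num q) (den p * den q)
                    (*-≉0 _ _ (den≉0 p) (den≉0 q))

  -ꟳ_ : Op₁ Fraction
  -ꟳ p = fraction (- num p) (den p) (den≉0 p)

  embed : Carrier → Fraction
  embed a = fraction a 1# 1≉0

  _⁻¹ꟳ : Op₁ Fraction
  p ⁻¹ꟳ with num p ≟0
  ... | yes _     = embed 0#
  ... | no  num≉0 = fraction (den p) (num p) num≉0

  private
    open RingProperties ring using (-‿distribˡ-*; x≈y⇒x∙y⁻¹≈ε; x∙y⁻¹≈ε⇒x≈y; -‿distribʳ-*)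
    open SetoidReasoning setoid
    open Solver commutativeSemiring using (solve; _:=_; _:+_; _:*_; con)

    cancelˡ : ∀ {x y z} → x ≉ 0# → x * y ≈ x * z → y ≈ z
    cancelˡ {x} {y} {z} x≉0 xy≈xz with (y - z) ≟0
    ... | yes y-z≈0 = x∙y⁻¹≈ε⇒x≈y y z y-z≈0
    ... | no  y-z≉0 = contradiction (begin
      x * (y - z)        ≈⟨ distribˡ x y (- z) ⟩
      x * y + x * - z    ≈⟨ +-cong xy≈xz (sym (-‿distribʳ-* x z)) ⟩
      x * z - x * z      ≈⟨ -‿inverseʳ _ ⟩
      0#                 ∎) (*-≉0 _ _ x≉0 y-z≉0)

    ≈ꟳ-trans : ∀ {p q r} → p ≈ꟳ q → q ≈ꟳ r → p ≈ꟳ r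
    ≈ꟳ-trans {p} {q} {r} (mk≈ pq) (mk≈ qr) = mk≈ (cancelˡ (den≉0 q) (begin
      den q * (num p * den r) ≈⟨ solve 3 (λ a b c → a :* (b :* c) := b :* a :* c) refl _ _ _ ⟩
      num p * den q * den r   ≈⟨ *-congʳ pq ⟩
      num q * den p * den r   ≈⟨ solve 3 (λ a b c → a :* b :* c := a :* c :* b) refl _ _ _ ⟩
      num q * den r * den p   ≈⟨ *-congʳ qr ⟩
      num r * den q * den p   ≈⟨ solve 3 (λ a b c → a :* b :* c := b :* (a :* c)) refl _ _ _ ⟩
      den q * (num r * den p) ∎))

    ≈ꟳ-isEquivalence : IsEquivalence _≈ꟳ_
    ≈ꟳ-isEquivalence = record
      { refl = mk≈ refl ; sym = λ eq → mk≈ (sym (cross eq)) ; trans = ≈ꟳ-trans }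

    ≈ꟳ-setoid : Setoid (c ⊔ ℓ) ℓ
    ≈ꟳ-setoid = record { isEquivalence = ≈ꟳ-isEquivalence }

    +ꟳ-cong : ∀ {p p′ q q′} → p ≈ꟳ p′ → q ≈ꟳ q′ → p +ꟳ q ≈ꟳ p′ +ꟳ q′
    +ꟳ-cong {p} {p′} {q} {q′} (mk≈ pp′) (mk≈ qq′) = mk≈ (begin
      (num p * den q + num q * den p) * (den p′ * den q′)
        ≈⟨ solve 6 (λ a b c d e f → (a :* d :+ c :* b) :* (e :* f) :=
             a :* e :* (d :* f) :+ c :* f :* (b :* e)) refl _ _ _ _ _ _ ⟩
      num p * den p′ * (den q * den q′) + num q * den q′ * (den p * den p′)
        ≈⟨ +-cong (*-congʳ pp′) (*-congʳ qq′) ⟩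
      num p′ * den p * (den q * den q′) + num q′ * den q * (den p * den p′)
        ≈⟨ solve 6 (λ a b c d e f → a :* e :* (f :* d) :+ c :* f :* (e :* b) :=
             (a :* d :+ c :* b) :* (e :* f)) refl _ _ _ _ _ _ ⟩
      (num p′ * den q′ + num q′ * den p′) * (den p * den q) ∎)

    *ꟳ-cong : ∀ {p p′ q q′} → p ≈ꟳ p′ → q ≈ꟳ q′ → p *ꟳ q ≈ꟳ p′ *ꟳ q′
    *ꟳ-cong {p} {p′} {q} {q′} (mk≈ pp′) (mk≈ qq′) = mk≈ (begin
      num p * num q * (den p′ * den q′)     ≈⟨ interchange _ _ _ _ ⟩
      num p * den p′ * (num q * den q′)     ≈⟨ *-cong pp′ qq′ ⟩
      num p′ * den p * (num q′ * den q)     ≈⟨ interchange _ _ _ _ ⟩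
      num p′ * num q′ * (den p * den q)     ∎)
      where
      interchange : ∀ a b c d → a * b * (c * d) ≈ a * c * (b * d)
      interchange = solve 4 (λ a b c d → a :* b :* (c :* d) := a :* c :* (b :* d)) refl

    -ꟳ-cong : ∀ {p q} → p ≈ꟳ q → -ꟳ p ≈ꟳ -ꟳ q
    -ꟳ-cong {p} {q} (mk≈ pq) = mk≈ (begin
      - num p * den q   ≈⟨ -‿distribˡ-* _ _ ⟨
      - (num p * den q) ≈⟨ -‿cong pq ⟩
      - (num q * den p) ≈⟨ -‿distribˡ-* _ _ ⟩
      - num q * den p   ∎)

    +ꟳ-assoc : ∀ p q r → (p +ꟳ q) +ꟳ r ≈ꟳ p +ꟳ (q +ꟳ r)
    +ꟳ-assoc p q r = mk≈ (solve 6 (λ a b c d e f →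
      ((a :* d :+ c :* b) :* f :+ e :* (b :* d)) :* (b :* (d :* f)) :=
      (a :* (d :* f) :+ (c :* f :+ e :* d) :* b) :* (b :* d :* f)) refl
      (num p) (den p) (num q) (den q) (num r) (den r))

    +ꟳ-comm : ∀ p q → p +ꟳ q ≈ꟳ q +ꟳ p
    +ꟳ-comm p q = mk≈ (solve 4 (λ a b c d →
      (a :* d :+ c :* b) :* (d :* b) := (c :* b :+ a :* d) :* (b :* d)) refl
      (num p) (den p) (num q) (den q))

    +ꟳ-identityˡ : ∀ p → embed 0# +ꟳ p ≈ꟳ p
    +ꟳ-identityˡ p = mk≈ (solve 2 (λ a b →
      (con 0 :* b :+ a :* con 1) :* b := a :* (con 1 :* b)) refl (num p) (den p))

    +ꟳ-inverseˡ : ∀ p → -ꟳ p +ꟳ p ≈ꟳ embed 0#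
    +ꟳ-inverseˡ p = mk≈ (*-cong-0 (begin
      - num p * den p + num p * den p ≈⟨ distribʳ _ _ _ ⟨
      (- num p + num p) * den p       ≈⟨ *-congʳ (-‿inverseˡ _) ⟩
      0# * den p                      ≈⟨ zeroˡ _ ⟩
      0#                              ∎))
      where
      *-cong-0 : ∀ {x y z} → x ≈ 0# → x * y ≈ 0# * z
      *-cong-0 {x} {y} {z} x≈0 = trans (*-congʳ x≈0) (trans (zeroˡ y) (sym (zeroˡ z)))

    *ꟳ-assoc : ∀ p q r → (p *ꟳ q) *ꟳ r ≈ꟳ p *ꟳ (q *ꟳ r)
    *ꟳ-assoc p q r = mk≈ (*-cong (*-assoc _ _ _) (sym (*-assoc _ _ _)))

    *ꟳ-comm : ∀ p q → p *ꟳ q ≈ꟳ q *ꟳ p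
    *ꟳ-comm p q = mk≈ (*-cong (*-comm _ _) (*-comm _ _))

    *ꟳ-identityˡ : ∀ p → embed 1# *ꟳ p ≈ꟳ p
    *ꟳ-identityˡ p = mk≈ (trans (*-congʳ (*-identityˡ _)) (*-congˡ (sym (*-identityˡ _))))

    *ꟳ-distribˡ : ∀ p q r → p *ꟳ (q +ꟳ r) ≈ꟳ p *ꟳ q +ꟳ p *ꟳ r
    *ꟳ-distribˡ p q r = mk≈ (solve 6 (λ a b c d e f →
      a :* (c :* f :+ e :* d) :* (b :* d :* (b :* f)) :=
      (a :* c :* (b :* f) :+ a :* e :* (b :* d)) :* (b :* (d :* f))) refl
      (num p) (den p) (num q) (den q) (num r) (den r))

    fractionRing : CommutativeRing (c ⊔ ℓ) ℓ
    fractionRing = record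
      { Carrier = Fraction
      ; _≈_     = _≈ꟳ_
      ; _+_     = _+ꟳ_
      ; _*_     = _*ꟳ_
      ; -_      = -ꟳ_
      ; 0#      = embed 0#
      ; 1#      = embed 1#
      ; isCommutativeRing = record
        { isRing = record
          { +-isAbelianGroup = record
            { isGroup = record
              { isMonoid = record
                { isSemigroup = record
                  { isMagma = record { isEquivalence = ≈ꟳ-isEquivalence ; ∙-cong = +ꟳ-cong }
                  ; assoc   = +ꟳ-assoc
                  }
                ; identity = comm∧idˡ⇒id +ꟳ-comm {e = embed 0#} +ꟳ-identityˡ
                }
              ; inverse = comm∧invˡ⇒inv {_⁻¹ = -ꟳ_} {e = embed 0#} +ꟳ-comm +ꟳ-inverseˡ
              ; ⁻¹-cong = -ꟳ-cong
              }
            ; comm = +ꟳ-comm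
            }
          ; *-cong     = *ꟳ-cong
          ; *-assoc    = *ꟳ-assoc
          ; *-identity = comm∧idˡ⇒id *ꟳ-comm {e = embed 1#} *ꟳ-identityˡ
          ; distrib    = comm∧distrˡ⇒distr +ꟳ-cong *ꟳ-comm *ꟳ-distribˡ
          }
        ; *-comm = *ꟳ-comm
        }
      }
      where
      open Consequences ≈ꟳ-setoid
        using (comm∧idˡ⇒id; comm∧invˡ⇒inv; comm∧distrˡ⇒distr)

    num≈0⇒≈0 : ∀ {p} → num p ≈ 0# → p ≈ꟳ embed 0#
    num≈0⇒≈0 {p} num≈0 =
      mk≈ (trans (*-congʳ num≈0) (trans (zeroˡ _) (sym (zeroˡ (den p)))))

    ⁻¹ꟳ-inverseʳ : ∀ {p} → ¬ p ≈ꟳ embed 0# → p *ꟳ p ⁻¹ꟳ ≈ꟳ embed 1#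
    ⁻¹ꟳ-inverseʳ {p} p≉0 with num p ≟0
    ... | yes num≈0 = contradiction (num≈0⇒≈0 num≈0) p≉0
    ... | no  _     = mk≈ (trans (*-identityʳ _) (trans (*-comm _ _) (sym (*-identityˡ _))))

    _≟ꟳ_ : Decidable _≈ꟳ_
    p ≟ꟳ q with (num p * den q - num q * den p) ≟0
    ... | yes eq = yes (mk≈ (x∙y⁻¹≈ε⇒x≈y _ _ eq))
    ... | no ¬eq = no λ p≈q → ¬eq (x≈y⇒x∙y⁻¹≈ε (cross p≈q))

  fractionField : Field (c ⊔ ℓ) ℓ
  fractionField = record
    { commutativeRing = fractionRing
    ; _≟_             = _≟ꟳ_
    ; 1≉0             = λ eq → 1≉0 (trans (sym (*-identityʳ 1#))
                                     (trans (cross eq) (zeroˡ 1#)))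
    ; _⁻¹             = _⁻¹ꟳ
    ; *-inverseʳ      = ⁻¹ꟳ-inverseʳ
    }

module RationalFunctions {c ℓ} (K : Field c ℓ) where

  private
    module K = Field K
    module P = Polynomials K.commutativeRing
    open PolynomialsOverField K using (_≟ₚ0; *ₚ-≉0)

  polynomialDomain : IntegralDomain c ℓ
  polynomialDomain = record
    { commutativeRing = P.polynomialRing
    ; _≟0             = _≟ₚ0
    ; 1≉0             = λ eq → K.1≉0 (P.at eq 0)
    ; *-≉0            = *ₚ-≉0
    }

  private module F = Fractions polynomialDomain

  rationalFunctionField : Field (c ⊔ ℓ) ℓ
  rationalFunctionField = F.fractionField

  open Field rationalFunctionField

  X : Carrier
  X = F.embed P.indeterminate

  C : K.Carrier → Carrier
  C a = F.embed (P.constant a)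

module Matrices {c ℓ} (R : CommutativeRing c ℓ) where

  open CommutativeRing R hiding (zero)
  open Algebra.Definitions.RawSemiring (Semiring.rawSemiring semiring) using (sum; _^_)

  Matrix : ℕ → Set c
  Matrix n = Vector (Vector Carrier n) n

  infix  4 _≈ᴹ_
  infixl 7 _·_

  _≈ᴹ_ : ∀ {n} → Rel (Matrix n) ℓ
  M ≈ᴹ N = ∀ i j → M i j ≈ N i j

  I : ∀ {n} → Matrix n
  I i j = if does (i Fin.≟ j) then 1# else 0#

  _·_ : ∀ {n} → Op₂ (Matrix n)
  (M · N) i j = sum λ k → M i k * N k j

  InvertibleMatrix : ∀ {n} → Matrix n → Set (c ⊔ ℓ)
  InvertibleMatrix = Algebra.Definitions.Invertible _≈ᴹ_ I _·_

  entrySum : ∀ {n} → Matrix n → Carrier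
  entrySum M = sum λ i → sum λ j → M i j

  -- Laplace expansion along the first row.
  det : ∀ {n} → Matrix n → Carrier
  det {zero}  M = 1#
  det {suc n} M =
    sum λ j → (- 1#) ^ toℕ j * M zero j * det (λ i k → M (suc i) (punchIn j k))

module Spectra {c ℓ₁ ℓ₂} (K : OrderedField c ℓ₁ ℓ₂) where

  private
    module K  = OrderedField K
    module K∑ = Algebra.Definitions.RawSemiring (Semiring.rawSemiring K.semiring)
    module KM = Matrices K.commutativeRing

  open RationalFunctions K.baseField public
  open Field rationalFunctionField public hiding (zero)
  open Algebra.Definitions.RawSemiring (Semiring.rawSemiring semiring) public
    using (product; _^_) renaming (_×_ to _•_)
  open Matrices commutativeRing using (Matrix; InvertibleMatrix; I; det; entrySum)

  xI-_ : ∀ {n} → KM.Matrix n → Matrix n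
  (xI- M) i j = X * I i j - C (M i j)

  f : ∀ {n} → KM.Matrix n → Carrier
  f M = det (xI- M)

  -- (xI - M)⁻¹ together with the proof that it is a two-sided inverse.
  Resolvent : ∀ {n} → KM.Matrix n → Set (c ⊔ ℓ₁)
  Resolvent M = InvertibleMatrix (xI- M)

  χ : ∀ {n} {M : KM.Matrix n} → Resolvent M → Carrier
  χ (inverse , _) = entrySum inverse

  -- λs are the eigenvalues of M with algebraic multiplicity, all lying in K.
  record IsSpectrum {n} (M : KM.Matrix n) (λs : Vector K.Carrier n) : Set (ℓ₁ ⊔ ℓ₂) where
    field
      splits     : f M ≈ product λ i → X - C (λs i)
      decreasing : ∀ {i j} → i Fin.≤ j → λs j K.≤ λs i

  -- For the spectrum λs of a connected r-regular graph on n vertices: θs lists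
  -- the distinct eigenvalues other than r, so no divisor r - θ is zero.
  P : ∀ {n} → ℕ → Vector K.Carrier n → K.Carrier → K.Carrier
  P {n} r λs x =
    n K∑.× K.1# K.* List.foldr K._*_ K.1# (List.map (λ θ → (x K.- θ) K./ (r′ K.- θ)) θs)
    where
    r′ : K.Carrier
    r′ = r K∑.× K.1#

    θs : List K.Carrier
    θs = filter (λ θ → ¬? (θ K.≟ r′)) (deduplicate K._≟_ (tabulate λs))

record Graph (V : Set) : Set₁ where
  infix 4 _~_ _~?_
  field
    _~_      : Rel V 0ℓ
    _~?_     : Decidable _~_
    ~-sym    : Symmetric _~_
    ~-irrefl : Irreflexive _≡_ _~_

record Connected {V : Set} (G : Graph V) : Set where
  open Graph G
  field
    nonempty  : V
    reachable : ∀ u v → Star _~_ u v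

relabel : ∀ {V W : Set} → W ↔ V → Graph V → Graph W
relabel W↔V G = record
  { _~_      = λ u v → to u ~ to v
  ; _~?_     = λ u v → to u ~? to v
  ; ~-sym    = ~-sym
  ; ~-irrefl = λ { ≡.refl → ~-irrefl ≡.refl }
  }
  where
  open Graph G
  open Inverse W↔V using (to)

module _ {n} (G : Graph (Fin n)) where

  open Graph G

  degree : Fin n → ℕ
  degree v = length (filter (v ~?_) (allFin n))

  Regular : ℕ → Set
  Regular r = ∀ v → degree v ≡ r

  edges : List (Fin n × Fin n)
  edges = filter (λ (u , v) → (u Fin.<? v) ×-dec (u ~? v))
                 (cartesianProduct (allFin n) (allFin n))

  size : ℕ
  size = length edges

  infix 4 _∈ₑ_ _∈ₑ?_
  _∈ₑ_ : Fin n → Fin size → Set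
  v ∈ₑ e = v ≡ proj₁ (lookup edges e) ⊎ v ≡ proj₂ (lookup edges e)

  _∈ₑ?_ : Decidable _∈ₑ_
  v ∈ₑ? e = (v Fin.≟ _) ⊎-dec (v Fin.≟ _)

  -- inj₁ is an original vertex, inj₂ the vertex subdividing an edge.
  centralGraph : Graph (Fin n ⊎ Fin size)
  centralGraph = record
    { _~_      = _~ᶜ_
    ; _~?_     = _~ᶜ?_
    ; ~-sym    = λ {a} {b} → ~ᶜ-sym {a} {b}
    ; ~-irrefl = λ { {a} ≡.refl → ~ᶜ-irrefl {a} }
    }
    where
    _~ᶜ_ : Rel (Fin n ⊎ Fin size) 0ℓ
    inj₁ u ~ᶜ inj₁ v = ¬ u ≡ v × ¬ u ~ v
    inj₁ u ~ᶜ inj₂ e = u ∈ₑ e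
    inj₂ e ~ᶜ inj₁ u = u ∈ₑ e
    inj₂ _ ~ᶜ inj₂ _ = ⊥

    _~ᶜ?_ : Decidable _~ᶜ_
    inj₁ u ~ᶜ? inj₁ v = ¬? (u Fin.≟ v) ×-dec ¬? (u ~? v)
    inj₁ u ~ᶜ? inj₂ e = u ∈ₑ? e
    inj₂ e ~ᶜ? inj₁ u = u ∈ₑ? e
    inj₂ _ ~ᶜ? inj₂ _ = no λ ()

    ~ᶜ-sym : Symmetric _~ᶜ_
    ~ᶜ-sym {inj₁ u} {inj₁ v} (u≢v , u≁v) = u≢v ∘ ≡.sym , u≁v ∘ ~-sym
    ~ᶜ-sym {inj₁ u} {inj₂ e} u∈e         = u∈e
    ~ᶜ-sym {inj₂ e} {inj₁ u} u∈e         = u∈e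

    ~ᶜ-irrefl : ∀ {a} → ¬ a ~ᶜ a
    ~ᶜ-irrefl {inj₁ u} (u≢u , _) = u≢u ≡.refl

module _ {n₁ n₂} (G₁ : Graph (Fin n₁)) (G₂ : Graph (Fin n₂)) where

  private
    module G₂ = Graph G₂
    module C₁ = Graph (centralGraph G₁)

  CoronaVertex : Set
  CoronaVertex = (Fin n₁ ⊎ Fin (size G₁)) ⊎ (Fin (size G₁) × Fin n₂)

  -- inj₂ (e , v) is the vertex v of the copy of G₂ belonging to the edge e.
  corona : Graph CoronaVertex
  corona = record
    { _~_      = _~ᵏ_
    ; _~?_     = _~ᵏ?_
    ; ~-sym    = λ {a} {b} → ~ᵏ-sym {a} {b}
    ; ~-irrefl = λ { {a} ≡.refl → ~ᵏ-irrefl {a} }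
    }
    where
    _~ᵏ_ : Rel CoronaVertex 0ℓ
    inj₁ a       ~ᵏ inj₁ b        = a C₁.~ b
    inj₁ a       ~ᵏ inj₂ (e , _)  = a C₁.~ inj₂ e
    inj₂ (e , _) ~ᵏ inj₁ a        = a C₁.~ inj₂ e
    inj₂ (e , u) ~ᵏ inj₂ (e′ , v) = e ≡ e′ × u G₂.~ v

    _~ᵏ?_ : Decidable _~ᵏ_
    inj₁ a       ~ᵏ? inj₁ b        = a C₁.~? b
    inj₁ a       ~ᵏ? inj₂ (e , _)  = a C₁.~? inj₂ e
    inj₂ (e , _) ~ᵏ? inj₁ a        = a C₁.~? inj₂ e
    inj₂ (e , u) ~ᵏ? inj₂ (e′ , v) = (e Fin.≟ e′) ×-dec (u G₂.~? v)

    ~ᵏ-sym : Symmetric _~ᵏ_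
    ~ᵏ-sym {inj₁ a} {inj₁ b} a~b          = C₁.~-sym {a} {b} a~b
    ~ᵏ-sym {inj₁ a} {inj₂ _} a~e          = a~e
    ~ᵏ-sym {inj₂ _} {inj₁ a} a~e          = a~e
    ~ᵏ-sym {inj₂ _} {inj₂ _} (e≡e′ , u~v) = ≡.sym e≡e′ , G₂.~-sym u~v

    ~ᵏ-irrefl : ∀ {a} → ¬ a ~ᵏ a
    ~ᵏ-irrefl {inj₁ a} a~a       = C₁.~-irrefl {a} ≡.refl a~a
    ~ᵏ-irrefl {inj₂ _} (_ , v~v) = G₂.~-irrefl ≡.refl v~v

infixl 7 _⊡_
_⊡_ : ∀ {n₁ n₂} (G₁ : Graph (Fin n₁)) → Graph (Fin n₂) →
      Graph (Fin (n₁ ℕ.+ size G₁ ℕ.+ size G₁ ℕ.* n₂))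
G₁ ⊡ G₂ = relabel ((Fin.+↔⊎ ⊎-↔ Fin.*↔×) ↔-∘ Fin.+↔⊎) (corona G₁ G₂)

module _ {c ℓ} (R : CommutativeRing c ℓ) where

  open CommutativeRing R

  adjacencyMatrix : ∀ {n} → Graph (Fin n) → Matrices.Matrix R n
  adjacencyMatrix G u v = if does (Graph._~?_ G u v) then 1# else 0#

module Submission where

-- Order the vertices of the corona as those of G₁, the subdivision vertices
-- and the copies of G₂.  With A₁, A₂ the adjacency matrices of G₁, G₂, B the
-- vertex-edge incidence matrix of G₁ and S = x I - A₂, the characteristic
-- matrix has the blocks
--
--     x I - (J - I - A₁)    - B      - B ⊗ 1ᵀ
--     - Bᵀ                  x I        0
--     - Bᵀ ⊗ 1               0        I ⊗ S
--
-- Taking the Schur complement of I ⊗ S and then that of x I (det-schur in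
-- BlockDeterminants, used in det-corona of Corona) leaves x^m₁ det(S)^m₁ times
-- the determinant of x I - (J - I - A₁) - (χ + 1/x) B Bᵀ.  Since
-- B Bᵀ = A₁ + r₁ I (gram in GraphMatrices), this matrix is a I + b A₁ - J with
-- a = x + 1 - r₁ χ - r₁/x and b = 1 - χ - 1/x.
--
-- It remains to see that det (a I + b A₁ - J) is the product over the
-- eigenvalues λ of a - P(λ) + b λ.  All columns of a I + b A₁ have the sum
-- s = a + b r₁.  Replacing row 0 of a matrix by the sum of its rows shows that
-- det (M + t J) = (s + n t) d(M) for any matrix M of size n with constant
-- column sum s, where d(M) is the determinant of M with row 0 replaced by ones
-- (det-+J).  In particular the characteristic polynomial of A₁ is
-- (x - r₁) d(x I - A₁), so r₁ is one of the eigenvalues, and d(x I - A₁) is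
-- the product of x - λ over the remaining ones (splits-withOnes).  This is an
-- identity of polynomials, hence d(a I + b A₁) is the product of a + b λ over
-- the remaining eigenvalues: for b ≠ 0 take x = - a/b (det-withOnes-pencil).
-- Finally r₁ is not among the remaining eigenvalues.  Otherwise d(r₁ I - A₁)
-- would vanish, and with it det (r₁ I - A₁ + J); but connectedness makes the
-- quadratic form of that matrix vanish only at 0 (Laplacian), and this
-- excludes a zero determinant (Anisotropic).  So P takes the value n₁ at one
-- eigenvalue, counted with multiplicity, and 0 at all others (PValues).

open import Defs
open import Algebra.Bundles using (CommutativeRing; RawRing)
import Algebra.Morphism.Construct.Composition as Composition
import Algebra.Morphism.Construct.Identity as Identity
open import Algebra.Morphism.Structures using (module RingMorphisms)
import Algebra.Properties.CommutativeMonoid.Sum as CommutativeMonoidSum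
import Algebra.Properties.Ring as RingProperties
import Algebra.Properties.Semiring.Exp as Exp
import Algebra.Properties.Semiring.Mult as Mult
import Algebra.Properties.Semiring.Mult.TCOptimised as MultOptimised
import Algebra.Properties.Semiring.Sum as Sum
import Algebra.Solver.Ring as RingSolver
open import Algebra.Solver.Ring.AlmostCommutativeRing using (_-Raw-AlmostCommutative⟶_; fromCommutativeRing)
import Algebra.Solver.Ring.NaturalCoefficients.Default as NaturalSolver
open import Data.Fin.Base as Fin using (Fin; zero; suc; toℕ; punchIn; pinch; _↑ˡ_; _↑ʳ_; splitAt; combine; remQuot)
import Data.Fin.Properties as Fin
open import Data.List.Base as List using (List; []; _∷_; _++_; length; filter; deduplicate; lookup; allFin; cartesianProduct; tabulate)
import Data.List.Membership.Setoid.Properties as Membership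
open import Data.List.Relation.Unary.All using (All; []; _∷_)
import Data.List.Relation.Unary.All.Properties as All
open import Data.List.Relation.Unary.Any using (Any; here; there)
import Data.List.Relation.Unary.Any as Any
open import Data.Bool.Base using (if_then_else_)
open import Data.Maybe.Base using (Maybe; just; nothing)
open import Data.Nat.Base as ℕ using (ℕ; zero; suc)
import Data.Nat.Properties as ℕ
open import Data.Product.Base using (_×_; _,_; proj₁; proj₂; Σ-syntax)
open import Data.Sum.Base using (_⊎_; inj₁; inj₂; [_,_]′)
open import Data.Sum.Function.Propositional using (_⊎-↔_)
open import Data.Vec.Functional using (Vector; updateAt)
open import Data.Vec.Functional.Properties using (updateAt-updates; updateAt-minimal)
open import Function.Base using (const; id; _∘_)
open import Function.Bundles using (Inverse)
open import Function.Construct.Composition using (_↔-∘_)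
open import Relation.Binary.Construct.Closure.ReflexiveTransitive using (Star; ε; _◅_)
open import Relation.Binary.Definitions using (tri<; tri≈; tri>)
open import Relation.Binary.PropositionalEquality as ≡ using (_≡_; _≢_)
import Relation.Binary.Reasoning.Setoid as SetoidReasoning
open import Relation.Binary.Structures using (IsTotalOrder)
open import Relation.Nullary using (¬_; Dec; yes; no; does; contradiction; ¬?; _×-dec_; _⊎-dec_)
open import Relation.Unary using (Pred; Decidable)

-- Identities in commutative rings

-- A normaliser for identities in an arbitrary commutative ring, with integer
-- coefficients.  The coefficient (m , n) stands for m - n; the pairs need
-- not be reduced.
module RingIdentities {c ℓ} (R : CommutativeRing c ℓ) where

  open CommutativeRing R hiding (zero)
  open MultOptimised semiring using (×-homo-+; ×1-homo-*) renaming (_×_ to _•_)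
  open RingProperties ring using (-0#≈0#; -‿distribˡ-*; -‿distribʳ-*; -‿involutive; -‿anti-homo-+)
  open SetoidReasoning setoid

  private
    module N = NaturalSolver commutativeSemiring

    coefficients : RawRing _ _
    coefficients = record
      { Carrier = ℕ × ℕ
      ; _≈_     = _≡_
      ; _+_     = λ (a , b) (c , d) → a ℕ.+ c , b ℕ.+ d
      ; _*_     = λ (a , b) (c , d) → a ℕ.* c ℕ.+ b ℕ.* d , a ℕ.* d ℕ.+ b ℕ.* c
      ; -_      = λ (a , b) → b , a
      ; 0#      = 0 , 0
      ; 1#      = 1 , 0
      }

    -- The first clause makes the numeral (n , 0) denote n • 1# on the nose.
    ⟦_⟧ : ℕ × ℕ → Carrier
    ⟦ a , zero  ⟧ = a • 1#
    ⟦ a , suc b ⟧ = a • 1# - suc b • 1#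

    value : ∀ a b → ⟦ a , b ⟧ ≈ a • 1# - b • 1#
    value a zero    = sym (trans (+-congˡ -0#≈0#) (+-identityʳ _))
    value a (suc b) = refl

    neg-+ : ∀ x y → - (x + y) ≈ - x + - y
    neg-+ x y = trans (-‿anti-homo-+ x y) (+-comm _ _)

    +-homo : ∀ x y → ⟦ RawRing._+_ coefficients x y ⟧ ≈ ⟦ x ⟧ + ⟦ y ⟧
    +-homo (a , b) (c , d) = begin
      ⟦ a ℕ.+ c , b ℕ.+ d ⟧                         ≈⟨ value (a ℕ.+ c) (b ℕ.+ d) ⟩
      (a ℕ.+ c) • 1# - (b ℕ.+ d) • 1#               ≈⟨ +-cong (×-homo-+ 1# a c) (-‿cong (×-homo-+ 1# b d)) ⟩
      a • 1# + c • 1# - (b • 1# + d • 1#)           ≈⟨ +-congˡ (neg-+ _ _) ⟩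
      a • 1# + c • 1# + (- (b • 1#) + - (d • 1#))   ≈⟨ N.solve 4 (λ a b c d → a N.:+ c N.:+ (b N.:+ d) N.:= a N.:+ b N.:+ (c N.:+ d)) refl _ _ _ _ ⟩
      a • 1# - b • 1# + (c • 1# - d • 1#)           ≈⟨ +-cong (value a b) (value c d) ⟨
      ⟦ a , b ⟧ + ⟦ c , d ⟧                         ∎

    product-of-differences : ∀ x y z w → x * z + y * w - (x * w + y * z) ≈ (x - y) * (z - w)
    product-of-differences x y z w = begin
      x * z + y * w - (x * w + y * z)                     ≈⟨ +-congˡ (neg-+ _ _) ⟩
      x * z + y * w + (- (x * w) + - (y * z))             ≈⟨ +-congˡ (+-cong (-‿distribʳ-* x w) (-‿distribˡ-* y z)) ⟩
      x * z + y * w + (x * - w + - y * z)                 ≈⟨ +-congʳ (+-congˡ (trans (-‿cong (sym (-‿distribʳ-* y w))) (-‿involutive _))) ⟨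
      x * z + - (y * - w) + (x * - w + - y * z)           ≈⟨ +-congʳ (+-congˡ (-‿distribˡ-* y (- w))) ⟩
      x * z + - y * - w + (x * - w + - y * z)             ≈⟨ N.solve 4 (λ x y z w → x N.:* z N.:+ y N.:* w N.:+ (x N.:* w N.:+ y N.:* z) N.:= (x N.:+ y) N.:* (z N.:+ w)) refl x (- y) z (- w) ⟩
      (x - y) * (z - w)                                   ∎

    products : ∀ a b c d → (a ℕ.* c ℕ.+ b ℕ.* d) • 1# ≈ (a • 1#) * (c • 1#) + (b • 1#) * (d • 1#)
    products a b c d = trans (×-homo-+ 1# (a ℕ.* c) (b ℕ.* d)) (+-cong (×1-homo-* a c) (×1-homo-* b d))

    *-homo : ∀ x y → ⟦ RawRing._*_ coefficients x y ⟧ ≈ ⟦ x ⟧ * ⟦ y ⟧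
    *-homo (a , b) (c , d) = begin
      ⟦ a ℕ.* c ℕ.+ b ℕ.* d , a ℕ.* d ℕ.+ b ℕ.* c ⟧                     ≈⟨ value (a ℕ.* c ℕ.+ b ℕ.* d) (a ℕ.* d ℕ.+ b ℕ.* c) ⟩
      (a ℕ.* c ℕ.+ b ℕ.* d) • 1# - (a ℕ.* d ℕ.+ b ℕ.* c) • 1#           ≈⟨ +-cong (products a b c d) (-‿cong (products a b d c)) ⟩
      (a • 1#) * (c • 1#) + (b • 1#) * (d • 1#) - ((a • 1#) * (d • 1#) + (b • 1#) * (c • 1#)) ≈⟨ product-of-differences _ _ _ _ ⟩
      (a • 1# - b • 1#) * (c • 1# - d • 1#)                             ≈⟨ *-cong (value a b) (value c d) ⟨
      ⟦ a , b ⟧ * ⟦ c , d ⟧                                             ∎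

    -‿homo : ∀ x → ⟦ RawRing.-_ coefficients x ⟧ ≈ - ⟦ x ⟧
    -‿homo (a , b) = begin
      ⟦ b , a ⟧              ≈⟨ value b a ⟩
      b • 1# - a • 1#        ≈⟨ +-comm _ _ ⟩
      - (a • 1#) + b • 1#    ≈⟨ +-congˡ (-‿involutive _) ⟨
      - (a • 1#) - - (b • 1#) ≈⟨ neg-+ _ _ ⟨
      - (a • 1# - b • 1#)    ≈⟨ -‿cong (value a b) ⟨
      - ⟦ a , b ⟧            ∎

    homomorphism : coefficients -Raw-AlmostCommutative⟶ fromCommutativeRing R
    homomorphism = record
      { ⟦_⟧    = ⟦_⟧
      ; +-homo = +-homo
      ; *-homo = *-homo
      ; -‿homo = -‿homo
      ; 0-homo = refl
      ; 1-homo = refl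
      }

    _≟_ : ∀ x y → Maybe (⟦ x ⟧ ≈ ⟦ y ⟧)
    (a , b) ≟ (c , d) with a ℕ.+ d ℕ.≟ c ℕ.+ b
    ... | no  _  = nothing
    ... | yes eq = just (begin
      ⟦ a , b ⟧                            ≈⟨ value a b ⟩
      a • 1# - b • 1#                      ≈⟨ +-identityʳ _ ⟨
      a • 1# - b • 1# + 0#                 ≈⟨ +-congˡ (-‿inverseʳ _) ⟨
      a • 1# - b • 1# + (d • 1# - d • 1#)  ≈⟨ N.solve 4 (λ a b c d → a N.:+ b N.:+ (c N.:+ d) N.:= a N.:+ c N.:+ (b N.:+ d)) refl _ _ _ _ ⟩
      a • 1# + d • 1# + (- (b • 1#) - d • 1#)  ≈⟨ +-congʳ (×-homo-+ 1# a d) ⟨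
      (a ℕ.+ d) • 1# + (- (b • 1#) - d • 1#)   ≡⟨ ≡.cong (λ n → n • 1# + (- (b • 1#) - d • 1#)) eq ⟩
      (c ℕ.+ b) • 1# + (- (b • 1#) - d • 1#)   ≈⟨ +-congʳ (×-homo-+ 1# c b) ⟩
      c • 1# + b • 1# + (- (b • 1#) - d • 1#)  ≈⟨ N.solve 4 (λ c b e d → c N.:+ b N.:+ (e N.:+ d) N.:= c N.:+ d N.:+ (b N.:+ e)) refl _ _ _ _ ⟩
      c • 1# - d • 1# + (b • 1# - b • 1#)  ≈⟨ +-congˡ (-‿inverseʳ _) ⟩
      c • 1# - d • 1# + 0#                 ≈⟨ +-identityʳ _ ⟩
      c • 1# - d • 1#                      ≈⟨ value c d ⟨
      ⟦ c , d ⟧                            ∎)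

  open RingSolver coefficients (fromCommutativeRing R) homomorphism _≟_ public
    using (solve; _:=_; _:+_; _:*_; _:-_; :-_; con)

-- Finite sums and products

module FiniteSums {c ℓ} (R : CommutativeRing c ℓ) where

  open CommutativeRing R hiding (zero)
  open Sum semiring public
  open SetoidReasoning setoid

  sum-cong : ∀ {n} {f g : Vector Carrier n} → (∀ i → f i ≈ g i) → sum f ≈ sum g
  sum-cong = sum-cong-≋

  sum-zero : ∀ {n} {f : Vector Carrier n} → (∀ i → f i ≈ 0#) → sum f ≈ 0#
  sum-zero {n} f≈0 = trans (sum-cong f≈0) (sum-replicate-zero n)

  sum-linear : ∀ {n} (f g : Vector Carrier n) a b →
               sum (λ i → a * f i + b * g i) ≈ a * sum f + b * sum g
  sum-linear f g a b = begin
    sum (λ i → a * f i + b * g i)                 ≈⟨ ∑-distrib-+ (λ i → a * f i) (λ i → b * g i) ⟩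
    sum (λ i → a * f i) + sum (λ i → b * g i)     ≈⟨ +-cong (*-distribˡ-sum a f) (*-distribˡ-sum b g) ⟨
    a * sum f + b * sum g                         ∎

  -- Splitting a sum over Fin (m + n) into its two blocks.
  sum-↑ : ∀ m {n} (f : Vector Carrier (m ℕ.+ n)) →
          sum f ≈ sum (λ i → f (i ↑ˡ n)) + sum (λ j → f (m ↑ʳ j))
  sum-↑ zero    f = sym (+-identityˡ _)
  sum-↑ (suc m) f = trans (+-congˡ (sum-↑ m (f ∘ suc))) (sym (+-assoc _ _ _))

module FiniteProducts {c ℓ} (R : CommutativeRing c ℓ) where

  open CommutativeRing R hiding (zero)
  open CommutativeMonoidSum *-commutativeMonoid public
    using ()
    renaming (sum to product; sum-cong-≋ to product-cong; sum-remove to product-remove; sum-replicate to product-replicate)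
  private module ×Sum = CommutativeMonoidSum *-commutativeMonoid
  open Exp semiring using (_^_)

  product-* : ∀ {n} (f g : Vector Carrier n) → product (λ i → f i * g i) ≈ product f * product g
  product-* = ×Sum.∑-distrib-+

  product-zero : ∀ {n} (f : Vector Carrier n) i → f i ≈ 0# → product f ≈ 0#
  product-zero f zero    f₀≈0 = trans (*-congʳ f₀≈0) (zeroˡ _)
  product-zero f (suc i) fᵢ≈0 = trans (*-congˡ (product-zero (f ∘ suc) i fᵢ≈0)) (zeroʳ _)

  product-1 : ∀ n → product {n} (const 1#) ≈ 1#
  product-1 zero    = refl
  product-1 (suc n) = trans (*-identityˡ _) (product-1 n)

  product-^ : ∀ {n} (f : Vector Carrier n) m → product f ^ m ≈ product (λ i → f i ^ m)
  product-^ {n} f zero    = sym (product-1 n)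
  product-^ f (suc m) = trans (*-congˡ (product-^ f m)) (sym (product-* f (λ i → f i ^ m)))

-- Determinants as alternating functions of the rows

module Determinants {c ℓ} (R : CommutativeRing c ℓ) where

  open CommutativeRing R hiding (zero)
  open Matrices R
  open FiniteSums R
  open Exp semiring using (_^_)
  open RingIdentities R
  open SetoidReasoning setoid

  private
    Row : ℕ → Set c
    Row = Vector Carrier

    -- The sign of column j in the expansion along row 0.
    sign : ∀ {n} → Fin n → Carrier
    sign j = (- 1#) ^ toℕ j

  -- The minor obtained by deleting row 0 and column j.
  minor : ∀ {n} → Matrix (suc n) → Fin (suc n) → Matrix n
  minor M j i k = M (suc i) (punchIn j k)

  I-diagonal : ∀ {n} (i : Fin n) → I i i ≈ 1#
  I-diagonal i with i Fin.≟ i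
  ... | yes _   = refl
  ... | no  i≢i = contradiction ≡.refl i≢i

  I-offDiagonal : ∀ {n} {i j : Fin n} → i ≢ j → I i j ≈ 0#
  I-offDiagonal {i = i} {j} i≢j with i Fin.≟ j
  ... | yes i≡j = contradiction i≡j i≢j
  ... | no  _   = refl

  I-sym : ∀ {n} (i j : Fin n) → I i j ≈ I j i
  I-sym i j with i Fin.≟ j
  ... | yes ≡.refl = sym (I-diagonal i)
  ... | no  i≢j    = sym (I-offDiagonal (i≢j ∘ ≡.sym))

  I-suc : ∀ {n} (i j : Fin n) → I (suc i) (suc j) ≈ I i j
  I-suc i j with i Fin.≟ j
  ... | yes ≡.refl = refl
  ... | no  i≢j    = refl

  sum-Iˡ : ∀ {n} (i : Fin n) (f : Vector Carrier n) → sum (λ k → I i k * f k) ≈ f i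
  sum-Iˡ {suc n} zero f = begin
    I {suc n} zero zero * f zero + sum (λ k → I zero (suc k) * f (suc k))
      ≈⟨ +-cong (*-identityˡ _) (sum-zero {n} λ k → zeroˡ (f (suc k))) ⟩
    f zero + 0#  ≈⟨ +-identityʳ _ ⟩
    f zero       ∎
  sum-Iˡ (suc i) f = begin
    I (suc i) zero * f zero + sum (λ k → I (suc i) (suc k) * f (suc k))
      ≈⟨ +-cong (zeroˡ _) (sum-cong λ k → *-congʳ (I-suc i k)) ⟩
    0# + sum (λ k → I i k * f (suc k))  ≈⟨ +-identityˡ _ ⟩
    sum (λ k → I i k * f (suc k))       ≈⟨ sum-Iˡ i (f ∘ suc) ⟩
    f (suc i)                           ∎

  sum-Iʳ : ∀ {n} (i : Fin n) (f : Vector Carrier n) → sum (λ k → f k * I k i) ≈ f i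
  sum-Iʳ i f = trans (sum-cong λ k → trans (*-comm _ _) (*-congʳ (I-sym k i))) (sum-Iˡ i f)

  -- Linearity in row i, for matrices M, A, B that agree in all other rows.
  -- The induction uses det-cong for matrices of smaller size.
  det-linear : ∀ {n} {M A B : Matrix n} i a b →
               (∀ j → M i j ≈ a * A i j + b * B i j) →
               (∀ k → k ≢ i → ∀ j → M k j ≈ A k j) →
               (∀ k → k ≢ i → ∀ j → M k j ≈ B k j) →
               det M ≈ a * det A + b * det B
  det-cong : ∀ {n} {M N : Matrix n} → M ≈ᴹ N → det M ≈ det N

  det-linear {suc n} {M} {A} {B} zero a b row M≈A M≈B = begin
    sum (λ j → sign j * M zero j * det (minor M j))
      ≈⟨ sum-cong (λ j → begin
           sign j * M zero j * det (minor M j)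
             ≈⟨ *-congʳ (*-congˡ (row j)) ⟩
           sign j * (a * A zero j + b * B zero j) * det (minor M j)
             ≈⟨ solve 6 (λ s a b x y d → s :* (a :* x :+ b :* y) :* d
                  := a :* (s :* x :* d) :+ b :* (s :* y :* d)) refl _ _ _ _ _ _ ⟩
           a * (sign j * A zero j * det (minor M j)) + b * (sign j * B zero j * det (minor M j))
             ≈⟨ +-cong (*-congˡ (*-congˡ (det-cong λ i k → M≈A (suc i) (λ ()) (punchIn j k))))
                       (*-congˡ (*-congˡ (det-cong λ i k → M≈B (suc i) (λ ()) (punchIn j k)))) ⟩
           a * (sign j * A zero j * det (minor A j)) + b * (sign j * B zero j * det (minor B j)) ∎) ⟩
    sum (λ j → a * (sign j * A zero j * det (minor A j)) + b * (sign j * B zero j * det (minor B j)))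
      ≈⟨ sum-linear (λ j → sign j * A zero j * det (minor A j)) (λ j → sign j * B zero j * det (minor B j)) a b ⟩
    a * det A + b * det B ∎
  det-linear {suc n} {M} {A} {B} (suc i) a b row M≈A M≈B = begin
    sum (λ j → sign j * M zero j * det (minor M j))
      ≈⟨ sum-cong (λ j → begin
           sign j * M zero j * det (minor M j)
             ≈⟨ *-congˡ (det-linear i a b (λ k → row (punchIn j k))
                  (λ k k≢i l → M≈A (suc k) (k≢i ∘ Fin.suc-injective) (punchIn j l))
                  (λ k k≢i l → M≈B (suc k) (k≢i ∘ Fin.suc-injective) (punchIn j l))) ⟩
           sign j * M zero j * (a * det (minor A j) + b * det (minor B j))
             ≈⟨ solve 6 (λ s a b x d e → s :* x :* (a :* d :+ b :* e)
                  := a :* (s :* x :* d) :+ b :* (s :* x :* e)) refl _ _ _ _ _ _ ⟩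
           a * (sign j * M zero j * det (minor A j)) + b * (sign j * M zero j * det (minor B j))
             ≈⟨ +-cong (*-congˡ (*-congʳ (*-congˡ (M≈A zero (λ ()) j))))
                       (*-congˡ (*-congʳ (*-congˡ (M≈B zero (λ ()) j)))) ⟩
           a * (sign j * A zero j * det (minor A j)) + b * (sign j * B zero j * det (minor B j)) ∎) ⟩
    sum (λ j → a * (sign j * A zero j * det (minor A j)) + b * (sign j * B zero j * det (minor B j)))
      ≈⟨ sum-linear (λ j → sign j * A zero j * det (minor A j)) (λ j → sign j * B zero j * det (minor B j)) a b ⟩
    a * det A + b * det B ∎

  det-cong {zero}  M≈N = refl
  det-cong {suc n} M≈N = sum-cong λ j →
    *-cong (*-congˡ {sign j} (M≈N zero j)) (det-cong λ i k → M≈N (suc i) (punchIn j k))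

  -- Double sums over the ordered pairs of distinct elements of Fin (suc n),
  -- the pair (j , punchIn j k) being indexed by j and k.  Exchanging the two
  -- elements turns the index (j , k) into (punchIn j k , pinch k j).

  private
    sum-antisymmetric : ∀ n (g : Fin (suc n) → Fin n → Carrier) →
      (∀ j k → g j k + g (punchIn j k) (pinch k j) ≈ 0#) →
      sum (λ j → sum (g j)) ≈ 0#
    sum-antisymmetric zero    g anti = +-identityʳ 0#
    sum-antisymmetric (suc n) g anti = begin
      sum (g zero) + sum (λ j → g (suc j) zero + sum (g (suc j) ∘ suc))
        ≈⟨ +-congˡ (∑-distrib-+ (λ j → g (suc j) zero) (λ j → sum (g (suc j) ∘ suc))) ⟩
      sum (g zero) + (sum (λ j → g (suc j) zero) + sum (λ j → sum (g (suc j) ∘ suc)))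
        ≈⟨ +-assoc _ _ _ ⟨
      sum (g zero) + sum (λ j → g (suc j) zero) + sum (λ j → sum (g (suc j) ∘ suc))
        ≈⟨ +-cong (sym (∑-distrib-+ (g zero) (λ j → g (suc j) zero)))
                  (sum-antisymmetric n (λ j k → g (suc j) (suc k)) (λ j k → anti (suc j) (suc k))) ⟩
      sum (λ j → g zero j + g (suc j) zero) + 0#
        ≈⟨ +-congʳ (sum-zero (anti zero)) ⟩
      0# + 0#  ≈⟨ +-identityˡ 0# ⟩
      0#       ∎

    punchIn-pinch : ∀ {n} (j : Fin (suc n)) (k : Fin n) → punchIn (punchIn j k) (pinch k j) ≡ j
    punchIn-pinch {suc n} zero    k       = ≡.refl
    punchIn-pinch {suc n} (suc j) zero    = ≡.refl
    punchIn-pinch {suc n} (suc j) (suc k) = ≡.cong suc (punchIn-pinch j k)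

    punchIn-exchange : ∀ {n} (j : Fin (suc (suc n))) (k : Fin (suc n)) l →
      punchIn (punchIn j k) (punchIn (pinch k j) l) ≡ punchIn j (punchIn k l)
    punchIn-exchange zero    k       l       = ≡.refl
    punchIn-exchange (suc j) zero    l       = ≡.refl
    punchIn-exchange (suc j) (suc k) zero    = ≡.refl
    punchIn-exchange (suc j) (suc k) (suc l) = ≡.cong suc (punchIn-exchange j k l)

    sign-exchange : ∀ {n} (j : Fin (suc n)) (k : Fin n) →
      sign (punchIn j k) * sign (pinch k j) ≈ - (sign j * sign k)
    sign-exchange {suc n} zero k =
      solve 1 (λ s → :- con (1 , 0) :* s :* con (1 , 0) := :- (con (1 , 0) :* s)) refl (sign k)
    sign-exchange {suc n} (suc j) zero =
      solve 1 (λ s → con (1 , 0) :* s := :- (:- con (1 , 0) :* s :* con (1 , 0))) refl (sign j)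
    sign-exchange {suc n} (suc j) (suc k) = begin
      - 1# * sign (punchIn j k) * (- 1# * sign (pinch k j))
        ≈⟨ solve 2 (λ s t → :- con (1 , 0) :* s :* (:- con (1 , 0) :* t) := s :* t) refl _ _ ⟩
      sign (punchIn j k) * sign (pinch k j)  ≈⟨ sign-exchange j k ⟩
      - (sign j * sign k)
        ≈⟨ solve 2 (λ s t → :- (s :* t) := :- (:- con (1 , 0) :* s :* (:- con (1 , 0) :* t))) refl _ _ ⟩
      - (- 1# * sign j * (- 1# * sign k))  ∎

    -- Expanding along the two equal rows, the terms belonging to an ordered
    -- pair of columns and to the exchanged pair cancel.
    det-firstRows : ∀ {n} (M : Matrix (suc (suc n))) →
                    (∀ j → M zero j ≈ M (suc zero) j) → det M ≈ 0#
    det-firstRows {n} M M₀≈M₁ = begin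
      sum (λ j → sign j * M zero j * sum (λ k → sign k * M (suc zero) (punchIn j k) * D j k))
        ≈⟨ sum-cong (λ j → *-distribˡ-sum (sign j * M zero j) (λ k → sign k * M (suc zero) (punchIn j k) * D j k)) ⟩
      sum (λ j → sum (g j))
        ≈⟨ sum-antisymmetric (suc n) g anti ⟩
      0# ∎
      where
      D : Fin (suc (suc n)) → Fin (suc n) → Carrier
      D j k = det (minor (minor M j) k)

      g : Fin (suc (suc n)) → Fin (suc n) → Carrier
      g j k = sign j * M zero j * (sign k * M (suc zero) (punchIn j k) * D j k)

      anti : ∀ j k → g j k + g (punchIn j k) (pinch k j) ≈ 0#
      anti j k = begin
        g j k + sign j′ * M zero j′ * (sign k′ * M (suc zero) (punchIn j′ k′) * D j′ k′)
          ≈⟨ +-congˡ (*-cong (*-congˡ (M₀≈M₁ j′)) (*-cong (*-congˡ M₁≈M₀) (det-cong λ a b →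
               reflexive (≡.cong (M (suc (suc a))) (punchIn-exchange j k b))))) ⟩
        g j k + sign j′ * M (suc zero) j′ * (sign k′ * M zero j * D j k)
          ≈⟨ +-congˡ (solve 5 (λ s t x y d → s :* y :* (t :* x :* d) := s :* t :* (x :* y :* d)) refl
               (sign j′) (sign k′) (M zero j) (M (suc zero) j′) (D j k)) ⟩
        g j k + sign j′ * sign k′ * (M zero j * M (suc zero) j′ * D j k)
          ≈⟨ +-congˡ (*-congʳ (sign-exchange j k)) ⟩
        g j k + - (sign j * sign k) * (M zero j * M (suc zero) j′ * D j k)
          ≈⟨ solve 5 (λ s t x y d → s :* x :* (t :* y :* d) :+ (:- (s :* t)) :* (x :* y :* d) := con (0 , 0)) refl
               (sign j) (sign k) (M zero j) (M (suc zero) j′) (D j k) ⟩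
        0# ∎
        where
        j′ = punchIn j k
        k′ = pinch k j
        M₁≈M₀ : M (suc zero) (punchIn j′ k′) ≈ M zero j
        M₁≈M₀ = trans (reflexive (≡.cong (M (suc zero)) (punchIn-pinch j k))) (sym (M₀≈M₁ j))

  -- M with row i replaced by v.
  infixl 5 _[_]≔_
  _[_]≔_ : ∀ {m n} → Vector (Row m) n → Fin n → Row m → Vector (Row m) n
  M [ i ]≔ v = updateAt M i (const v)

  ≔-at : ∀ {m n} (M : Vector (Row m) n) i v j → (M [ i ]≔ v) i j ≈ v j
  ≔-at M i v j = reflexive (≡.cong (λ row → row j) (updateAt-updates i M))

  ≔-off : ∀ {m n} (M : Vector (Row m) n) {i} v {k} → k ≢ i → ∀ j → (M [ i ]≔ v) k j ≈ M k j
  ≔-off M {i} v {k} k≢i j = reflexive (≡.cong (λ row → row j) (updateAt-minimal k i M k≢i))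

  ≔-columns : ∀ {l m n} (M : Vector (Row m) n) v (φ : Fin l → Fin m) i k j →
              (M [ i ]≔ v) k (φ j) ≈ ((λ a → M a ∘ φ) [ i ]≔ (v ∘ φ)) k j
  ≔-columns M v φ i k j with k Fin.≟ i
  ... | yes ≡.refl = trans (≔-at M i v (φ j)) (sym (≔-at (λ a → M a ∘ φ) i (v ∘ φ) j))
  ... | no  k≢i    = trans (≔-off M v k≢i (φ j)) (sym (≔-off (λ a → M a ∘ φ) (v ∘ φ) k≢i j))

  ≔-cong : ∀ {n} {M N : Matrix n} i {u v : Row n} →
           (∀ j → u j ≈ v j) → (∀ k → k ≢ i → ∀ j → M k j ≈ N k j) → (M [ i ]≔ u) ≈ᴹ (N [ i ]≔ v)
  ≔-cong {M = M} {N} i {u} {v} u≈v M≈N k j with k Fin.≟ i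
  ... | yes ≡.refl = trans (≔-at M i u j) (trans (u≈v j) (sym (≔-at N i v j)))
  ... | no  k≢i    = trans (≔-off M u k≢i j) (trans (M≈N k k≢i j) (sym (≔-off N v k≢i j)))

  ≔-linear : ∀ {n} (M : Matrix n) i a u b v →
             det (M [ i ]≔ λ j → a * u j + b * v j) ≈ a * det (M [ i ]≔ u) + b * det (M [ i ]≔ v)
  ≔-linear M i a u b v = det-linear i a b
    (λ j → trans (≔-at M i _ j) (+-cong (*-congˡ (sym (≔-at M i u j))) (*-congˡ (sym (≔-at M i v j)))))
    (λ k k≢i j → trans (≔-off M _ k≢i j) (sym (≔-off M u k≢i j)))
    (λ k k≢i j → trans (≔-off M _ k≢i j) (sym (≔-off M v k≢i j)))

  ≔-sum : ∀ {n q} (M : Matrix n) i (a : Vector Carrier q) (v : Fin q → Row n) →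
          det (M [ i ]≔ λ j → sum λ k → a k * v k j) ≈ sum λ k → a k * det (M [ i ]≔ v k)
  ≔-sum {q = zero} M i a v = begin
    det (M [ i ]≔ λ j → 0#)  ≈⟨ det-linear i 0# 0# (λ j → trans (≔-at M i _ j) (zero-combination (M i j)))
                                  (λ k k≢i → ≔-off M _ k≢i) (λ k k≢i → ≔-off M _ k≢i) ⟩
    0# * det M + 0# * det M  ≈⟨ zero-combination (det M) ⟨
    0#                       ∎
    where
    zero-combination : ∀ x → 0# ≈ 0# * x + 0# * x
    zero-combination = solve 1 (λ x → con (0 , 0) := con (0 , 0) :* x :+ con (0 , 0) :* x) refl
  ≔-sum {q = suc q} M i a v = begin
    det (M [ i ]≔ λ j → a zero * v zero j + sum λ k → a (suc k) * v (suc k) j)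
      ≈⟨ det-cong (≔-cong {M = M} i (λ j → +-congˡ (sym (*-identityˡ _))) (λ _ _ _ → refl)) ⟩
    det (M [ i ]≔ λ j → a zero * v zero j + 1# * sum λ k → a (suc k) * v (suc k) j)
      ≈⟨ ≔-linear M i (a zero) (v zero) 1# _ ⟩
    a zero * det (M [ i ]≔ v zero) + 1# * det (M [ i ]≔ λ j → sum λ k → a (suc k) * v (suc k) j)
      ≈⟨ +-congˡ (trans (*-identityˡ _) (≔-sum M i (a ∘ suc) (v ∘ suc))) ⟩
    a zero * det (M [ i ]≔ v zero) + sum (λ k → a (suc k) * det (M [ i ]≔ v (suc k))) ∎

  private
    -- Matrices of size n with two equal rows have determinant 0.
    Alternating : ℕ → Set _
    Alternating n = ∀ (M : Matrix n) {i k} → i ≢ k → (∀ j → M i j ≈ M k j) → det M ≈ 0#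

    -- Exchanging rows i and k of M changes the sign of det M, by polarisation
    -- of the vanishing of det on equal rows i and k.
    exchange : ∀ {n} → Alternating n → ∀ (M : Matrix n) {i k} → i ≢ k →
               det M + det (M [ i ]≔ M k [ k ]≔ M i) ≈ 0#
    exchange alternating M {i} {k} i≢k = begin
      det M + E (M k) (M i)
        ≈⟨ +-congʳ (det-cong M≈) ⟩
      E (M i) (M k) + E (M k) (M i)
        ≈⟨ +-cong (+-identityˡ _) (+-identityʳ _) ⟨
      0# + E (M i) (M k) + (E (M k) (M i) + 0#)
        ≈⟨ +-cong (+-congʳ (E-diagonal (M i))) (+-congˡ (E-diagonal (M k))) ⟨
      E (M i) (M i) + E (M i) (M k) + (E (M k) (M i) + E (M k) (M k))
        ≈⟨ +-cong (E-addʳ (M i)) (E-addʳ (M k)) ⟨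
      E (M i) s + E (M k) s
        ≈⟨ E-addˡ ⟨
      E s s
        ≈⟨ E-diagonal s ⟩
      0# ∎
      where
      s : Row _
      s j = 1# * M i j + 1# * M k j

      -- det as a function of the rows i and k.
      E : Row _ → Row _ → Carrier
      E u v = det (M [ i ]≔ u [ k ]≔ v)

      row-i : ∀ u v j → (M [ i ]≔ u [ k ]≔ v) i j ≈ u j
      row-i u v j = trans (≔-off (M [ i ]≔ u) v i≢k j) (≔-at M i u j)

      E-diagonal : ∀ u → E u u ≈ 0#
      E-diagonal u = alternating _ i≢k λ j → trans (row-i u u j) (sym (≔-at (M [ i ]≔ u) k u j))

      M≈ : M ≈ᴹ (M [ i ]≔ M i [ k ]≔ M k)
      M≈ l j with l Fin.≟ k | l Fin.≟ i
      ... | yes ≡.refl | _          = sym (≔-at (M [ i ]≔ M i) k (M k) j)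
      ... | no  _      | yes ≡.refl = sym (row-i (M i) (M k) j)
      ... | no  l≢k    | no  l≢i    = sym (trans (≔-off (M [ i ]≔ M i) (M k) l≢k j) (≔-off M (M i) l≢i j))

      ones : ∀ x y → 1# * x + 1# * y ≈ x + y
      ones x y = +-cong (*-identityˡ x) (*-identityˡ y)

      E-addʳ : ∀ u → E u s ≈ E u (M i) + E u (M k)
      E-addʳ u = trans (≔-linear (M [ i ]≔ u) k 1# (M i) 1# (M k)) (ones _ _)

      off-i : ∀ u v w l → l ≢ i → ∀ j → (M [ i ]≔ u [ k ]≔ w) l j ≈ (M [ i ]≔ v [ k ]≔ w) l j
      off-i u v w l l≢i j with l Fin.≟ k
      ... | yes ≡.refl = trans (≔-at (M [ i ]≔ u) k w j) (sym (≔-at (M [ i ]≔ v) k w j))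
      ... | no  l≢k    = begin
        (M [ i ]≔ u [ k ]≔ w) l j  ≈⟨ ≔-off (M [ i ]≔ u) w l≢k j ⟩
        (M [ i ]≔ u) l j           ≈⟨ ≔-off M u l≢i j ⟩
        M l j                      ≈⟨ ≔-off M v l≢i j ⟨
        (M [ i ]≔ v) l j           ≈⟨ ≔-off (M [ i ]≔ v) w l≢k j ⟨
        (M [ i ]≔ v [ k ]≔ w) l j  ∎

      E-addˡ : E s s ≈ E (M i) s + E (M k) s
      E-addˡ = trans (det-linear i 1# 1#
        (λ j → trans (row-i s s j) (sym (+-cong (*-congˡ (row-i (M i) s j)) (*-congˡ (row-i (M k) s j)))))
        (off-i s (M i) s) (off-i s (M k) s)) (ones _ _)

    alternate : ∀ n → Alternating n
    alternate-zero : ∀ n (M : Matrix (suc n)) i → (∀ j → M zero j ≈ M (suc i) j) → det M ≈ 0#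

    alternate (suc n) M {zero}  {zero}  0≢0 _     = contradiction ≡.refl 0≢0
    alternate (suc n) M {zero}  {suc k} _   M₀≈Mₖ = alternate-zero n M k M₀≈Mₖ
    alternate (suc n) M {suc i} {zero}  _   Mᵢ≈M₀ = alternate-zero n M i (sym ∘ Mᵢ≈M₀)
    alternate (suc n) M {suc i} {suc k} i≢k Mᵢ≈Mₖ = sum-zero λ j →
      trans (*-congˡ {sign j * M zero j} (alternate n (minor M j) (i≢k ∘ ≡.cong suc) (Mᵢ≈Mₖ ∘ punchIn j))) (zeroʳ _)

    -- Rows 1 and suc i are exchanged in all minors, which moves the second
    -- of the two equal rows next to the first.
    alternate-zero (suc n) M zero    M₀≈M₁ = det-firstRows M M₀≈M₁
    alternate-zero (suc n) M (suc i) M₀≈Mᵢ = begin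
      det M           ≈⟨ +-identityʳ _ ⟨
      det M + 0#      ≈⟨ +-congˡ (det-firstRows M′ λ j → M₀≈Mᵢ j) ⟨
      det M + det M′  ≈⟨ ∑-distrib-+ (λ j → sign j * M zero j * det (minor M j)) (λ j → sign j * M zero j * det (minor M′ j)) ⟨
      sum (λ j → sign j * M zero j * det (minor M j) + sign j * M zero j * det (minor M′ j))
        ≈⟨ sum-zero (λ j → begin
             sign j * M zero j * det (minor M j) + sign j * M zero j * det (minor M′ j)
               ≈⟨ distribˡ _ _ _ ⟨
             sign j * M zero j * (det (minor M j) + det (minor M′ j))
               ≈⟨ *-congˡ (+-congˡ (det-cong (minor-M′ j))) ⟩
             sign j * M zero j * (det (minor M j) + det (minor M j [ zero ]≔ minor M j (suc i) [ suc i ]≔ minor M j zero))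
               ≈⟨ *-congˡ (exchange (alternate (suc n)) (minor M j) {zero} {suc i} λ ()) ⟩
             sign j * M zero j * 0#
               ≈⟨ zeroʳ _ ⟩
             0# ∎) ⟩
      0# ∎
      where
      M′ : Matrix (suc (suc n))
      M′ zero    = M zero
      M′ (suc k) = ((M ∘ suc) [ zero ]≔ M (suc (suc i)) [ suc i ]≔ M (suc zero)) k

      minor-M′ : ∀ j → minor M′ j ≈ᴹ (minor M j [ zero ]≔ minor M j (suc i) [ suc i ]≔ minor M j zero)
      minor-M′ j zero    l = refl
      minor-M′ j (suc k) l = ≔-columns (λ a → M (suc (suc a))) (M (suc zero)) (punchIn j) i k l

  det-alternating : ∀ {n} (M : Matrix n) {i k} → i ≢ k → (∀ j → M i j ≈ M k j) → det M ≈ 0#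
  det-alternating = alternate _

  -- The transposed adjugate: the (i , j) cofactor is the determinant after
  -- replacing row i by the j-th unit vector.
  cofactor : ∀ {n} → Matrix n → Matrix n
  cofactor M i j = det (M [ i ]≔ I j)

  -- Cramer's rule: expanding row i against the cofactors of row k gives the
  -- determinant of M with row k replaced by row i.
  sum-cofactor : ∀ {n} (M : Matrix n) i k → sum (λ j → M i j * cofactor M k j) ≈ I i k * det M
  sum-cofactor M i k = begin
    sum (λ j → M i j * det (M [ k ]≔ I j))      ≈⟨ ≔-sum M k (M i) I ⟨
    det (M [ k ]≔ λ l → sum λ j → M i j * I j l) ≈⟨ det-cong (≔-cong {M = M} k (λ l → sum-Iʳ l (M i)) (λ _ _ _ → refl)) ⟩
    det (M [ k ]≔ M i)                          ≈⟨ replaced (i Fin.≟ k) ⟩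
    I i k * det M                               ∎
    where
    replaced : Dec (i ≡ k) → det (M [ k ]≔ M i) ≈ I i k * det M
    replaced (yes ≡.refl) = begin
      det (M [ i ]≔ M i)  ≈⟨ det-cong same ⟩
      det M               ≈⟨ *-identityˡ _ ⟨
      1# * det M          ≈⟨ *-congʳ (I-diagonal i) ⟨
      I i i * det M       ∎
      where
      same : (M [ i ]≔ M i) ≈ᴹ M
      same l j with l Fin.≟ i
      ... | yes ≡.refl = ≔-at M i (M i) j
      ... | no  l≢i    = ≔-off M (M i) l≢i j
    replaced (no i≢k) = begin
      det (M [ k ]≔ M i)  ≈⟨ det-alternating _ i≢k (λ j → trans (≔-off M (M i) i≢k j) (sym (≔-at M k (M i) j))) ⟩
      0#                  ≈⟨ zeroˡ _ ⟨
      0# * det M          ≈⟨ *-congʳ (I-offDiagonal i≢k) ⟨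
      I i k * det M       ∎

  -- Adding to row i a combination of the rows φ k, which is trivial in case
  -- row i is one of them.
  det-rowOperation : ∀ {n q} {M M′ : Matrix n} i (φ : Fin q → Fin n) (y : Vector Carrier q) →
    (∀ k → i ≡ φ k → ∀ l → y l ≈ 0#) →
    (∀ j → M′ i j ≈ M i j + sum λ k → y k * M (φ k) j) →
    (∀ l → l ≢ i → ∀ j → M′ l j ≈ M l j) →
    det M′ ≈ det M
  det-rowOperation {M = M} {M′} i φ y y≈0 M′ᵢ M′≈M = begin
    det M′  ≈⟨ det-linear i 1# 1#
                 (λ j → trans (M′ᵢ j) (sym (+-cong (*-identityˡ _) (trans (*-identityˡ _) (≔-at M i combination j)))))
                 M′≈M (λ l l≢i j → trans (M′≈M l l≢i j) (sym (≔-off M combination l≢i j))) ⟩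
    1# * det M + 1# * det (M [ i ]≔ combination)
            ≈⟨ +-cong (*-identityˡ _) (trans (*-identityˡ _) vanishes) ⟩
    det M + 0#  ≈⟨ +-identityʳ _ ⟩
    det M       ∎
    where
    combination : Row _
    combination j = sum λ k → y k * M (φ k) j

    term : ∀ k → Dec (i ≡ φ k) → y k * det (M [ i ]≔ M (φ k)) ≈ 0#
    term k (yes i≡φk) = trans (*-congʳ (y≈0 k i≡φk k)) (zeroˡ _)
    term k (no  i≢φk) = trans (*-congˡ (det-alternating (M [ i ]≔ M (φ k)) i≢φk λ j →
      trans (≔-at M i (M (φ k)) j) (sym (≔-off M (M (φ k)) (i≢φk ∘ ≡.sym) j)))) (zeroʳ _)

    vanishes : det (M [ i ]≔ combination) ≈ 0#
    vanishes = trans (≔-sum M i y (M ∘ φ)) (sum-zero λ k → term k (i Fin.≟ φ k))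

  -- Simultaneous row operations: multiples of the rows φ k are added to
  -- other rows, the rows φ k themselves staying fixed.
  det-rowOperations : ∀ {n q} {M M′ : Matrix n} (φ : Fin q → Fin n) (y : Fin n → Vector Carrier q) →
    (∀ k l → y (φ k) l ≈ 0#) →
    (∀ i j → M′ i j ≈ M i j + sum λ k → y i k * M (φ k) j) →
    det M′ ≈ det M
  det-rowOperations {n} {q} {M} {M′} φ y y≈0 M′≈ = begin
    det M′     ≈⟨ det-cong (λ i j → trans (M′≈ i j) (sym (stage-done i j))) ⟩
    det (stage n) ≈⟨ stages n ⟩
    det M      ∎
    where
    -- The operations performed on the first t rows only.
    stage-row : ∀ {t} i → Dec (toℕ i ℕ.< t) → Row n
    stage-row i (yes _) j = M i j + sum λ k → y i k * M (φ k) j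
    stage-row i (no  _) j = M i j

    stage : ℕ → Matrix n
    stage t i = stage-row i (toℕ i ℕ.<? t)

    stage-done : ∀ i j → stage n i j ≈ M i j + sum λ k → y i k * M (φ k) j
    stage-done i j with toℕ i ℕ.<? n
    ... | yes _   = refl
    ... | no  i≮n = contradiction (Fin.toℕ<n i) i≮n

    combination≈0 : ∀ k j → M (φ k) j + sum (λ l → y (φ k) l * M (φ l) j) ≈ M (φ k) j
    combination≈0 k j = trans (+-congˡ (sum-zero λ l → trans (*-congʳ (y≈0 k l)) (zeroˡ _))) (+-identityʳ _)

    stage-φ : ∀ t k j → stage t (φ k) j ≈ M (φ k) j
    stage-φ t k j with toℕ (φ k) ℕ.<? t
    ... | yes _ = combination≈0 k j
    ... | no  _ = refl

    stage-off : ∀ t i → toℕ i ≢ t → ∀ j → stage (suc t) i j ≈ stage t i j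
    stage-off t i i≢t j with toℕ i ℕ.<? suc t | toℕ i ℕ.<? t
    ... | yes _   | yes _   = refl
    ... | no _    | no _    = refl
    ... | yes i≤t | no  i≮t = contradiction (ℕ.≤-antisym (ℕ.s≤s⁻¹ i≤t) (ℕ.≮⇒≥ i≮t)) i≢t
    ... | no  i≰t | yes i<t = contradiction (ℕ.m<n⇒m<1+n i<t) i≰t

    stage-at : ∀ i j → stage (suc (toℕ i)) i j ≈ stage (toℕ i) i j + sum λ k → y i k * stage (toℕ i) (φ k) j
    stage-at i j with toℕ i ℕ.<? suc (toℕ i) | toℕ i ℕ.<? toℕ i
    ... | no  i≮1+i | _       = contradiction ℕ.≤-refl i≮1+i
    ... | _         | yes i<i = contradiction i<i (ℕ.<-irrefl ≡.refl)
    ... | yes _     | no  _   = +-congˡ (sum-cong λ k → *-congˡ (sym (stage-φ (toℕ i) k j)))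

    step : ∀ i → det (stage (suc (toℕ i))) ≈ det (stage (toℕ i))
    step i = det-rowOperation i φ (y i) y≈0-at (stage-at i)
      (λ l l≢i → stage-off (toℕ i) l (l≢i ∘ Fin.toℕ-injective))
      where
      y≈0-at : ∀ k → i ≡ φ k → ∀ l → y i l ≈ 0#
      y≈0-at k ≡.refl = y≈0 k

    stages : ∀ t → det (stage t) ≈ det M
    stages zero    = refl
    stages (suc t) with t ℕ.<? n
    ... | no  t≮n = trans (det-cong λ i j → stage-off t i (λ i≡t → t≮n (≡.subst (ℕ._< n) i≡t (Fin.toℕ<n i))) j) (stages t)
    ... | yes t<n = trans (≡.subst (λ u → det (stage (suc u)) ≈ det (stage u)) (Fin.toℕ-fromℕ< t<n) (step (Fin.fromℕ< t<n))) (stages t)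

-- Block matrices, matrices with constant column sums, inverses

module BlockDeterminants {c ℓ} (R : CommutativeRing c ℓ) where

  open CommutativeRing R hiding (zero)
  open Matrices R
  open FiniteSums R
  open Determinants R
  open Exp semiring using (_^_)
  open RingIdentities R
  open RingProperties ring using (-1*x≈-x; x≈y⇒x∙y⁻¹≈ε)
  open SetoidReasoning setoid

  sum-combine : ∀ m {n} (f : Vector Carrier (m ℕ.* n)) →
                sum f ≈ sum λ (i : Fin m) → sum λ (j : Fin n) → f (combine i j)
  sum-combine zero        f = refl
  sum-combine (suc m) {n} f = trans (sum-↑ n f) (+-congˡ (sum-combine m (λ k → f (n ↑ʳ k))))

  det-zeroColumn : ∀ {n} (M : Matrix (suc n)) → (∀ i → M i zero ≈ 0#) → det M ≈ 0#
  det-zeroColumn {n} M M≈0 = sum-zero (term n M M≈0)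
    where
    term : ∀ n (M : Matrix (suc n)) → (∀ i → M i zero ≈ 0#) →
           ∀ j → (- 1#) ^ toℕ j * M zero j * det (minor M j) ≈ 0#
    term n       M M≈0 zero    = trans (*-congʳ (trans (*-congˡ (M≈0 zero)) (zeroʳ _))) (zeroˡ _)
    term (suc n) M M≈0 (suc j) = trans (*-congˡ (det-zeroColumn (minor M (suc j)) (M≈0 ∘ suc))) (zeroʳ _)

  -- Column 0 vanishes below its first entry.
  det-firstColumn : ∀ {n} (M : Matrix (suc n)) → (∀ i → M (suc i) zero ≈ 0#) →
                    det M ≈ M zero zero * det (minor M zero)
  det-firstColumn {n} M M≈0 = begin
    1# * M zero zero * det (minor M zero) + sum (λ j → (- 1#) ^ toℕ (suc j) * M zero (suc j) * det (minor M (suc j)))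
      ≈⟨ +-cong (*-congʳ (*-identityˡ _)) (sum-zero (term n M M≈0)) ⟩
    M zero zero * det (minor M zero) + 0#
      ≈⟨ +-identityʳ _ ⟩
    M zero zero * det (minor M zero) ∎
    where
    term : ∀ n (M : Matrix (suc n)) → (∀ i → M (suc i) zero ≈ 0#) →
           ∀ j → (- 1#) ^ toℕ (suc j) * M zero (suc j) * det (minor M (suc j)) ≈ 0#
    term (suc n) M M≈0 j = trans (*-congˡ (det-zeroColumn (minor M (suc j)) M≈0)) (zeroʳ _)

  det-I : ∀ n → det (I {n}) ≈ 1#
  det-I zero    = refl
  det-I (suc n) = begin
    det (I {suc n})                        ≈⟨ det-firstColumn (I {suc n}) (λ _ → refl) ⟩
    1# * det (minor (I {suc n}) zero)      ≈⟨ *-identityˡ _ ⟩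
    det (minor (I {suc n}) zero)           ≈⟨ det-cong (I-suc {n}) ⟩
    det (I {n})                            ≈⟨ det-I n ⟩
    1#                                     ∎

  det-scale : ∀ {n} a (M : Matrix n) → det (λ i j → a * M i j) ≈ a ^ n * det M
  det-scale {zero}  a M = sym (*-identityˡ 1#)
  det-scale {suc n} a M = begin
    sum (λ j → (- 1#) ^ toℕ j * (a * M zero j) * det (λ i k → a * minor M j i k))
      ≈⟨ sum-cong (λ j → trans (*-congˡ (det-scale a (minor M j)))
           (solve 5 (λ s a x p d → s :* (a :* x) :* (p :* d) := a :* p :* (s :* x :* d)) refl
             ((- 1#) ^ toℕ j) a (M zero j) (a ^ n) (det (minor M j)))) ⟩
    sum (λ j → a * a ^ n * ((- 1#) ^ toℕ j * M zero j * det (minor M j)))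
      ≈⟨ *-distribˡ-sum (a * a ^ n) (λ j → (- 1#) ^ toℕ j * M zero j * det (minor M j)) ⟨
    a * a ^ n * det M ∎

  private
    punchIn-↑ˡ : ∀ {p} q (j : Fin (suc p)) (k : Fin p) → punchIn (j ↑ˡ q) (k ↑ˡ q) ≡ punchIn j k ↑ˡ q
    punchIn-↑ˡ q zero    k       = ≡.refl
    punchIn-↑ˡ q (suc j) zero    = ≡.refl
    punchIn-↑ˡ q (suc j) (suc k) = ≡.cong suc (punchIn-↑ˡ q j k)

    punchIn-↑ʳ : ∀ {p q} (j : Fin (suc p)) (k : Fin q) → punchIn (j ↑ˡ q) (p ↑ʳ k) ≡ suc p ↑ʳ k
    punchIn-↑ʳ         zero    k = ≡.refl
    punchIn-↑ʳ {suc p} (suc j) k = ≡.cong suc (punchIn-↑ʳ j k)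

  -- Block lower triangular matrices, by induction on the size of the upper
  -- left block: the expansion along row 0 meets that block only.
  det-lowerBlocks : ∀ p {q} (M : Matrix (p ℕ.+ q)) → (∀ i j → M (i ↑ˡ q) (p ↑ʳ j) ≈ 0#) →
    det M ≈ det (λ i j → M (i ↑ˡ q) (j ↑ˡ q)) * det (λ i j → M (p ↑ʳ i) (p ↑ʳ j))
  det-lowerBlocks zero    M M≈0 = sym (*-identityˡ _)
  det-lowerBlocks (suc p) {q} M M≈0 = begin
    sum (λ j → (- 1#) ^ toℕ j * M zero j * det (minor M j))
      ≈⟨ sum-↑ (suc p) (λ j → (- 1#) ^ toℕ j * M zero j * det (minor M j)) ⟩
    sum (λ j → (- 1#) ^ toℕ (j ↑ˡ q) * M zero (j ↑ˡ q) * det (minor M (j ↑ˡ q)))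
      + sum (λ j → (- 1#) ^ toℕ (suc p ↑ʳ j) * M zero (suc p ↑ʳ j) * det (minor M (suc p ↑ʳ j)))
      ≈⟨ +-cong (sum-cong left) (sum-zero λ j → trans (*-congʳ (trans (*-congˡ (M≈0 zero j)) (zeroʳ _))) (zeroˡ _)) ⟩
    sum (λ j → (- 1#) ^ toℕ j * TL zero j * det (minor TL j) * det BR) + 0#
      ≈⟨ +-identityʳ _ ⟩
    sum (λ j → (- 1#) ^ toℕ j * TL zero j * det (minor TL j) * det BR)
      ≈⟨ *-distribʳ-sum (det BR) (λ j → (- 1#) ^ toℕ j * TL zero j * det (minor TL j)) ⟨
    det TL * det BR ∎
    where
    TL : Matrix (suc p)
    TL i j = M (i ↑ˡ q) (j ↑ˡ q)
    BR : Matrix q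
    BR i j = M (suc p ↑ʳ i) (suc p ↑ʳ j)

    left : ∀ j → (- 1#) ^ toℕ (j ↑ˡ q) * M zero (j ↑ˡ q) * det (minor M (j ↑ˡ q))
               ≈ (- 1#) ^ toℕ j * TL zero j * det (minor TL j) * det BR
    left j = begin
      (- 1#) ^ toℕ (j ↑ˡ q) * TL zero j * det (minor M (j ↑ˡ q))
        ≈⟨ *-cong (*-congʳ (reflexive (≡.cong ((- 1#) ^_) (Fin.toℕ-↑ˡ j q))))
             (det-lowerBlocks p (minor M (j ↑ˡ q)) λ i k →
               trans (reflexive (≡.cong (M (suc (i ↑ˡ q))) (punchIn-↑ʳ j k))) (M≈0 (suc i) k)) ⟩
      (- 1#) ^ toℕ j * TL zero j * (det (λ i k → minor M (j ↑ˡ q) (i ↑ˡ q) (k ↑ˡ q))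
                                    * det (λ i k → minor M (j ↑ˡ q) (p ↑ʳ i) (p ↑ʳ k)))
        ≈⟨ *-congˡ (*-cong
             (det-cong λ i k → reflexive (≡.cong (M (suc (i ↑ˡ q))) (punchIn-↑ˡ q j k)))
             (det-cong λ i k → reflexive (≡.cong (M (suc p ↑ʳ i)) (punchIn-↑ʳ j k)))) ⟩
      (- 1#) ^ toℕ j * TL zero j * (det (minor TL j) * det BR)
        ≈⟨ *-assoc _ _ _ ⟨
      (- 1#) ^ toℕ j * TL zero j * det (minor TL j) * det BR ∎

  -- The Schur complement.  With M in blocks M₁₁, M₁₂, M₂₁, M₂₂ the matrix y
  -- plays the role of M₁₂ M₂₂⁻¹.
  det-schur : ∀ p {q} (M : Matrix (p ℕ.+ q)) (y : Fin p → Vector Carrier q) →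
    (∀ i j → sum (λ k → y i k * M (p ↑ʳ k) (p ↑ʳ j)) ≈ M (i ↑ˡ q) (p ↑ʳ j)) →
    det M ≈ det (λ i j → M (i ↑ˡ q) (j ↑ˡ q) - sum λ k → y i k * M (p ↑ʳ k) (j ↑ˡ q))
          * det (λ i j → M (p ↑ʳ i) (p ↑ʳ j))
  det-schur p {q} M y y≈ = begin
    det M   ≈⟨ det-rowOperations (p ↑ʳ_) z z-lower (λ _ _ → refl) ⟨
    det M′  ≈⟨ det-lowerBlocks p M′ (λ i j → trans (upper i _) (x≈y⇒x∙y⁻¹≈ε (sym (y≈ i j)))) ⟩
    det (λ i j → M′ (i ↑ˡ q) (j ↑ˡ q)) * det (λ i j → M′ (p ↑ʳ i) (p ↑ʳ j))
            ≈⟨ *-cong (det-cong λ i j → upper i (j ↑ˡ q)) (det-cong λ i j → lower i (p ↑ʳ j)) ⟩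
    det (λ i j → M (i ↑ˡ q) (j ↑ˡ q) - sum λ k → y i k * M (p ↑ʳ k) (j ↑ˡ q))
          * det (λ i j → M (p ↑ʳ i) (p ↑ʳ j)) ∎
    where
    -- The coefficients of the row operations that clear the block M₁₂.
    z : Fin (p ℕ.+ q) → Vector Carrier q
    z x k = [ (λ i → - y i k) , const 0# ]′ (splitAt p x)

    M′ : Matrix (p ℕ.+ q)
    M′ x j = M x j + sum λ k → z x k * M (p ↑ʳ k) j

    z-lower : ∀ k l → z (p ↑ʳ k) l ≈ 0#
    z-lower k l rewrite Fin.splitAt-↑ʳ p q k = refl

    z-upper : ∀ i k → z (i ↑ˡ q) k ≈ - 1# * y i k
    z-upper i k rewrite Fin.splitAt-↑ˡ p i q = solve 1 (λ x → :- x := :- con (1 , 0) :* x) refl _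

    lower : ∀ k j → M′ (p ↑ʳ k) j ≈ M (p ↑ʳ k) j
    lower k j = trans (+-congˡ (sum-zero λ l → trans (*-congʳ (z-lower k l)) (zeroˡ _))) (+-identityʳ _)

    upper : ∀ i j → M′ (i ↑ˡ q) j ≈ M (i ↑ˡ q) j - sum λ k → y i k * M (p ↑ʳ k) j
    upper i j = +-congˡ (begin
      sum (λ k → z (i ↑ˡ q) k * M (p ↑ʳ k) j)        ≈⟨ sum-cong (λ k → trans (*-congʳ (z-upper i k)) (*-assoc _ _ _)) ⟩
      sum (λ k → - 1# * (y i k * M (p ↑ʳ k) j))      ≈⟨ *-distribˡ-sum (- 1#) (λ k → y i k * M (p ↑ʳ k) j) ⟨
      - 1# * sum (λ k → y i k * M (p ↑ʳ k) j)        ≈⟨ solve 1 (λ x → :- con (1 , 0) :* x := :- x) refl _ ⟩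
      - sum (λ k → y i k * M (p ↑ʳ k) j)             ∎)

  -- The determinant of the block diagonal matrix with m blocks N.
  det-blockDiagonal : ∀ m {n} (N : Matrix n) (M : Matrix (m ℕ.* n)) →
    (∀ (d : Fin m) i (e : Fin m) j → M (combine d i) (combine e j) ≈ I d e * N i j) →
    det M ≈ det N ^ m
  det-blockDiagonal zero        N M M≈ = refl
  det-blockDiagonal (suc m) {n} N M M≈ = begin
    det M
      ≈⟨ det-lowerBlocks n M (λ i x → ≡.subst (λ x → M (i ↑ˡ (m ℕ.* n)) (n ↑ʳ x) ≈ 0#) (Fin.combine-remQuot {m} n x)
           (trans (M≈ zero i (suc (proj₁ (remQuot {m} n x))) (proj₂ (remQuot {m} n x))) (zeroˡ _))) ⟩
    det (λ i j → M (i ↑ˡ (m ℕ.* n)) (j ↑ˡ (m ℕ.* n))) * det (λ x y → M (n ↑ʳ x) (n ↑ʳ y))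
      ≈⟨ *-cong (det-cong λ i j → trans (M≈ zero i zero j) (*-identityˡ _))
           (det-blockDiagonal m N (λ x y → M (n ↑ʳ x) (n ↑ʳ y))
             λ d i e j → trans (M≈ (suc d) i (suc e) j) (*-congʳ (I-suc d e))) ⟩
    det N * det N ^ m ∎

  -- The matrix M with row 0 replaced by the all-ones row.
  withOnes : ∀ {n} → Matrix (suc n) → Matrix (suc n)
  withOnes M zero    j = 1#
  withOnes M (suc i) j = M (suc i) j

  det-withOnes-cong : ∀ {n} {M N : Matrix (suc n)} → M ≈ᴹ N → det (withOnes M) ≈ det (withOnes N)
  det-withOnes-cong {n} {M} {N} M≈N = det-cong {M = withOnes M} {withOnes N} entries
    where
    entries : withOnes M ≈ᴹ withOnes N
    entries zero    j = refl
    entries (suc i) j = M≈N (suc i) j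

  det-withOnes-scale : ∀ {n} a (M : Matrix (suc n)) →
                       det (withOnes λ i j → a * M i j) ≈ a ^ n * det (withOnes M)
  det-withOnes-scale {n} a M = begin
    sum (λ j → (- 1#) ^ toℕ j * 1# * det (λ i k → a * minor M j i k))
      ≈⟨ sum-cong (λ j → trans (*-congˡ (det-scale a (minor M j)))
           (solve 4 (λ s x p d → s :* x :* (p :* d) := p :* (s :* x :* d)) refl
             ((- 1#) ^ toℕ j) 1# (a ^ n) (det (minor M j)))) ⟩
    sum (λ j → a ^ n * ((- 1#) ^ toℕ j * 1# * det (minor M j)))
      ≈⟨ *-distribˡ-sum (a ^ n) (λ j → (- 1#) ^ toℕ j * 1# * det (minor M j)) ⟨
    a ^ n * det (withOnes M) ∎

  det-withOnes-I : ∀ n → det (withOnes (I {suc n})) ≈ 1#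
  det-withOnes-I n = begin
    det (withOnes (I {suc n}))         ≈⟨ det-firstColumn (withOnes (I {suc n})) (λ _ → refl) ⟩
    1# * det (minor (I {suc n}) zero)  ≈⟨ *-identityˡ _ ⟩
    det (minor (I {suc n}) zero)       ≈⟨ det-cong (I-suc {n}) ⟩
    det (I {n})                        ≈⟨ det-I n ⟩
    1#                                 ∎

  -- If all columns of M have sum s, then s is a factor of det M: the sum of
  -- all rows may replace row 0.
  det-columnSums : ∀ {n} (M : Matrix (suc n)) {s} → (∀ j → sum (λ i → M i j) ≈ s) →
                   det M ≈ s * det (withOnes M)
  det-columnSums {n} M {s} sums = begin
    det M   ≈⟨ det-rowOperation {M = M} {M′} zero suc (const 1#) (λ _ ())
                 (λ j → +-congˡ (sum-cong {n} λ i → sym (*-identityˡ (M (suc i) j)))) off ⟨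
    det M′  ≈⟨ det-linear {B = withOnes M} zero s 0#
                 (λ j → trans (sums j) (solve 1 (λ s → s := s :* con (1 , 0) :+ con (0 , 0) :* con (1 , 0)) refl s))
                 off′ off′ ⟩
    s * det (withOnes M) + 0# * det (withOnes M)
            ≈⟨ solve 2 (λ s d → s :* d :+ con (0 , 0) :* d := s :* d) refl s _ ⟩
    s * det (withOnes M) ∎
    where
    M′ : Matrix (suc n)
    M′ zero    j = sum λ i → M i j
    M′ (suc i) j = M (suc i) j

    off : ∀ i → i ≢ zero → ∀ j → M′ i j ≈ M i j
    off zero    0≢0 j = contradiction ≡.refl 0≢0
    off (suc i) _   j = refl

    off′ : ∀ i → i ≢ zero → ∀ j → M′ i j ≈ withOnes M i j
    off′ zero    0≢0 j = contradiction ≡.refl 0≢0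
    off′ (suc i) _   j = refl

  -- Adding t to every entry adds t times row 0 to each of the other rows.
  det-withOnes-+J : ∀ {n} (M : Matrix (suc n)) t →
                    det (withOnes λ i j → M i j + t) ≈ det (withOnes M)
  det-withOnes-+J M t = det-rowOperations {q = 1} (const zero) y (λ _ _ → refl) entries
    where
    y : Fin _ → Vector Carrier 1
    y zero    _ = 0#
    y (suc i) _ = t

    entries : ∀ i j → withOnes (λ i j → M i j + t) i j ≈ withOnes M i j + (y i zero * 1# + 0#)
    entries zero    j = solve 0 (con (1 , 0) := con (1 , 0) :+ (con (0 , 0) :* con (1 , 0) :+ con (0 , 0))) refl
    entries (suc i) j = solve 2 (λ x t → x :+ t := x :+ (t :* con (1 , 0) :+ con (0 , 0))) refl (M (suc i) j) t

  -- A constant multiple t of the all-ones matrix shifts the factor s above.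
  det-+J : ∀ {n} (M : Matrix (suc n)) {s} t → (∀ j → sum (λ i → M i j) ≈ s) →
           det (λ i j → M i j + t) ≈ (s + sum (λ (i : Fin (suc n)) → t)) * det (withOnes M)
  det-+J M {s} t sums = trans
    (det-columnSums (λ i j → M i j + t) λ j → trans (∑-distrib-+ (λ i → M i j) (λ _ → t)) (+-congʳ (sums j)))
    (*-congˡ (det-withOnes-+J M t))

  -- The column sums of a I + b M.
  sum-pencil : ∀ {n} a b (M : Matrix n) j → sum (λ i → a * I i j + b * M i j) ≈ a + b * sum (λ i → M i j)
  sum-pencil a b M j = begin
    sum (λ i → a * I i j + b * M i j)              ≈⟨ sum-linear (λ i → I i j) (λ i → M i j) a b ⟩
    a * sum (λ i → I i j) + b * sum (λ i → M i j)  ≈⟨ +-congʳ (*-congˡ (sum-cong λ i → sym (*-identityˡ (I i j)))) ⟩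
    a * sum (λ i → 1# * I i j) + b * sum (λ i → M i j)
                                                   ≈⟨ +-congʳ (trans (*-congˡ (sum-Iʳ j (const 1#))) (*-identityʳ a)) ⟩
    a + b * sum (λ i → M i j)                      ∎

  -- The column sums of a I - M.
  sum-characteristic : ∀ {n} a (M : Matrix n) j → sum (λ i → a * I i j - M i j) ≈ a - sum (λ i → M i j)
  sum-characteristic a M j = begin
    sum (λ i → a * I i j - M i j)         ≈⟨ sum-cong (λ i → +-congˡ (-1*x≈-x (M i j))) ⟨
    sum (λ i → a * I i j + - 1# * M i j)  ≈⟨ sum-pencil a (- 1#) M j ⟩
    a + - 1# * sum (λ i → M i j)          ≈⟨ +-congˡ (-1*x≈-x (sum λ i → M i j)) ⟩
    a - sum (λ i → M i j)                 ∎

  -- Gaussian elimination of column 0 with pivot in position (0 , 0).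
  det-pivot : ∀ {n} (M : Matrix (suc n)) p → M zero zero * p ≈ 1# →
    det M ≈ M zero zero * det (λ i j → M (suc i) (suc j) - M (suc i) zero * p * M zero (suc j))
  det-pivot {n} M p Mp≈1 = begin
    det M   ≈⟨ det-rowOperations {M = M} {M′} (const zero) y (λ _ _ → refl) (λ _ _ → refl) ⟨
    det M′  ≈⟨ det-firstColumn M′ (λ i → begin
                 M (suc i) zero + (- (M (suc i) zero * p) * M zero zero + 0#)
                   ≈⟨ solve 3 (λ x p m → x :+ ((:- (x :* p)) :* m :+ con (0 , 0)) := x :* (con (1 , 0) :- m :* p)) refl _ p _ ⟩
                 M (suc i) zero * (1# - M zero zero * p)
                   ≈⟨ *-congˡ (x≈y⇒x∙y⁻¹≈ε (sym Mp≈1)) ⟩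
                 M (suc i) zero * 0#  ≈⟨ zeroʳ _ ⟩
                 0#                   ∎) ⟩
    M′ zero zero * det (minor M′ zero)
            ≈⟨ *-cong (solve 1 (λ m → m :+ (con (0 , 0) :* m :+ con (0 , 0)) := m) refl _)
                 (det-cong {n} λ i j → solve 3 (λ x a b → x :+ ((:- a) :* b :+ con (0 , 0)) := x :- a :* b) refl
                   (M (suc i) (suc j)) (M (suc i) zero * p) (M zero (suc j))) ⟩
    M zero zero * det (λ i j → M (suc i) (suc j) - M (suc i) zero * p * M zero (suc j)) ∎
    where
    y : Fin (suc n) → Vector Carrier 1
    y zero    _ = 0#
    y (suc i) _ = - (M (suc i) zero * p)

    M′ : Matrix (suc n)
    M′ i j = M i j + (y i zero * M zero j + 0#)

  -- A symmetric matrix whose determinant has an inverse is invertible.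
  symmetric-invertible : ∀ {n} (M : Matrix n) p → det M * p ≈ 1# →
                         (∀ i j → M i j ≈ M j i) → InvertibleMatrix M
  symmetric-invertible M p p-inverse M-sym = inverse , left , right
    where
    inverse : Matrix _
    inverse i j = cofactor M j i * p

    right : (M · inverse) ≈ᴹ I
    right i j = begin
      sum (λ k → M i k * (cofactor M j k * p))  ≈⟨ sum-cong (λ k → *-assoc (M i k) (cofactor M j k) p) ⟨
      sum (λ k → M i k * cofactor M j k * p)    ≈⟨ *-distribʳ-sum p (λ k → M i k * cofactor M j k) ⟨
      sum (λ k → M i k * cofactor M j k) * p    ≈⟨ *-congʳ (sum-cofactor M i j) ⟩
      I i j * det M * p                         ≈⟨ *-assoc _ _ _ ⟩
      I i j * (det M * p)                       ≈⟨ *-congˡ p-inverse ⟩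
      I i j * 1#                                ≈⟨ *-identityʳ _ ⟩
      I i j                                     ∎

    -- By symmetry of M the transpose of the right inverse is a left inverse.
    left-transpose : ∀ i j → sum (λ k → inverse k i * M k j) ≈ I i j
    left-transpose i j = begin
      sum (λ k → inverse k i * M k j)  ≈⟨ sum-cong (λ k → trans (*-comm _ _) (*-congʳ (M-sym k j))) ⟩
      sum (λ k → M j k * inverse k i)  ≈⟨ right j i ⟩
      I j i                            ≈⟨ I-sym j i ⟩
      I i j                            ∎

    -- A left inverse and a right inverse coincide.
    inverse-sym : ∀ i j → inverse j i ≈ inverse i j
    inverse-sym i j = begin
      inverse j i
        ≈⟨ sum-Iʳ j (λ k → inverse k i) ⟨
      sum (λ k → inverse k i * I k j)
        ≈⟨ sum-cong (λ k → *-congˡ (right k j)) ⟨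
      sum (λ k → inverse k i * sum (λ l → M k l * inverse l j))
        ≈⟨ sum-cong (λ k → trans (*-distribˡ-sum (inverse k i) (λ l → M k l * inverse l j)) (sum-cong λ l → sym (*-assoc (inverse k i) (M k l) (inverse l j)))) ⟩
      sum (λ k → sum (λ l → inverse k i * M k l * inverse l j))
        ≈⟨ ∑-comm (λ k l → inverse k i * M k l * inverse l j) ⟩
      sum (λ l → sum (λ k → inverse k i * M k l * inverse l j))
        ≈⟨ sum-cong (λ l → sym (*-distribʳ-sum (inverse l j) (λ k → inverse k i * M k l))) ⟩
      sum (λ l → sum (λ k → inverse k i * M k l) * inverse l j)
        ≈⟨ sum-cong (λ l → *-congʳ (left-transpose i l)) ⟩
      sum (λ l → I i l * inverse l j)
        ≈⟨ sum-Iˡ i (λ l → inverse l j) ⟩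
      inverse i j ∎

    left : (inverse · M) ≈ᴹ I
    left i j = trans (sum-cong λ k → *-congʳ (sym (inverse-sym i k))) (left-transpose i j)

-- Ring homomorphisms and integral domains

module Homomorphisms {c₁ ℓ₁ c₂ ℓ₂} (R : CommutativeRing c₁ ℓ₁) (S : CommutativeRing c₂ ℓ₂) where

  private
    module R = CommutativeRing R
    module S = CommutativeRing S
    module RM = Matrices R
    module SM = Matrices S
    module RΣ = FiniteSums R
    module SΣ = FiniteSums S
    module RΠ = FiniteProducts R
    module SΠ = FiniteProducts S
    module RE = Exp R.semiring
    module SE = Exp S.semiring
    module RK = Mult R.semiring
    module SK = Mult S.semiring
  open RingMorphisms R.rawRing S.rawRing public using (IsRingHomomorphism)

  -- The laws of a homomorphism of rings, without the nesting of structures.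
  ringHomomorphism : ∀ {h : R.Carrier → S.Carrier} →
    (∀ {x y} → x R.≈ y → h x S.≈ h y) →
    (∀ x y → h (x R.+ y) S.≈ h x S.+ h y) →
    (∀ x y → h (x R.* y) S.≈ h x S.* h y) →
    (∀ x → h (R.- x) S.≈ S.- h x) →
    h R.0# S.≈ S.0# → h R.1# S.≈ S.1# →
    IsRingHomomorphism h
  ringHomomorphism cong + * - 0# 1# = record
    { isSemiringHomomorphism = record
      { isNearSemiringHomomorphism = record
        { +-isMonoidHomomorphism = record
          { isMagmaHomomorphism = record
            { isRelHomomorphism = record { cong = cong }
            ; homo = +
            }
          ; ε-homo = 0#
          }
        ; *-homo = *
        }
      ; 1#-homo = 1#
      }
    ; -‿homo = -
    }

  module _ {h : R.Carrier → S.Carrier} (isHom : IsRingHomomorphism h) where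

    open IsRingHomomorphism isHom
    open Determinants R using (minor)

    sum-homo : ∀ {n} (f : Vector R.Carrier n) → h (RΣ.sum f) S.≈ SΣ.sum (h ∘ f)
    sum-homo {zero}  f = 0#-homo
    sum-homo {suc n} f = S.trans (+-homo _ _) (S.+-congˡ (sum-homo (f ∘ suc)))

    product-homo : ∀ {n} (f : Vector R.Carrier n) → h (RΠ.product f) S.≈ SΠ.product (h ∘ f)
    product-homo {zero}  f = 1#-homo
    product-homo {suc n} f = S.trans (*-homo _ _) (S.*-congˡ (product-homo (f ∘ suc)))

    sign-homo : ∀ n → h ((R.- R.1#) RE.^ n) S.≈ (S.- S.1#) SE.^ n
    sign-homo zero    = 1#-homo
    sign-homo (suc n) = S.trans (*-homo _ _) (S.*-cong (S.trans (-‿homo _) (S.-‿cong 1#-homo)) (sign-homo n))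

    det-homo : ∀ {n} (M : RM.Matrix n) → h (RM.det M) S.≈ SM.det (λ i j → h (M i j))
    det-homo {zero}  M = 1#-homo
    det-homo {suc n} M = S.trans (sum-homo (λ j → (R.- R.1#) RE.^ toℕ j R.* M zero j R.* RM.det (minor M j))) (SΣ.sum-cong λ j →
      S.trans (*-homo _ _) (S.*-cong (S.trans (*-homo _ (M zero j)) (S.*-congʳ (sign-homo (toℕ j))))
        (det-homo (minor M j))))

    I-homo : ∀ {n} (i j : Fin n) → h (RM.I i j) S.≈ SM.I i j
    I-homo i j with i Fin.≟ j
    ... | yes _ = 1#-homo
    ... | no  _ = 0#-homo

    ×1-homo : ∀ n → h (n RK.× R.1#) S.≈ n SK.× S.1#
    ×1-homo zero    = 0#-homo
    ×1-homo (suc n) = S.trans (+-homo _ _) (S.+-cong 1#-homo (×1-homo n))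

module Domains {c ℓ} (D : IntegralDomain c ℓ) where

  open IntegralDomain D hiding (zero)
  open RingProperties ring using (x[y-z]≈xy-xz; x≈y⇒x∙y⁻¹≈ε; x∙y⁻¹≈ε⇒x≈y)

  *-cancelˡ-≉0 : ∀ {x y z} → x ≉ 0# → x * y ≈ x * z → y ≈ z
  *-cancelˡ-≉0 {x} {y} {z} x≉0 xy≈xz with (y - z) ≟0
  ... | yes y-z≈0 = x∙y⁻¹≈ε⇒x≈y y z y-z≈0
  ... | no  y-z≉0 = contradiction (trans (x[y-z]≈xy-xz x y z) (x≈y⇒x∙y⁻¹≈ε xy≈xz)) (*-≉0 x (y - z) x≉0 y-z≉0)

  product-≉0 : ∀ {n} (f : Vector Carrier n) → (∀ i → f i ≉ 0#) → FiniteProducts.product commutativeRing f ≉ 0#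
  product-≉0 {zero}  f f≉0 = 1≉0
  product-≉0 {suc n} f f≉0 = *-≉0 _ _ (f≉0 zero) (product-≉0 (f ∘ suc) (f≉0 ∘ suc))

  product≈0 : ∀ {n} (f : Vector Carrier n) → FiniteProducts.product commutativeRing f ≈ 0# → Σ[ i ∈ Fin n ] f i ≈ 0#
  product≈0 {zero}  f ∏≈0 = contradiction ∏≈0 1≉0
  product≈0 {suc n} f ∏≈0 with f zero ≟0
  ... | yes f₀≈0 = zero , f₀≈0
  ... | no  f₀≉0 = let i , fᵢ≈0 = product≈0 (f ∘ suc) (*-cancelˡ-≉0 f₀≉0 (trans ∏≈0 (sym (zeroʳ _)))) in suc i , fᵢ≈0

-- A field as an integral domain.
fieldDomain : ∀ {c ℓ} → Field c ℓ → IntegralDomain c ℓ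
fieldDomain K = record
  { commutativeRing = commutativeRing
  ; _≟0             = _≟ 0#
  ; 1≉0             = 1≉0
  ; *-≉0            = λ x y → PolynomialsOverField.*-≉0 K
  }
  where open Field K

-- Characteristic polynomials and their evaluation

-- Substitution of an element t of S for the indeterminate, the coefficients
-- being mapped by h.
module Evaluation {c₁ ℓ₁ c₂ ℓ₂} (R : CommutativeRing c₁ ℓ₁) (S : CommutativeRing c₂ ℓ₂)
  (h : CommutativeRing.Carrier R → CommutativeRing.Carrier S)
  (isHom : Homomorphisms.IsRingHomomorphism R S h)
  (t : CommutativeRing.Carrier S) where

  private module R = CommutativeRing R
  open CommutativeRing S hiding (zero)
  open Polynomials R
  open Homomorphisms.IsRingHomomorphism R S isHom using () renaming
    (⟦⟧-cong to h-cong; +-homo to h-+; *-homo to h-*; -‿homo to h-neg; 0#-homo to h-0; 1#-homo to h-1)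
  open RingIdentities S
  open SetoidReasoning setoid
  open RingProperties ring using (-0#≈0#)

  eval : Polynomial → Carrier
  eval []      = 0#
  eval (a ∷ p) = h a + t * eval p

  private
    eval-≈0 : ∀ p → p ≈ₚ [] → eval p ≈ 0#
    eval-≈0 []      _   = refl
    eval-≈0 (a ∷ p) p≈0 = begin
      h a + t * eval p  ≈⟨ +-cong (trans (h-cong (at p≈0 0)) h-0) (*-congˡ (eval-≈0 p (mk≈ λ k → at p≈0 (suc k)))) ⟩
      0# + t * 0#       ≈⟨ solve 1 (λ t → con (0 , 0) :+ t :* con (0 , 0) := con (0 , 0)) refl t ⟩
      0#                ∎

    eval-cong : ∀ {p q} → p ≈ₚ q → eval p ≈ eval q
    eval-cong {[]}    {q}     p≈q = sym (eval-≈0 q (mk≈ λ k → R.sym (at p≈q k)))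
    eval-cong {a ∷ p} {[]}    p≈q = eval-≈0 (a ∷ p) p≈q
    eval-cong {a ∷ p} {b ∷ q} p≈q =
      +-cong (h-cong (at p≈q 0)) (*-congˡ (eval-cong {p} {q} (mk≈ λ k → at p≈q (suc k))))

    eval-+ : ∀ p q → eval (p +ₚ q) ≈ eval p + eval q
    eval-+ []      q       = sym (+-identityˡ _)
    eval-+ (a ∷ p) []      = sym (+-identityʳ _)
    eval-+ (a ∷ p) (b ∷ q) = begin
      h (a R.+ b) + t * eval (p +ₚ q)          ≈⟨ +-cong (h-+ a b) (*-congˡ (eval-+ p q)) ⟩
      h a + h b + t * (eval p + eval q)        ≈⟨ solve 5 (λ a b t p q → a :+ b :+ t :* (p :+ q) := a :+ t :* p :+ (b :+ t :* q)) refl _ _ _ _ _ ⟩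
      h a + t * eval p + (h b + t * eval q)    ∎

    eval-neg : ∀ p → eval (-ₚ p) ≈ - eval p
    eval-neg []      = sym -0#≈0#
    eval-neg (a ∷ p) = begin
      h (R.- a) + t * eval (-ₚ p)  ≈⟨ +-cong (h-neg a) (*-congˡ (eval-neg p)) ⟩
      - h a + t * - eval p         ≈⟨ solve 3 (λ a t p → :- a :+ t :* (:- p) := :- (a :+ t :* p)) refl _ _ _ ⟩
      - (h a + t * eval p)         ∎

    eval-scale : ∀ a p → eval (scale a p) ≈ h a * eval p
    eval-scale a []      = sym (zeroʳ _)
    eval-scale a (b ∷ p) = begin
      h (a R.* b) + t * eval (scale a p)  ≈⟨ +-cong (h-* a b) (*-congˡ (eval-scale a p)) ⟩
      h a * h b + t * (h a * eval p)      ≈⟨ solve 4 (λ a b t p → a :* b :+ t :* (a :* p) := a :* (b :+ t :* p)) refl _ _ _ _ ⟩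
      h a * (h b + t * eval p)            ∎

    eval-* : ∀ p q → eval (p *ₚ q) ≈ eval p * eval q
    eval-* []      q = sym (zeroˡ _)
    eval-* (a ∷ p) q = begin
      eval (scale a q +ₚ (R.0# ∷ p *ₚ q))            ≈⟨ eval-+ (scale a q) (R.0# ∷ p *ₚ q) ⟩
      eval (scale a q) + (h R.0# + t * eval (p *ₚ q)) ≈⟨ +-cong (eval-scale a q) (+-cong h-0 (*-congˡ (eval-* p q))) ⟩
      h a * eval q + (0# + t * (eval p * eval q))     ≈⟨ solve 4 (λ a t p q → a :* q :+ (con (0 , 0) :+ t :* (p :* q)) := (a :+ t :* p) :* q) refl _ _ _ _ ⟩
      (h a + t * eval p) * eval q                     ∎

  eval-constant : ∀ a → eval (constant a) ≈ h a
  eval-constant a = solve 2 (λ a t → a :+ t :* con (0 , 0) := a) refl _ t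

  eval-indeterminate : eval indeterminate ≈ t
  eval-indeterminate = begin
    h R.0# + t * (h R.1# + t * 0#)  ≈⟨ +-cong h-0 (*-congˡ (+-congʳ h-1)) ⟩
    0# + t * (1# + t * 0#)          ≈⟨ solve 1 (λ t → con (0 , 0) :+ t :* (con (1 , 0) :+ t :* con (0 , 0)) := t) refl t ⟩
    t                               ∎

  eval-isRingHomomorphism : Homomorphisms.IsRingHomomorphism polynomialRing S eval
  eval-isRingHomomorphism = Homomorphisms.ringHomomorphism polynomialRing S
    (λ {p} {q} → eval-cong {p} {q}) eval-+ eval-* eval-neg refl (trans (eval-constant R.1#) h-1)

-- The characteristic matrix over the polynomial ring; its entries and its
-- determinant can be specialised at elements of other rings.
module CharacteristicMatrices {c ℓ} (K : Field c ℓ) where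

  private
    module K  = Field K
    module KM = Matrices K.commutativeRing
  open Polynomials K.commutativeRing
  module P  = CommutativeRing polynomialRing
  module PM = Matrices polynomialRing
  module PD = BlockDeterminants polynomialRing
  module PΠ = FiniteProducts polynomialRing

  -- The polynomial x - a.
  linear : K.Carrier → Polynomial
  linear a = indeterminate P.- constant a

  -- The matrix x I - M.
  characteristicMatrix : ∀ {n} → KM.Matrix n → PM.Matrix n
  characteristicMatrix M i j = indeterminate P.* PM.I i j P.- constant (M i j)

  linear-≉0 : ∀ a → linear a P.≉ P.0#
  linear-≉0 a eq = K.1≉0 (at eq 1)

  linear-cong : ∀ {a b} → a K.≈ b → linear a P.≈ linear b
  linear-cong a≈b = P.+-congˡ {indeterminate} (P.-‿cong {constant _} {constant _} (mk≈ λ { zero → a≈b ; (suc k) → K.refl }))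

  constant-isRingHomomorphism : Homomorphisms.IsRingHomomorphism K.commutativeRing polynomialRing constant
  constant-isRingHomomorphism = Homomorphisms.ringHomomorphism K.commutativeRing polynomialRing
    (λ a≈b → mk≈ λ { zero → a≈b ; (suc k) → K.refl })
    (λ a b → P.refl)
    (λ a b → mk≈ λ { zero → K.sym (K.+-identityʳ _) ; (suc k) → K.refl })
    (λ a → P.refl)
    (mk≈ λ { zero → K.refl ; (suc k) → K.refl })
    P.refl

  module Specialisation {c₂ ℓ₂} (S : CommutativeRing c₂ ℓ₂)
    (g : Polynomial → CommutativeRing.Carrier S)
    (g-isHom : Homomorphisms.IsRingHomomorphism polynomialRing S g) where

    open CommutativeRing S hiding (zero)
    open Homomorphisms polynomialRing S
    open IsRingHomomorphism g-isHom using (+-homo; *-homo; -‿homo)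

    specialise-linear : ∀ a → g (linear a) ≈ g indeterminate - g (constant a)
    specialise-linear a = trans (+-homo _ _) (+-congˡ (-‿homo _))

    specialise-matrix : ∀ {n} (M : KM.Matrix n) i j →
      g (characteristicMatrix M i j) ≈ g indeterminate * Matrices.I S i j - g (constant (M i j))
    specialise-matrix M i j = trans (+-homo _ _)
      (+-cong (trans (*-homo _ _) (*-congˡ (I-homo g-isHom i j))) (-‿homo _))

    specialise-det : ∀ {n} (M : KM.Matrix n) →
      g (PM.det (characteristicMatrix M)) ≈
      Matrices.det S (λ i j → g indeterminate * Matrices.I S i j - g (constant (M i j)))
    specialise-det M = trans (det-homo g-isHom (characteristicMatrix M))
      (Determinants.det-cong S (specialise-matrix M))

    specialise-withOnes : ∀ {n} (M : KM.Matrix (suc n)) →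
      g (PM.det (PD.withOnes (characteristicMatrix M))) ≈
      Matrices.det S (BlockDeterminants.withOnes S λ i j → g indeterminate * Matrices.I S i j - g (constant (M i j)))
    specialise-withOnes {n} M = trans (det-homo g-isHom (PD.withOnes (characteristicMatrix M)))
      (Determinants.det-cong S entries)
      where
      entries : ∀ (i j : Fin (suc n)) → g (PD.withOnes (characteristicMatrix M) i j) ≈
        BlockDeterminants.withOnes S (λ i j → g indeterminate * Matrices.I S i j - g (constant (M i j))) i j
      entries zero    j = IsRingHomomorphism.1#-homo g-isHom
      entries (suc i) j = specialise-matrix M (suc i) j

    specialise-product : ∀ {n} (λs : Vector K.Carrier n) →
      g (PΠ.product (linear ∘ λs)) ≈ FiniteProducts.product S (λ i → g indeterminate - g (constant (λs i)))
    specialise-product λs = trans (Homomorphisms.product-homo polynomialRing S g-isHom (linear ∘ λs))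
      (FiniteProducts.product-cong S (specialise-linear ∘ λs))

  open RationalFunctions K using (polynomialDomain; rationalFunctionField; C)
  private
    module F = Fractions polynomialDomain
    module L = Field rationalFunctionField
    open RingIdentities polynomialRing

  embed-isRingHomomorphism : Homomorphisms.IsRingHomomorphism polynomialRing L.commutativeRing F.embed
  embed-isRingHomomorphism = Homomorphisms.ringHomomorphism polynomialRing L.commutativeRing
    (λ p≈q → F.mk≈ (P.*-congʳ p≈q))
    (λ p q → F.mk≈ (solve 2 (λ p q → (p :+ q) :* (con (1 , 0) :* con (1 , 0)) := (p :* con (1 , 0) :+ q :* con (1 , 0)) :* con (1 , 0)) P.refl p q))
    (λ p q → F.mk≈ (P.*-congˡ {p P.* q} (P.*-identityˡ P.1#)))
    (λ p → L.refl)
    L.refl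
    L.refl

  embed-injective : ∀ {p q} → F.embed p L.≈ F.embed q → p P.≈ q
  embed-injective (F.mk≈ eq) = P.trans (P.sym (P.*-identityʳ _)) (P.trans eq (P.*-identityʳ _))

  C-isRingHomomorphism : Homomorphisms.IsRingHomomorphism K.commutativeRing L.commutativeRing C
  C-isRingHomomorphism = Composition.isRingHomomorphism L.trans constant-isRingHomomorphism embed-isRingHomomorphism

  open RationalFunctions K using (X)

  -- An identity of rational functions is an identity of polynomials.
  splits-polynomial : ∀ {n} (M : KM.Matrix n) (λs : Vector K.Carrier n) →
    Matrices.det L.commutativeRing (λ i j → X L.* Matrices.I L.commutativeRing i j L.- C (M i j))
      L.≈ FiniteProducts.product L.commutativeRing (λ i → X L.- C (λs i)) →
    PM.det (characteristicMatrix M) P.≈ PΠ.product (linear ∘ λs)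
  splits-polynomial M λs splits = embed-injective
    (L.trans (specialise-det M) (L.trans splits (L.sym (specialise-product λs))))
    where open Specialisation L.commutativeRing F.embed embed-isRingHomomorphism

  private
    module KΣ = FiniteSums K.commutativeRing
    module PΣ = FiniteSums polynomialRing

  -- If the columns of M have sum r, those of x I - M have sum x - r.
  columnSums : ∀ {n} (M : KM.Matrix n) {r} → (∀ j → KΣ.sum (λ i → M i j) K.≈ r) →
               ∀ j → PΣ.sum (λ i → characteristicMatrix M i j) P.≈ linear r
  columnSums M {r} sums j = begin
    PΣ.sum (λ i → indeterminate P.* PM.I i j P.- constant (M i j))
      ≈⟨ PD.sum-characteristic indeterminate (λ i j → constant (M i j)) j ⟩
    indeterminate P.- PΣ.sum (λ i → constant (M i j))
      ≈⟨ P.+-congˡ {indeterminate} (P.-‿cong {PΣ.sum (λ i → constant (M i j))} {constant r} (P.trans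
           (P.sym (Homomorphisms.sum-homo K.commutativeRing polynomialRing constant-isRingHomomorphism (λ i → M i j)))
           (mk≈ λ { zero → sums j ; (suc k) → K.refl }))) ⟩
    linear r ∎
    where open SetoidReasoning P.setoid

  -- If the columns of M have sum r and M has the eigenvalues λs, then r is one
  -- of them; cancelling x - r in det (x I - M) = (x - r) det (withOnes (x I - M))
  -- shows that the others are the roots of det (withOnes (x I - M)).
  splits-withOnes : ∀ {n} (M : KM.Matrix (suc n)) {r} → (∀ j → KΣ.sum (λ i → M i j) K.≈ r) →
    (λs : Vector K.Carrier (suc n)) →
    PM.det (characteristicMatrix M) P.≈ PΠ.product (linear ∘ λs) →
    Σ[ i ∈ Fin (suc n) ] (λs i K.≈ r ×
      PM.det (PD.withOnes (characteristicMatrix M)) P.≈ PΠ.product (linear ∘ λs ∘ punchIn i))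
  splits-withOnes M {r} sums λs splits = i₀ , λ≈r , Domains.*-cancelˡ-≉0 polynomialDomain (linear-≉0 r) (begin
    linear r P.* PM.det (PD.withOnes (characteristicMatrix M))  ≈⟨ factor ⟨
    PM.det (characteristicMatrix M)                             ≈⟨ splits ⟩
    PΠ.product (linear ∘ λs)                                    ≈⟨ PΠ.product-remove {i = i₀} (linear ∘ λs) ⟩
    linear (λs i₀) P.* PΠ.product (linear ∘ λs ∘ punchIn i₀)    ≈⟨ P.*-congʳ (linear-cong λ≈r) ⟩
    linear r P.* PΠ.product (linear ∘ λs ∘ punchIn i₀)          ∎)
    where
    open SetoidReasoning P.setoid
    factor : PM.det (characteristicMatrix M) P.≈ linear r P.* PM.det (PD.withOnes (characteristicMatrix M))
    factor = PD.det-columnSums (characteristicMatrix M) (columnSums M sums)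

    -- Evaluation at r makes the product of the r - λs i vanish.
    open Evaluation K.commutativeRing K.commutativeRing id (Identity.isRingHomomorphism K.rawRing K.refl) r
    open Specialisation K.commutativeRing eval eval-isRingHomomorphism
    module E = Homomorphisms.IsRingHomomorphism polynomialRing K.commutativeRing eval-isRingHomomorphism
    open RingProperties K.ring using (x∙y⁻¹≈ε⇒x≈y)

    eval-linear : ∀ a → eval (linear a) K.≈ r K.- a
    eval-linear a = K.trans (specialise-linear a) (K.+-cong eval-indeterminate (K.-‿cong (eval-constant a)))

    ∏≈0 : FiniteProducts.product K.commutativeRing (eval ∘ linear ∘ λs) K.≈ K.0#
    ∏≈0 = K.trans (K.sym (Homomorphisms.product-homo polynomialRing K.commutativeRing eval-isRingHomomorphism (linear ∘ λs)))
      (K.trans (E.⟦⟧-cong (P.trans (P.sym splits) factor))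
      (K.trans (E.*-homo (linear r) (PM.det (PD.withOnes (characteristicMatrix M))))
      (K.trans (K.*-congʳ (K.trans (eval-linear r) (K.-‿inverseʳ r))) (K.zeroˡ _))))

    root : Σ[ i ∈ Fin _ ] eval (linear (λs i)) K.≈ K.0#
    root = Domains.product≈0 (fieldDomain K) (eval ∘ linear ∘ λs) ∏≈0

    i₀ = proj₁ root

    λ≈r : λs i₀ K.≈ r
    λ≈r = K.sym (x∙y⁻¹≈ε⇒x≈y r (λs i₀) (K.trans (K.sym (eval-linear (λs i₀))) (proj₂ root)))

  -- A splitting of det (withOnes (x I - M)) holds at all arguments in K-algebras.
  specialise-splitting : ∀ {c₂ ℓ₂} (S : CommutativeRing c₂ ℓ₂) (let module S = CommutativeRing S)
    (h : K.Carrier → S.Carrier) → Homomorphisms.IsRingHomomorphism K.commutativeRing S h → (t : S.Carrier) →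
    ∀ {m n} (M : KM.Matrix (suc n)) (λs : Vector K.Carrier m) →
    PM.det (PD.withOnes (characteristicMatrix M)) P.≈ PΠ.product (linear ∘ λs) →
    Matrices.det S (BlockDeterminants.withOnes S λ i j → t S.* Matrices.I S i j S.- h (M i j))
      S.≈ FiniteProducts.product S (λ i → t S.- h (λs i))
  specialise-splitting S h isHom t M λs splits = begin
    Matrices.det S (BlockDeterminants.withOnes S λ i j → t S.* Matrices.I S i j S.- h (M i j))
      ≈⟨ BlockDeterminants.det-withOnes-cong S (λ i j → S.+-cong (S.*-congʳ {Matrices.I S i j} eval-indeterminate) (S.-‿cong (eval-constant (M i j)))) ⟨
    Matrices.det S (BlockDeterminants.withOnes S λ i j → eval indeterminate S.* Matrices.I S i j S.- eval (constant (M i j)))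
      ≈⟨ specialise-withOnes M ⟨
    eval (PM.det (PD.withOnes (characteristicMatrix M)))
      ≈⟨ Homomorphisms.IsRingHomomorphism.⟦⟧-cong polynomialRing S eval-isRingHomomorphism splits ⟩
    eval (PΠ.product (linear ∘ λs))
      ≈⟨ specialise-product λs ⟩
    FiniteProducts.product S (λ i → eval indeterminate S.- eval (constant (λs i)))
      ≈⟨ FiniteProducts.product-cong S (λ i → S.+-cong eval-indeterminate (S.-‿cong (eval-constant (λs i)))) ⟩
    FiniteProducts.product S (λ i → t S.- h (λs i)) ∎
    where
    module S = CommutativeRing S
    open SetoidReasoning S.setoid
    open Evaluation K.commutativeRing S h isHom t
    open Specialisation S eval eval-isRingHomomorphism

-- Matrices with anisotropic quadratic form

-- A matrix whose quadratic form vanishes only at 0 is nonsingular: the form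
-- of the Schur complement of the entry (0 , 0) is a restriction of it.
module Anisotropic {c ℓ} (K : Field c ℓ) where

  open Field K hiding (zero)
  open Matrices commutativeRing
  open FiniteSums commutativeRing
  open Determinants commutativeRing
  open BlockDeterminants commutativeRing
  open RingIdentities commutativeRing
  open SetoidReasoning setoid

  -- The quadratic form of M at v.
  form : ∀ {n} → Matrix n → Vector Carrier n → Carrier
  form M v = sum λ i → v i * sum λ j → M i j * v j

  det≉0 : ∀ {n} (M : Matrix n) → (∀ v → form M v ≈ 0# → ∀ i → v i ≈ 0#) → det M ≉ 0#
  det≉0 {zero}  M anisotropic = 1≉0
  det≉0 {suc n} M anisotropic det≈0 = det≉0 S S-anisotropic (Domains.*-cancelˡ-≉0 (fieldDomain K) M₀₀≉0
    (trans (sym (det-pivot M p (*-inverseʳ M₀₀≉0))) (trans det≈0 (sym (zeroʳ _)))))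
    where
    M₀₀ = M zero zero

    -- M₀₀ is the value of the form at the unit vector I zero.
    M₀₀≉0 : M₀₀ ≉ 0#
    M₀₀≉0 M₀₀≈0 = 1≉0 (anisotropic (I zero) (begin
      sum (λ i → I zero i * sum λ j → M i j * I zero j)  ≈⟨ sum-Iˡ zero (λ i → sum λ j → M i j * I zero j) ⟩
      sum (λ j → M zero j * I zero j)                    ≈⟨ sum-cong (λ j → *-comm (M zero j) (I zero j)) ⟩
      sum (λ j → I zero j * M zero j)                    ≈⟨ sum-Iˡ zero (M zero) ⟩
      M₀₀                                                ≈⟨ M₀₀≈0 ⟩
      0#                                                 ∎) zero)

    p : Carrier
    p = M₀₀ ⁻¹

    -- The Schur complement of the entry (0 , 0).
    S : Matrix n
    S i j = M (suc i) (suc j) - M (suc i) zero * p * M zero (suc j)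

    S-anisotropic : ∀ w → form S w ≈ 0# → ∀ i → w i ≈ 0#
    S-anisotropic w form≈0 i = anisotropic v (trans form-v form≈0) (suc i)
      where
      s : Carrier
      s = sum λ j → M zero (suc j) * w j

      -- The value at index 0 makes row 0 of M orthogonal to v.
      v : Vector Carrier (suc n)
      v zero    = - (p * s)
      v (suc j) = w j

      row₀ : M₀₀ * - (p * s) + s ≈ 0#
      row₀ = begin
        M₀₀ * - (p * s) + s   ≈⟨ solve 3 (λ m p s → m :* (:- (p :* s)) :+ s := (con (1 , 0) :- m :* p) :* s) refl M₀₀ p s ⟩
        (1# - M₀₀ * p) * s    ≈⟨ *-congʳ (trans (+-congˡ (-‿cong (*-inverseʳ M₀₀≉0))) (-‿inverseʳ 1#)) ⟩
        0# * s                ≈⟨ zeroˡ s ⟩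
        0#                    ∎

      row : ∀ i → M (suc i) zero * - (p * s) + sum (λ j → M (suc i) (suc j) * w j) ≈ sum (λ j → S i j * w j)
      row i = begin
        M (suc i) zero * - (p * s) + sum (λ j → M (suc i) (suc j) * w j)
          ≈⟨ solve 4 (λ m p s t → m :* (:- (p :* s)) :+ t := con (1 , 0) :* t :+ (:- (m :* p)) :* s) refl (M (suc i) zero) p s _ ⟩
        1# * sum (λ j → M (suc i) (suc j) * w j) + - (M (suc i) zero * p) * s
          ≈⟨ sum-linear (λ j → M (suc i) (suc j) * w j) (λ j → M zero (suc j) * w j) 1# (- (M (suc i) zero * p)) ⟨
        sum (λ j → 1# * (M (suc i) (suc j) * w j) + - (M (suc i) zero * p) * (M zero (suc j) * w j))
          ≈⟨ sum-cong (λ j → solve 4 (λ m q b w → con (1 , 0) :* (m :* w) :+ (:- q) :* (b :* w) := (m :- q :* b) :* w) refl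
               (M (suc i) (suc j)) (M (suc i) zero * p) (M zero (suc j)) (w j)) ⟩
        sum (λ j → S i j * w j) ∎

      form-v : form M v ≈ form S w
      form-v = begin
        - (p * s) * (M₀₀ * - (p * s) + s) + sum (λ i → w i * (M (suc i) zero * - (p * s) + sum (λ j → M (suc i) (suc j) * w j)))
          ≈⟨ +-cong (trans (*-congˡ row₀) (zeroʳ _)) (sum-cong λ i → *-congˡ {w i} (row i)) ⟩
        0# + form S w  ≈⟨ +-identityˡ _ ⟩
        form S w       ∎

-- Adjacency and incidence matrices of regular graphs

module Indicators {c ℓ} (R : CommutativeRing c ℓ) where

  open CommutativeRing R hiding (zero)
  open FiniteSums R
  open Mult semiring using () renaming (_×_ to _•_)
  open RingIdentities R

  -- The Iverson bracket.  The entries of adjacency and identity matrices are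
  -- such brackets by definition.
  ⟦_⟧ : ∀ {p} {P : Set p} → Dec P → Carrier
  ⟦ P? ⟧ = if does P? then 1# else 0#

  ⟦⟧-true : ∀ {p} {P : Set p} (P? : Dec P) → P → ⟦ P? ⟧ ≈ 1#
  ⟦⟧-true (yes _) _ = refl
  ⟦⟧-true (no ¬p) p = contradiction p ¬p

  ⟦⟧-false : ∀ {p} {P : Set p} (P? : Dec P) → ¬ P → ⟦ P? ⟧ ≈ 0#
  ⟦⟧-false (yes p) ¬p = contradiction p ¬p
  ⟦⟧-false (no _)  _  = refl

  ⟦⟧-⇔ : ∀ {p q} {P : Set p} {Q : Set q} (P? : Dec P) (Q? : Dec Q) → (P → Q) → (Q → P) → ⟦ P? ⟧ ≈ ⟦ Q? ⟧
  ⟦⟧-⇔ (yes p) Q? P→Q Q→P = sym (⟦⟧-true Q? (P→Q p))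
  ⟦⟧-⇔ (no ¬p) Q? P→Q Q→P = sym (⟦⟧-false Q? (¬p ∘ Q→P))

  ⟦⟧-¬ : ∀ {p} {P : Set p} (P? : Dec P) → ⟦ ¬? P? ⟧ ≈ 1# - ⟦ P? ⟧
  ⟦⟧-¬ (yes _) = sym (-‿inverseʳ 1#)
  ⟦⟧-¬ (no _)  = solve 0 (con (1 , 0) := con (1 , 0) :- con (0 , 0)) refl

  ⟦⟧-× : ∀ {p q} {P : Set p} {Q : Set q} (P? : Dec P) (Q? : Dec Q) → ⟦ P? ×-dec Q? ⟧ ≈ ⟦ P? ⟧ * ⟦ Q? ⟧
  ⟦⟧-× (yes _) (yes _) = sym (*-identityˡ 1#)
  ⟦⟧-× (yes _) (no _)  = sym (*-identityˡ 0#)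
  ⟦⟧-× (no _)  Q?      = sym (zeroˡ ⟦ Q? ⟧)

  ⟦⟧-⊎ : ∀ {p q} {P : Set p} {Q : Set q} (P? : Dec P) (Q? : Dec Q) → ¬ (P × Q) → ⟦ P? ⊎-dec Q? ⟧ ≈ ⟦ P? ⟧ + ⟦ Q? ⟧
  ⟦⟧-⊎ (yes p) (yes q) ¬pq = contradiction (p , q) ¬pq
  ⟦⟧-⊎ (yes _) (no _)  _   = sym (+-identityʳ 1#)
  ⟦⟧-⊎ (no _)  Q?      _   = sym (+-identityˡ ⟦ Q? ⟧)

  -- The sum of g over the elements of a list.
  sumList : ∀ {a} {A : Set a} → (A → Carrier) → List A → Carrier
  sumList g = List.foldr (λ x s → g x + s) 0#

  sumList-cong : ∀ {a} {A : Set a} {g h : A → Carrier} → (∀ x → g x ≈ h x) → ∀ xs → sumList g xs ≈ sumList h xs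
  sumList-cong g≈h []       = refl
  sumList-cong g≈h (x ∷ xs) = +-cong (g≈h x) (sumList-cong g≈h xs)

  sumList-++ : ∀ {a} {A : Set a} (g : A → Carrier) xs ys → sumList g (xs ++ ys) ≈ sumList g xs + sumList g ys
  sumList-++ g []       ys = sym (+-identityˡ _)
  sumList-++ g (x ∷ xs) ys = trans (+-congˡ (sumList-++ g xs ys)) (sym (+-assoc _ _ _))

  sumList-map : ∀ {a b} {A : Set a} {B : Set b} (g : B → Carrier) (f : A → B) xs → sumList g (List.map f xs) ≈ sumList (g ∘ f) xs
  sumList-map g f []       = refl
  sumList-map g f (x ∷ xs) = +-congˡ (sumList-map g f xs)

  sumList-cartesianProduct : ∀ {a b} {A : Set a} {B : Set b} (g : A × B → Carrier) xs ys →
    sumList g (cartesianProduct xs ys) ≈ sumList (λ x → sumList (λ y → g (x , y)) ys) xs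
  sumList-cartesianProduct g []       ys = refl
  sumList-cartesianProduct g (x ∷ xs) ys = trans (sumList-++ g (List.map (x ,_) ys) (cartesianProduct xs ys))
    (+-cong (sumList-map g (x ,_) ys) (sumList-cartesianProduct g xs ys))

  sumList-tabulate : ∀ {a} {A : Set a} (g : A → Carrier) {n} (f : Fin n → A) → sumList g (tabulate f) ≈ sum (g ∘ f)
  sumList-tabulate g {zero}  f = refl
  sumList-tabulate g {suc n} f = +-congˡ (sumList-tabulate g (f ∘ suc))

  sumList-filter : ∀ {a p} {A : Set a} {P : Pred A p} (P? : Decidable P) (g : A → Carrier) xs →
                   sumList g (filter P? xs) ≈ sumList (λ x → ⟦ P? x ⟧ * g x) xs
  sumList-filter P? g []       = refl
  sumList-filter P? g (x ∷ xs) with P? x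
  ... | yes _ = +-cong (sym (*-identityˡ (g x))) (sumList-filter P? g xs)
  ... | no  _ = trans (sumList-filter P? g xs) (sym (trans (+-congʳ (zeroˡ (g x))) (+-identityˡ _)))

  sum-lookup : ∀ {a} {A : Set a} (g : A → Carrier) xs → sum (λ i → g (lookup xs i)) ≈ sumList g xs
  sum-lookup g []       = refl
  sum-lookup g (x ∷ xs) = +-congˡ (sum-lookup g xs)

  sumList-1 : ∀ {a} {A : Set a} (xs : List A) → sumList (const 1#) xs ≈ length xs • 1#
  sumList-1 []       = refl
  sumList-1 (x ∷ xs) = +-congˡ (sumList-1 xs)

module GraphMatrices {c ℓ} (R : CommutativeRing c ℓ) {n} (G : Graph (Fin n)) where

  open CommutativeRing R hiding (zero)
  open Matrices R using (Matrix; I)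
  open FiniteSums R
  open Determinants R using (sum-Iˡ; I-sym)
  open Indicators R
  open Mult semiring using () renaming (_×_ to _•_)
  open RingIdentities R
  open SetoidReasoning setoid
  open Graph G

  A : Matrix n
  A = adjacencyMatrix R G

  A-sym : ∀ u v → A u v ≈ A v u
  A-sym u v = ⟦⟧-⇔ (u ~? v) (v ~? u) ~-sym ~-sym

  rowSums : ∀ {r} → Regular G r → ∀ u → sum (A u) ≈ r • 1#
  rowSums {r} regular u = begin
    sum (A u)                                         ≈⟨ sumList-tabulate (A u) id ⟨
    sumList (A u) (allFin n)                          ≈⟨ sumList-cong (λ v → *-identityʳ (A u v)) (allFin n) ⟨
    sumList (λ v → A u v * 1#) (allFin n)             ≈⟨ sumList-filter (u ~?_) (const 1#) (allFin n) ⟨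
    sumList (const 1#) (filter (u ~?_) (allFin n))    ≈⟨ sumList-1 (filter (u ~?_) (allFin n)) ⟩
    degree G u • 1#                                   ≈⟨ reflexive (≡.cong (_• 1#) (regular u)) ⟩
    r • 1#                                            ∎

  columnSums : ∀ {r} → Regular G r → ∀ v → sum (λ u → A u v) ≈ r • 1#
  columnSums regular v = trans (sum-cong λ u → A-sym u v) (rowSums regular v)

  -- The vertex-edge incidence matrix.
  B : Fin n → Fin (size G) → Carrier
  B u e = ⟦ _∈ₑ?_ G u e ⟧

  private
    -- The adjacency matrix of the orientation of G by increasing index; its
    -- nonzero entries are the listed edges.
    w : Matrix n
    w i j = ⟦ (i Fin.<? j) ×-dec (i ~? j) ⟧

    w-diagonal : ∀ i → w i i ≈ 0#
    w-diagonal i = ⟦⟧-false ((i Fin.<? i) ×-dec (i ~? i)) (λ (i<i , _) → Fin.<-irrefl ≡.refl i<i)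

    w+w : ∀ i j → w i j + w j i ≈ A i j
    w+w i j with Fin.<-cmp i j
    ... | tri< i<j _ j≮i = trans (+-cong
          (⟦⟧-⇔ ((i Fin.<? j) ×-dec (i ~? j)) (i ~? j) proj₂ (i<j ,_))
          (⟦⟧-false ((j Fin.<? i) ×-dec (j ~? i)) (j≮i ∘ proj₁))) (+-identityʳ _)
    ... | tri≈ _ ≡.refl _ = trans (+-cong (w-diagonal i) (w-diagonal i))
          (trans (+-identityˡ 0#) (sym (⟦⟧-false (i ~? i) (~-irrefl ≡.refl))))
    ... | tri> i≮j _ j<i = trans (+-cong
          (⟦⟧-false ((i Fin.<? j) ×-dec (i ~? j)) (i≮j ∘ proj₁))
          (⟦⟧-⇔ ((j Fin.<? i) ×-dec (j ~? i)) (i ~? j) (~-sym ∘ proj₂) (λ i~j → j<i , ~-sym i~j))) (+-identityˡ _)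

    -- Whether u is one of the two elements of a pair.
    endpoint : Fin n → Fin n × Fin n → Carrier
    endpoint u (i , j) = ⟦ (u Fin.≟ i) ⊎-dec (u Fin.≟ j) ⟧

    -- Pairs with equal elements are not edges, and for the others the two ways
    -- of being an endpoint exclude each other.
    weighted : ∀ u v i j → w i j * (endpoint u (i , j) * endpoint v (i , j))
                         ≈ w i j * ((I u i + I u j) * (I v i + I v j))
    weighted u v i j with i Fin.≟ j
    ... | yes ≡.refl = trans (trans (*-congʳ (w-diagonal i)) (zeroˡ _)) (sym (trans (*-congʳ (w-diagonal i)) (zeroˡ _)))
    ... | no  i≢j    = *-congˡ (*-cong (split u) (split v))
      where
      split : ∀ u → endpoint u (i , j) ≈ I u i + I u j
      split u = ⟦⟧-⊎ (u Fin.≟ i) (u Fin.≟ j) λ { (≡.refl , u≡j) → i≢j u≡j }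

  -- B Bᵀ = A + r I.
  gram : ∀ {r} → Regular G r → ∀ u v → sum (λ e → B u e * B v e) ≈ A u v + (r • 1#) * I u v
  gram {r} regular u v = begin
    sum (λ e → B u e * B v e)
      ≈⟨ sum-lookup (λ p → endpoint u p * endpoint v p) (edges G) ⟩
    sumList (λ p → endpoint u p * endpoint v p) (edges G)
      ≈⟨ sumList-filter (λ (i , j) → (i Fin.<? j) ×-dec (i ~? j)) (λ p → endpoint u p * endpoint v p) (cartesianProduct (allFin n) (allFin n)) ⟩
    sumList (λ (i , j) → w i j * (endpoint u (i , j) * endpoint v (i , j))) (cartesianProduct (allFin n) (allFin n))
      ≈⟨ sumList-cong (λ (i , j) → weighted u v i j) (cartesianProduct (allFin n) (allFin n)) ⟩
    sumList (λ (i , j) → w i j * ((I u i + I u j) * (I v i + I v j))) (cartesianProduct (allFin n) (allFin n))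
      ≈⟨ sumList-cartesianProduct (λ (i , j) → w i j * ((I u i + I u j) * (I v i + I v j))) (allFin n) (allFin n) ⟩
    sumList (λ i → sumList (λ j → w i j * ((I u i + I u j) * (I v i + I v j))) (allFin n)) (allFin n)
      ≈⟨ sumList-tabulate (λ i → sumList (λ j → w i j * ((I u i + I u j) * (I v i + I v j))) (allFin n)) id ⟩
    sum (λ i → sumList (λ j → w i j * ((I u i + I u j) * (I v i + I v j))) (allFin n))
      ≈⟨ sum-cong (λ i → sumList-tabulate (λ j → w i j * ((I u i + I u j) * (I v i + I v j))) id) ⟩
    sum (λ i → sum λ j → w i j * ((I u i + I u j) * (I v i + I v j)))
      ≈⟨ sum-cong (λ i → trans (sum-cong λ j → expand (w i j) (I u i) (I u j) (I v i) (I v j))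
           (trans (∑-distrib-+ (λ j → I u i * (I v i * w i j) + I u i * (I v j * w i j)) (λ j → I v i * (I u j * w i j) + I u j * (I v j * w i j)))
             (+-cong (∑-distrib-+ (λ j → I u i * (I v i * w i j)) (λ j → I u i * (I v j * w i j)))
                     (∑-distrib-+ (λ j → I v i * (I u j * w i j)) (λ j → I u j * (I v j * w i j)))))) ⟩
    sum (λ i → (ii i + ij i) + (ji i + jj i))
      ≈⟨ trans (∑-distrib-+ (λ i → ii i + ij i) (λ i → ji i + jj i)) (+-cong (∑-distrib-+ ii ij) (∑-distrib-+ ji jj)) ⟩
    (sum ii + sum ij) + (sum ji + sum jj)
      ≈⟨ +-cong (+-cong sum-ii (sum-mixed u v)) (+-cong (sum-mixed v u) sum-jj) ⟩
    (I v u * sum (w u) + w u v) + (w v u + I v u * sum (λ i → w i u))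
      ≈⟨ solve 5 (λ a b c d e → a :* b :+ c :+ (d :+ a :* e) := a :* (b :+ e) :+ (c :+ d)) refl _ _ _ _ _ ⟩
    I v u * (sum (w u) + sum (λ i → w i u)) + (w u v + w v u)
      ≈⟨ +-cong (*-cong (I-sym v u) (trans (sym (∑-distrib-+ (w u) (λ i → w i u))) (trans (sum-cong (w+w u)) (rowSums regular u)))) (w+w u v) ⟩
    I u v * (r • 1#) + A u v
      ≈⟨ trans (+-comm _ _) (+-congˡ (*-comm _ _)) ⟩
    A u v + (r • 1#) * I u v ∎
    where
    -- The inner sums of the expanded product, named by the indices that are
    -- identified with u and v.
    ii ij ji jj : Fin n → Carrier
    ii i = sum λ j → I u i * (I v i * w i j)
    ij i = sum λ j → I u i * (I v j * w i j)
    ji i = sum λ j → I v i * (I u j * w i j)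
    jj i = sum λ j → I u j * (I v j * w i j)

    expand : ∀ w a b c d → w * ((a + b) * (c + d)) ≈ (a * (c * w) + a * (d * w)) + (c * (b * w) + b * (d * w))
    expand = solve 5 (λ w a b c d → w :* ((a :+ b) :* (c :+ d)) :=
      (a :* (c :* w) :+ a :* (d :* w)) :+ (c :* (b :* w) :+ b :* (d :* w))) refl

    sum-mixed : ∀ u v → sum (λ i → sum λ j → I u i * (I v j * w i j)) ≈ w u v
    sum-mixed u v = begin
      sum (λ i → sum λ j → I u i * (I v j * w i j))  ≈⟨ sum-cong (λ i → *-distribˡ-sum (I u i) (λ j → I v j * w i j)) ⟨
      sum (λ i → I u i * sum λ j → I v j * w i j)    ≈⟨ sum-Iˡ u (λ i → sum λ j → I v j * w i j) ⟩
      sum (λ j → I v j * w u j)                      ≈⟨ sum-Iˡ v (w u) ⟩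
      w u v                                          ∎

    sum-ii : sum ii ≈ I v u * sum (w u)
    sum-ii = begin
      sum ii                                         ≈⟨ sum-cong (λ i → trans (*-congˡ (*-distribˡ-sum (I v i) (w i))) (*-distribˡ-sum (I u i) (λ j → I v i * w i j))) ⟨
      sum (λ i → I u i * (I v i * sum (w i)))        ≈⟨ sum-Iˡ u (λ i → I v i * sum (w i)) ⟩
      I v u * sum (w u)                              ∎

    sum-jj : sum jj ≈ I v u * sum (λ i → w i u)
    sum-jj = begin
      sum jj
        ≈⟨ ∑-comm (λ i j → I u j * (I v j * w i j)) ⟩
      sum (λ j → sum λ i → I u j * (I v j * w i j))
        ≈⟨ sum-cong (λ j → trans (*-congˡ (*-distribˡ-sum (I v j) (λ i → w i j))) (*-distribˡ-sum (I u j) (λ i → I v j * w i j))) ⟨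
      sum (λ j → I u j * (I v j * sum λ i → w i j))
        ≈⟨ sum-Iˡ u (λ j → I v j * sum λ i → w i j) ⟩
      I v u * sum (λ i → w i u) ∎

-- The Laplacian form of a connected regular graph

module OrderedFieldSums {c ℓ₁ ℓ₂} (K : OrderedField c ℓ₁ ℓ₂) where

  open OrderedField K hiding (zero)
  open IsTotalOrder isTotalOrder using (total; antisym; ≤-respˡ-≈; ≤-respʳ-≈) renaming (reflexive to ≤-reflexive; trans to ≤-trans)
  open FiniteSums commutativeRing
  open RingIdentities commutativeRing

  NonNeg : Carrier → Set ℓ₂
  NonNeg x = 0# ≤ x

  square-nonNeg : ∀ x → NonNeg (x * x)
  square-nonNeg x with total 0# x
  ... | inj₁ 0≤x = *-nonNeg 0≤x 0≤x
  ... | inj₂ x≤0 = ≤-respʳ-≈ (solve 1 (λ x → (:- x) :* (:- x) := x :* x) refl x) (*-nonNeg 0≤-x 0≤-x)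
    where
    0≤-x : NonNeg (- x)
    0≤-x = ≤-respʳ-≈ (+-identityˡ (- x)) (≤-respˡ-≈ (-‿inverseʳ x) (+-monoˡ-≤ (- x) x≤0))

  1-nonNeg : NonNeg 1#
  1-nonNeg = ≤-respʳ-≈ (*-identityˡ 1#) (square-nonNeg 1#)

  +-nonNeg : ∀ {x y} → NonNeg x → NonNeg y → NonNeg (x + y)
  +-nonNeg {x} {y} 0≤x 0≤y = ≤-trans 0≤y (≤-respˡ-≈ (+-identityˡ y) (+-monoˡ-≤ y 0≤x))

  +≈0ˡ : ∀ {x y} → NonNeg x → NonNeg y → x + y ≈ 0# → x ≈ 0#
  +≈0ˡ {x} {y} 0≤x 0≤y x+y≈0 = antisym
    (≤-respʳ-≈ (trans (+-comm y x) x+y≈0) (≤-respˡ-≈ (+-identityˡ x) (+-monoˡ-≤ x 0≤y))) 0≤x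

  sum-nonNeg : ∀ {n} (f : Vector Carrier n) → (∀ i → NonNeg (f i)) → NonNeg (sum f)
  sum-nonNeg {zero}  f 0≤f = ≤-reflexive refl
  sum-nonNeg {suc n} f 0≤f = +-nonNeg (0≤f zero) (sum-nonNeg (f ∘ suc) (0≤f ∘ suc))

  sum≈0 : ∀ {n} (f : Vector Carrier n) → (∀ i → NonNeg (f i)) → sum f ≈ 0# → ∀ i → f i ≈ 0#
  sum≈0 {suc n} f 0≤f ∑≈0 zero    = +≈0ˡ (0≤f zero) (sum-nonNeg (f ∘ suc) (0≤f ∘ suc)) ∑≈0
  sum≈0 {suc n} f 0≤f ∑≈0 (suc i) = sum≈0 (f ∘ suc) (0≤f ∘ suc)
    (+≈0ˡ (sum-nonNeg (f ∘ suc) (0≤f ∘ suc)) (0≤f zero) (trans (+-comm _ _) ∑≈0)) i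

  square≈0 : ∀ {x} → x * x ≈ 0# → x ≈ 0#
  square≈0 {x} xx≈0 with x ≟ 0#
  ... | yes x≈0 = x≈0
  ... | no  x≉0 = contradiction xx≈0 (PolynomialsOverField.*-≉0 baseField x≉0 x≉0)

-- For a connected r-regular graph the matrix r I - A + J is nonsingular:
-- twice its quadratic form at v is the sum of the squares (v i - v j)² over
-- the ordered pairs of adjacent vertices and of 2 (Σ v i)².
module Laplacian {c ℓ₁ ℓ₂} (K : OrderedField c ℓ₁ ℓ₂) {n} (G : Graph (Fin n)) {r} (regular : Regular G r) where

  open OrderedField K hiding (zero)
  open Matrices commutativeRing
  open FiniteSums commutativeRing
  open Determinants commutativeRing using (sum-Iˡ)
  open Anisotropic baseField
  open OrderedFieldSums K
  open Indicators commutativeRing using (⟦⟧-true)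
  open GraphMatrices commutativeRing G
  open Mult semiring using () renaming (_×_ to _•_)
  open RingIdentities commutativeRing
  open RingProperties ring using (x∙y⁻¹≈ε⇒x≈y)
  open SetoidReasoning setoid
  open Graph G

  private
    r′ : Carrier
    r′ = r • 1#

  rI-A+J : Matrix n
  rI-A+J i j = r′ * I i j - A i j + 1#

  -- The sum of (v i - v j)² over the ordered pairs of adjacent vertices.
  energy : Vector Carrier n → Carrier
  energy v = sum λ i → sum λ j → A i j * ((v i - v j) * (v i - v j))

  private module _ (v : Vector Carrier n) where

    -- The sums of the v i v i, of the v i A i j v j, and of the v i.
    T U s : Carrier
    T = sum λ i → v i * v i
    U = sum λ i → v i * sum λ j → A i j * v j
    s = sum v

    row : ∀ i → sum (λ j → rI-A+J i j * v j) ≈ (r′ * v i - sum (λ j → A i j * v j)) + s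
    row i = begin
      sum (λ j → rI-A+J i j * v j)
        ≈⟨ sum-cong (λ j → solve 4 (λ r e a v → (r :* e :- a :+ con (1 , 0)) :* v := (r :* (e :* v) :+ (:- con (1 , 0)) :* (a :* v)) :+ v) refl r′ (I i j) (A i j) (v j)) ⟩
      sum (λ j → (r′ * (I i j * v j) + - 1# * (A i j * v j)) + v j)
        ≈⟨ ∑-distrib-+ (λ j → r′ * (I i j * v j) + - 1# * (A i j * v j)) v ⟩
      sum (λ j → r′ * (I i j * v j) + - 1# * (A i j * v j)) + s
        ≈⟨ +-congʳ (sum-linear (λ j → I i j * v j) (λ j → A i j * v j) r′ (- 1#)) ⟩
      (r′ * sum (λ j → I i j * v j) + - 1# * sum (λ j → A i j * v j)) + s
        ≈⟨ +-congʳ (+-cong (*-congˡ (sum-Iˡ i v)) (solve 1 (λ x → (:- con (1 , 0)) :* x := :- x) refl _)) ⟩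
      (r′ * v i - sum (λ j → A i j * v j)) + s ∎

    form≈ : form rI-A+J v ≈ (r′ * T - U) + s * s
    form≈ = begin
      sum (λ i → v i * sum λ j → rI-A+J i j * v j)
        ≈⟨ sum-cong (λ i → trans (*-congˡ (row i))
             (solve 4 (λ v r u s → v :* ((r :* v :- u) :+ s) := (r :* (v :* v) :+ (:- con (1 , 0)) :* (v :* u)) :+ v :* s) refl
               (v i) r′ (sum λ j → A i j * v j) s)) ⟩
      sum (λ i → (r′ * (v i * v i) + - 1# * (v i * sum λ j → A i j * v j)) + v i * s)
        ≈⟨ ∑-distrib-+ (λ i → r′ * (v i * v i) + - 1# * (v i * sum λ j → A i j * v j)) (λ i → v i * s) ⟩
      sum (λ i → r′ * (v i * v i) + - 1# * (v i * sum λ j → A i j * v j)) + sum (λ i → v i * s)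
        ≈⟨ +-cong (sum-linear (λ i → v i * v i) (λ i → v i * sum λ j → A i j * v j) r′ (- 1#)) (sym (*-distribʳ-sum s v)) ⟩
      (r′ * T + - 1# * U) + s * s
        ≈⟨ +-congʳ (+-congˡ (solve 1 (λ x → (:- con (1 , 0)) :* x := :- x) refl U)) ⟩
      (r′ * T - U) + s * s ∎

    energy-row : ∀ i → sum (λ j → A i j * ((v i - v j) * (v i - v j)))
               ≈ (r′ * (v i * v i) + - (1# + 1#) * (v i * sum λ j → A i j * v j)) + sum (λ j → A i j * (v j * v j))
    energy-row i = begin
      sum (λ j → A i j * ((v i - v j) * (v i - v j)))
        ≈⟨ sum-cong (λ j → solve 3 (λ a x y → a :* ((x :- y) :* (x :- y)) := ((x :* x) :* a :+ ((:- (con (1 , 0) :+ con (1 , 0))) :* x) :* (a :* y)) :+ a :* (y :* y)) refl (A i j) (v i) (v j)) ⟩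
      sum (λ j → ((v i * v i) * A i j + (- (1# + 1#) * v i) * (A i j * v j)) + A i j * (v j * v j))
        ≈⟨ ∑-distrib-+ (λ j → (v i * v i) * A i j + (- (1# + 1#) * v i) * (A i j * v j)) (λ j → A i j * (v j * v j)) ⟩
      sum (λ j → (v i * v i) * A i j + (- (1# + 1#) * v i) * (A i j * v j)) + sum (λ j → A i j * (v j * v j))
        ≈⟨ +-congʳ (sum-linear (A i) (λ j → A i j * v j) (v i * v i) (- (1# + 1#) * v i)) ⟩
      ((v i * v i) * sum (A i) + (- (1# + 1#) * v i) * sum (λ j → A i j * v j)) + sum (λ j → A i j * (v j * v j))
        ≈⟨ +-congʳ (+-cong (trans (*-congˡ (rowSums regular i)) (*-comm _ _)) (*-assoc _ _ _)) ⟩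
      (r′ * (v i * v i) + - (1# + 1#) * (v i * sum λ j → A i j * v j)) + sum (λ j → A i j * (v j * v j)) ∎

    energy≈ : energy v ≈ (r′ * T + - (1# + 1#) * U) + r′ * T
    energy≈ = begin
      energy v
        ≈⟨ sum-cong energy-row ⟩
      sum (λ i → (r′ * (v i * v i) + - (1# + 1#) * (v i * sum λ j → A i j * v j)) + sum (λ j → A i j * (v j * v j)))
        ≈⟨ ∑-distrib-+ (λ i → r′ * (v i * v i) + - (1# + 1#) * (v i * sum λ j → A i j * v j)) (λ i → sum (λ j → A i j * (v j * v j))) ⟩
      sum (λ i → r′ * (v i * v i) + - (1# + 1#) * (v i * sum λ j → A i j * v j)) + sum (λ i → sum (λ j → A i j * (v j * v j)))
        ≈⟨ +-cong (sum-linear (λ i → v i * v i) (λ i → v i * sum λ j → A i j * v j) r′ (- (1# + 1#))) (∑-comm (λ i j → A i j * (v j * v j))) ⟩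
      (r′ * T + - (1# + 1#) * U) + sum (λ j → sum (λ i → A i j * (v j * v j)))
        ≈⟨ +-congˡ (sum-cong λ j → trans (sym (*-distribʳ-sum (v j * v j) (λ i → A i j))) (*-congʳ (columnSums regular j))) ⟩
      (r′ * T + - (1# + 1#) * U) + sum (λ j → r′ * (v j * v j))
        ≈⟨ +-congˡ (sym (*-distribˡ-sum r′ (λ j → v j * v j))) ⟩
      (r′ * T + - (1# + 1#) * U) + r′ * T ∎

    energy+2s² : form rI-A+J v ≈ 0# → energy v + (s * s + s * s) ≈ 0#
    energy+2s² form≈0 = begin
      energy v + (s * s + s * s)
        ≈⟨ +-congʳ energy≈ ⟩
      (r′ * T + - (1# + 1#) * U) + r′ * T + (s * s + s * s)
        ≈⟨ solve 4 (λ r t u s → (r :* t :+ (:- (con (1 , 0) :+ con (1 , 0))) :* u) :+ r :* t :+ (s :* s :+ s :* s)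
             := ((r :* t :- u) :+ s :* s) :+ ((r :* t :- u) :+ s :* s)) refl r′ T U s ⟩
      ((r′ * T - U) + s * s) + ((r′ * T - U) + s * s)
        ≈⟨ +-cong (trans (sym form≈) form≈0) (trans (sym form≈) form≈0) ⟩
      0# + 0#  ≈⟨ +-identityˡ 0# ⟩
      0#       ∎

    A-nonNeg : ∀ i j → NonNeg (A i j)
    A-nonNeg i j with i ~? j
    ... | yes _ = 1-nonNeg
    ... | no  _ = sum-nonNeg {zero} (λ ()) (λ ())

    term-nonNeg : ∀ i j → NonNeg (A i j * ((v i - v j) * (v i - v j)))
    term-nonNeg i j = *-nonNeg (A-nonNeg i j) (square-nonNeg (v i - v j))

    energy-nonNeg : NonNeg (energy v)
    energy-nonNeg = sum-nonNeg _ λ i → sum-nonNeg _ (term-nonNeg i)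

    adjacent-equal : form rI-A+J v ≈ 0# → ∀ {i j} → i ~ j → v i ≈ v j
    adjacent-equal form≈0 {i} {j} i~j = x∙y⁻¹≈ε⇒x≈y (v i) (v j) (square≈0 (begin
      (v i - v j) * (v i - v j)          ≈⟨ *-identityˡ _ ⟨
      1# * ((v i - v j) * (v i - v j))   ≈⟨ *-congʳ (⟦⟧-true (i ~? j) i~j) ⟨
      A i j * ((v i - v j) * (v i - v j))
        ≈⟨ sum≈0 _ (term-nonNeg i) (sum≈0 _ (λ i → sum-nonNeg _ (term-nonNeg i)) energy≈0 i) j ⟩
      0# ∎))
      where
      energy≈0 : energy v ≈ 0#
      energy≈0 = +≈0ˡ energy-nonNeg (+-nonNeg (square-nonNeg s) (square-nonNeg s)) (energy+2s² form≈0)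

    sum-v≈0 : form rI-A+J v ≈ 0# → s ≈ 0#
    sum-v≈0 form≈0 = square≈0 (+≈0ˡ (square-nonNeg s) (square-nonNeg s)
      (+≈0ˡ (+-nonNeg (square-nonNeg s) (square-nonNeg s)) energy-nonNeg (trans (+-comm _ _) (energy+2s² form≈0))))

    reachable-equal : form rI-A+J v ≈ 0# → ∀ {i j} → Star _~_ i j → v i ≈ v j
    reachable-equal form≈0 ε          = refl
    reachable-equal form≈0 (i~j ◅ js) = trans (adjacent-equal form≈0 i~j) (reachable-equal form≈0 js)

  det-rI-A+J≉0 : Connected G → det rI-A+J ≉ 0#
  det-rI-A+J≉0 connected = det≉0 rI-A+J λ v form≈0 i →
    let equal : ∀ j → v i ≈ v j
        equal j = reachable-equal v form≈0 (Connected.reachable connected i j)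
    -- A constant vector with sum 0 vanishes: the sum of the v j * v i is a
    -- sum of squares.
    in square≈0 (sum≈0 (λ j → v j * v i)
         (λ j → IsTotalOrder.≤-respʳ-≈ isTotalOrder (*-congʳ (equal j)) (square-nonNeg (v i)))
         (trans (sym (*-distribʳ-sum (v i) v)) (trans (*-congʳ (sum-v≈0 v form≈0)) (zeroˡ (v i)))) i)

-- The characteristic matrix of the corona

module BlockIdentity {c ℓ} (R : CommutativeRing c ℓ) where

  open CommutativeRing R hiding (zero)
  open Matrices R using (I)
  open Indicators R

  I-↑ˡ : ∀ {m} n (i j : Fin m) → I (i ↑ˡ n) (j ↑ˡ n) ≈ I i j
  I-↑ˡ n i j = ⟦⟧-⇔ ((i ↑ˡ n) Fin.≟ (j ↑ˡ n)) (i Fin.≟ j) (Fin.↑ˡ-injective n i j) (≡.cong (_↑ˡ n))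

  I-↑ʳ : ∀ m {n} (i j : Fin n) → I (m ↑ʳ i) (m ↑ʳ j) ≈ I i j
  I-↑ʳ m i j = ⟦⟧-⇔ ((m ↑ʳ i) Fin.≟ (m ↑ʳ j)) (i Fin.≟ j) (Fin.↑ʳ-injective m i j) (≡.cong (m ↑ʳ_))

  ↑ˡ≢↑ʳ : ∀ {m n} (i : Fin m) (j : Fin n) → i ↑ˡ n ≢ m ↑ʳ j
  ↑ˡ≢↑ʳ {m} {n} i j eq with ≡.trans (≡.sym (Fin.splitAt-↑ˡ m i n)) (≡.trans (≡.cong (splitAt m) eq) (Fin.splitAt-↑ʳ m n j))
  ... | ()

  I-↑ˡ↑ʳ : ∀ {m n} (i : Fin m) (j : Fin n) → I (i ↑ˡ n) (m ↑ʳ j) ≈ 0#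
  I-↑ˡ↑ʳ {m} {n} i j = ⟦⟧-false ((i ↑ˡ n) Fin.≟ (m ↑ʳ j)) (↑ˡ≢↑ʳ i j)

  I-↑ʳ↑ˡ : ∀ {m n} (i : Fin m) (j : Fin n) → I (m ↑ʳ j) (i ↑ˡ n) ≈ 0#
  I-↑ʳ↑ˡ {m} {n} i j = ⟦⟧-false ((m ↑ʳ j) Fin.≟ (i ↑ˡ n)) (↑ˡ≢↑ʳ i j ∘ ≡.sym)

  I-combine : ∀ {m n} (d e : Fin m) (i j : Fin n) → I (combine d i) (combine e j) ≈ I d e * I i j
  I-combine d e i j = trans
    (⟦⟧-⇔ (combine d i Fin.≟ combine e j) ((d Fin.≟ e) ×-dec (i Fin.≟ j)) (Fin.combine-injective d i e j) (λ { (≡.refl , ≡.refl) → ≡.refl }))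
    (⟦⟧-× (d Fin.≟ e) (i Fin.≟ j))

-- Elimination of the copies of G₂ and then of the subdivision vertices from
-- det (x I - A (G₁ ⊡ G₂)).  Here y is an inverse of x and N is an inverse of
-- x I - A (G₂).
module Corona {c ℓ} (R : CommutativeRing c ℓ) {n₁ n₂ r} (G₁ : Graph (Fin n₁)) (G₂ : Graph (Fin n₂)) (regular : Regular G₁ r)
  (x y : CommutativeRing.Carrier R) (yx≈1 : CommutativeRing._≈_ R (CommutativeRing._*_ R y x) (CommutativeRing.1# R))
  (N : Matrices.Matrix R n₂)
  where

  open CommutativeRing R hiding (zero)
  open Matrices R
  open FiniteSums R
  open Determinants R
  open BlockDeterminants R
  open BlockIdentity R
  open Indicators R
  open GraphMatrices R G₁ using (B; gram) renaming (A to A₁)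
  open GraphMatrices R G₂ using () renaming (A to A₂)
  open Mult semiring using () renaming (_×_ to _•_)
  open Exp semiring using (_^_)
  open RingIdentities R
  open SetoidReasoning setoid

  private
    m : ℕ
    m = size G₁

    q : ℕ
    q = m ℕ.* n₂

    module C₁ = Graph (centralGraph G₁)
    module K  = Graph (corona G₁ G₂)

    -- The bijection that defines the numbering of the vertices of G₁ ⊡ G₂.
    vertex : Fin (n₁ ℕ.+ m ℕ.+ q) → CoronaVertex G₁ G₂
    vertex = Inverse.to ((Fin.+↔⊎ ⊎-↔ Fin.*↔×) ↔-∘ Fin.+↔⊎)

    vertex-↑ˡ : ∀ i → vertex (i ↑ˡ q) ≡ inj₁ (splitAt n₁ i)
    vertex-↑ˡ i rewrite Fin.splitAt-↑ˡ (n₁ ℕ.+ m) i q = ≡.refl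

    vertex-↑ʳ : ∀ (e : Fin m) w → vertex ((n₁ ℕ.+ m) ↑ʳ combine e w) ≡ inj₂ (e , w)
    vertex-↑ʳ e w rewrite Fin.splitAt-↑ʳ (n₁ ℕ.+ m) q (combine e w) = ≡.cong inj₂ (Fin.remQuot-combine e w)

  -- The characteristic matrix of G₁ ⊡ G₂.
  M : Matrix (n₁ ℕ.+ m ℕ.+ q)
  M i j = x * I i j - adjacencyMatrix R (G₁ ⊡ G₂) i j

  -- The characteristic matrix of G₂.
  S : Matrix n₂
  S i j = x * I i j - A₂ i j

  private
    -- Adjacency in the central graph.
    W : Fin n₁ ⊎ Fin m → Fin n₁ ⊎ Fin m → Carrier
    W a b = ⟦ a C₁.~? b ⟧

    -- The incidence matrix, extended by 0 to the subdivision vertices.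
    B′ : Fin n₁ ⊎ Fin m → Fin m → Carrier
    B′ a e = W a (inj₂ e)

    -- The blocks of M; index 1 stands for the central graph, index 2 for the
    -- copies of G₂.
    entry : ∀ {i j a b} → vertex i ≡ a → vertex j ≡ b → M i j ≈ x * I i j - ⟦ a K.~? b ⟧
    entry ≡.refl ≡.refl = refl

    M₁₁ : ∀ i j → M (i ↑ˡ q) (j ↑ˡ q) ≈ x * I i j - W (splitAt n₁ i) (splitAt n₁ j)
    M₁₁ i j = trans (entry (vertex-↑ˡ i) (vertex-↑ˡ j)) (+-congʳ (*-congˡ (I-↑ˡ q i j)))

    M₁₂ : ∀ i e w → M (i ↑ˡ q) ((n₁ ℕ.+ m) ↑ʳ combine e w) ≈ - B′ (splitAt n₁ i) e
    M₁₂ i e w = trans (entry (vertex-↑ˡ i) (vertex-↑ʳ e w))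
      (trans (+-congʳ (trans (*-congˡ (I-↑ˡ↑ʳ i (combine e w))) (zeroʳ x))) (+-identityˡ _))

    M₂₁ : ∀ e w j → M ((n₁ ℕ.+ m) ↑ʳ combine e w) (j ↑ˡ q) ≈ - B′ (splitAt n₁ j) e
    M₂₁ e w j = trans (entry (vertex-↑ʳ e w) (vertex-↑ˡ j))
      (trans (+-congʳ (trans (*-congˡ (I-↑ʳ↑ˡ j (combine e w))) (zeroʳ x))) (+-identityˡ _))

    M₂₂ : ∀ d v e w → M ((n₁ ℕ.+ m) ↑ʳ combine d v) ((n₁ ℕ.+ m) ↑ʳ combine e w) ≈ I d e * S v w
    M₂₂ d v e w = begin
      M ((n₁ ℕ.+ m) ↑ʳ combine d v) ((n₁ ℕ.+ m) ↑ʳ combine e w)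
        ≈⟨ entry (vertex-↑ʳ d v) (vertex-↑ʳ e w) ⟩
      x * I ((n₁ ℕ.+ m) ↑ʳ combine d v) ((n₁ ℕ.+ m) ↑ʳ combine e w) - ⟦ (d Fin.≟ e) ×-dec Graph._~?_ G₂ v w ⟧
        ≈⟨ +-cong (*-congˡ (trans (I-↑ʳ (n₁ ℕ.+ m) (combine d v) (combine e w)) (I-combine d e v w)))
                  (-‿cong (⟦⟧-× (d Fin.≟ e) (Graph._~?_ G₂ v w))) ⟩
      x * (I d e * I v w) - I d e * A₂ v w
        ≈⟨ solve 4 (λ x d v a → x :* (d :* v) :- d :* a := d :* (x :* v :- a)) refl x (I d e) (I v w) (A₂ v w) ⟩
      I d e * S v w ∎

  module _ (N-inverse : ∀ i j → sum (λ k → N i k * S k j) ≈ I i j) where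

    -- The coronal of A (G₂).
    χ : Carrier
    χ = sum λ i → sum λ j → N i j

    private
      -- The column sums of N.
      ρ : Fin n₂ → Carrier
      ρ w = sum λ v → N v w

      sum-ρ : sum ρ ≈ χ
      sum-ρ = ∑-comm (λ w v → N v w)

      -- Since N is a left inverse of S, ρᵀ S = 1ᵀ N S = 1ᵀ.
      ρ-inverse : ∀ w → sum (λ k → ρ k * S k w) ≈ 1#
      ρ-inverse w = begin
        sum (λ k → ρ k * S k w)                       ≈⟨ sum-cong (λ k → *-distribʳ-sum (S k w) (λ v → N v k)) ⟩
        sum (λ k → sum λ v → N v k * S k w)           ≈⟨ ∑-comm (λ k v → N v k * S k w) ⟩
        sum (λ v → sum λ k → N v k * S k w)           ≈⟨ sum-cong (λ v → N-inverse v w) ⟩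
        sum (λ v → I v w)                             ≈⟨ sum-cong (λ v → *-identityˡ (I v w)) ⟨
        sum (λ v → 1# * I v w)                        ≈⟨ sum-Iʳ w (const 1#) ⟩
        1#                                            ∎

      -- The block M₁₂ times the inverse of the block M₂₂.
      z : Fin (n₁ ℕ.+ m) → Vector Carrier q
      z i k = - B′ (splitAt n₁ i) (proj₁ (remQuot {m} n₂ k)) * ρ (proj₂ (remQuot {m} n₂ k))

      z-combine : ∀ i (e : Fin m) w → z i (combine e w) ≈ - B′ (splitAt n₁ i) e * ρ w
      z-combine i e w = reflexive (≡.cong (λ (e , w) → - B′ (splitAt n₁ i) e * ρ w) (Fin.remQuot-combine e w))

      z-M₂₂ : ∀ i e w → sum (λ k → z i k * M ((n₁ ℕ.+ m) ↑ʳ k) ((n₁ ℕ.+ m) ↑ʳ combine e w))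
                      ≈ M (i ↑ˡ q) ((n₁ ℕ.+ m) ↑ʳ combine e w)
      z-M₂₂ i e w = begin
        sum (λ k → z i k * M ((n₁ ℕ.+ m) ↑ʳ k) ((n₁ ℕ.+ m) ↑ʳ combine e w))
          ≈⟨ sum-combine m {n₂} (λ k → z i k * M ((n₁ ℕ.+ m) ↑ʳ k) ((n₁ ℕ.+ m) ↑ʳ combine e w)) ⟩
        sum (λ (d : Fin m) → sum λ v → z i (combine d v) * M ((n₁ ℕ.+ m) ↑ʳ combine d v) ((n₁ ℕ.+ m) ↑ʳ combine e w))
          ≈⟨ sum-cong {m} (λ d → trans (sum-cong {n₂} λ v → trans (*-cong (z-combine i d v) (M₂₂ d v e w))
                (solve 4 (λ b r d s → b :* r :* (d :* s) := (b :* d) :* (r :* s)) refl (- B′ (splitAt n₁ i) d) (ρ v) (I d e) (S v w)))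
              (trans (sym (*-distribˡ-sum (- B′ (splitAt n₁ i) d * I d e) (λ v → ρ v * S v w)))
                (trans (*-congˡ (ρ-inverse w)) (*-identityʳ _)))) ⟩
        sum (λ d → - B′ (splitAt n₁ i) d * I d e)
          ≈⟨ sum-Iʳ e (λ d → - B′ (splitAt n₁ i) d) ⟩
        - B′ (splitAt n₁ i) e
          ≈⟨ M₁₂ i e w ⟨
        M (i ↑ˡ q) ((n₁ ℕ.+ m) ↑ʳ combine e w) ∎

      z-M₂₁ : ∀ i j → sum (λ k → z i k * M ((n₁ ℕ.+ m) ↑ʳ k) (j ↑ˡ q))
                    ≈ χ * sum (λ e → B′ (splitAt n₁ i) e * B′ (splitAt n₁ j) e)
      z-M₂₁ i j = begin
        sum (λ k → z i k * M ((n₁ ℕ.+ m) ↑ʳ k) (j ↑ˡ q))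
          ≈⟨ sum-combine m {n₂} (λ k → z i k * M ((n₁ ℕ.+ m) ↑ʳ k) (j ↑ˡ q)) ⟩
        sum (λ (d : Fin m) → sum λ v → z i (combine d v) * M ((n₁ ℕ.+ m) ↑ʳ combine d v) (j ↑ˡ q))
          ≈⟨ sum-cong {m} (λ d → trans (sum-cong {n₂} λ v → trans (*-cong (z-combine i d v) (M₂₁ d v j))
                (solve 3 (λ b r c → (:- b) :* r :* (:- c) := (b :* c) :* r) refl (B′ (splitAt n₁ i) d) (ρ v) (B′ (splitAt n₁ j) d)))
              (trans (sym (*-distribˡ-sum (B′ (splitAt n₁ i) d * B′ (splitAt n₁ j) d) ρ))
                (trans (*-congˡ sum-ρ) (*-comm _ χ)))) ⟩
        sum (λ d → χ * (B′ (splitAt n₁ i) d * B′ (splitAt n₁ j) d))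
          ≈⟨ *-distribˡ-sum χ (λ d → B′ (splitAt n₁ i) d * B′ (splitAt n₁ j) d) ⟨
        χ * sum (λ e → B′ (splitAt n₁ i) e * B′ (splitAt n₁ j) e) ∎

      -- The Schur complement of the copies of G₂, with δ in place of the entry
      -- of the identity matrix.
      M′ : Fin n₁ ⊎ Fin m → Fin n₁ ⊎ Fin m → Carrier → Carrier
      M′ a b δ = x * δ - W a b - χ * sum (λ e → B′ a e * B′ b e)

      eliminate-copies : det M ≈ det (λ i j → M′ (splitAt n₁ i) (splitAt n₁ j) (I i j)) * det S ^ m
      eliminate-copies = begin
        det M
          ≈⟨ det-schur (n₁ ℕ.+ m) M z (λ i j → ≡.subst
               (λ j → sum (λ k → z i k * M ((n₁ ℕ.+ m) ↑ʳ k) ((n₁ ℕ.+ m) ↑ʳ j)) ≈ M (i ↑ˡ q) ((n₁ ℕ.+ m) ↑ʳ j))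
               (Fin.combine-remQuot {m} n₂ j) (z-M₂₂ i (proj₁ (remQuot {m} n₂ j)) (proj₂ (remQuot {m} n₂ j)))) ⟩
        det (λ i j → M (i ↑ˡ q) (j ↑ˡ q) - sum λ k → z i k * M ((n₁ ℕ.+ m) ↑ʳ k) (j ↑ˡ q))
          * det (λ i j → M ((n₁ ℕ.+ m) ↑ʳ i) ((n₁ ℕ.+ m) ↑ʳ j))
          ≈⟨ *-cong (det-cong λ i j → +-cong (M₁₁ i j) (-‿cong (z-M₂₁ i j)))
                    (det-blockDiagonal m S (λ i j → M ((n₁ ℕ.+ m) ↑ʳ i) ((n₁ ℕ.+ m) ↑ʳ j)) M₂₂) ⟩
        det (λ i j → M′ (splitAt n₁ i) (splitAt n₁ j) (I i j)) * det S ^ m ∎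

      -- The blocks of the Schur complement; index 1 stands for the vertices of
      -- G₁, index 2 for the subdivision vertices.
      L : Matrix (n₁ ℕ.+ m)
      L i j = M′ (splitAt n₁ i) (splitAt n₁ j) (I i j)

      entry′ : ∀ {i j a b δ} → splitAt n₁ i ≡ a → splitAt n₁ j ≡ b → I i j ≈ δ → L i j ≈ M′ a b δ
      entry′ ≡.refl ≡.refl I≈δ = +-congʳ (+-congʳ (*-congˡ I≈δ))

      gram-zeroʳ : ∀ (f : Fin m → Carrier) → sum (λ e → f e * 0#) ≈ 0#
      gram-zeroʳ f = sum-zero λ e → zeroʳ (f e)

      gram-zeroˡ : ∀ (f : Fin m → Carrier) → sum (λ e → 0# * f e) ≈ 0#
      gram-zeroˡ f = sum-zero λ e → zeroˡ (f e)

      L₁₁ : ∀ u v → L (u ↑ˡ m) (v ↑ˡ m) ≈ M′ (inj₁ u) (inj₁ v) (I u v)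
      L₁₁ u v = entry′ (Fin.splitAt-↑ˡ n₁ u m) (Fin.splitAt-↑ˡ n₁ v m) (I-↑ˡ m u v)

      L₁₂ : ∀ u e → L (u ↑ˡ m) (n₁ ↑ʳ e) ≈ - B u e
      L₁₂ u e = trans (entry′ (Fin.splitAt-↑ˡ n₁ u m) (Fin.splitAt-↑ʳ n₁ m e) (I-↑ˡ↑ʳ u e))
        (trans (+-congˡ (-‿cong (*-congˡ (gram-zeroʳ (B u)))))
          (solve 3 (λ x b c → x :* con (0 , 0) :- b :- c :* con (0 , 0) := :- b) refl x (B u e) χ))

      L₂₁ : ∀ e v → L (n₁ ↑ʳ e) (v ↑ˡ m) ≈ - B v e
      L₂₁ e v = trans (entry′ (Fin.splitAt-↑ʳ n₁ m e) (Fin.splitAt-↑ˡ n₁ v m) (I-↑ʳ↑ˡ v e))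
        (trans (+-congˡ (-‿cong (*-congˡ (gram-zeroˡ (B v)))))
          (solve 3 (λ x b c → x :* con (0 , 0) :- b :- c :* con (0 , 0) := :- b) refl x (B v e) χ))

      L₂₂ : ∀ d e → L (n₁ ↑ʳ d) (n₁ ↑ʳ e) ≈ x * I d e
      L₂₂ d e = trans (entry′ (Fin.splitAt-↑ʳ n₁ m d) (Fin.splitAt-↑ʳ n₁ m e) (I-↑ʳ n₁ d e))
        (trans (+-congˡ (-‿cong (*-congˡ (gram-zeroʳ (λ _ → 0#)))))
          (solve 3 (λ x i c → x :* i :- con (0 , 0) :- c :* con (0 , 0) := x :* i) refl x (I d e) χ))

    -- The matrix a I + b A (G₁) - J that is left on the vertices of G₁ after
    -- both eliminations.
    reduced : Matrix n₁
    reduced u v = ((x + 1# - r • χ - (r • 1#) * y) * I u v + (1# - χ - 1# * y) * A₁ u v) + - 1#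

    private
      W₁₁ : ∀ u v → W (inj₁ u) (inj₁ v) ≈ 1# - I u v - A₁ u v
      W₁₁ u v = begin
        ⟦ ¬? (u Fin.≟ v) ×-dec ¬? (Graph._~?_ G₁ u v) ⟧
          ≈⟨ ⟦⟧-× (¬? (u Fin.≟ v)) (¬? (Graph._~?_ G₁ u v)) ⟩
        ⟦ ¬? (u Fin.≟ v) ⟧ * ⟦ ¬? (Graph._~?_ G₁ u v) ⟧
          ≈⟨ *-cong (⟦⟧-¬ (u Fin.≟ v)) (⟦⟧-¬ (Graph._~?_ G₁ u v)) ⟩
        (1# - I u v) * (1# - A₁ u v)
          ≈⟨ solve 2 (λ i a → (con (1 , 0) :- i) :* (con (1 , 0) :- a) := con (1 , 0) :- i :- a :+ i :* a) refl (I u v) (A₁ u v) ⟩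
        1# - I u v - A₁ u v + I u v * A₁ u v
          ≈⟨ trans (+-congˡ (loopless u v)) (+-identityʳ _) ⟩
        1# - I u v - A₁ u v ∎
        where
        loopless : ∀ u v → I u v * A₁ u v ≈ 0#
        loopless u v with u Fin.≟ v
        ... | yes ≡.refl = trans (*-congˡ (⟦⟧-false (Graph._~?_ G₁ u u) (Graph.~-irrefl G₁ ≡.refl))) (zeroʳ 1#)
        ... | no  _      = zeroˡ _

      reduced≈ : ∀ u v → L (u ↑ˡ m) (v ↑ˡ m) - sum (λ e → - B u e * y * L (n₁ ↑ʳ e) (v ↑ˡ m)) ≈ reduced u v
      reduced≈ u v = begin
        L (u ↑ˡ m) (v ↑ˡ m) - sum (λ e → - B u e * y * L (n₁ ↑ʳ e) (v ↑ˡ m))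
          ≈⟨ +-cong (L₁₁ u v) (-‿cong (trans (sum-cong λ e → trans (*-congˡ (L₂₁ e v))
               (solve 3 (λ b y c → (:- b) :* y :* (:- c) := y :* (b :* c)) refl (B u e) y (B v e)))
               (sym (*-distribˡ-sum y (λ e → B u e * B v e))))) ⟩
        x * I u v - W (inj₁ u) (inj₁ v) - χ * sum (λ e → B u e * B v e) - y * sum (λ e → B u e * B v e)
          ≈⟨ +-cong (+-cong (+-congˡ (-‿cong (W₁₁ u v))) (-‿cong (*-congˡ (gram regular u v)))) (-‿cong (*-congˡ (gram regular u v))) ⟩
        x * I u v - (1# - I u v - A₁ u v) - χ * (A₁ u v + (r • 1#) * I u v) - y * (A₁ u v + (r • 1#) * I u v)
          ≈⟨ solve 6 (λ x i a c r y → x :* i :- (con (1 , 0) :- i :- a) :- c :* (a :+ r :* i) :- y :* (a :+ r :* i)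
               := ((x :+ con (1 , 0) :- r :* c :- r :* y) :* i :+ (con (1 , 0) :- c :- con (1 , 0) :* y) :* a) :+ (:- con (1 , 0)))
               refl x (I u v) (A₁ u v) χ (r • 1#) y ⟩
        ((x + 1# - (r • 1#) * χ - (r • 1#) * y) * I u v + (1# - χ - 1# * y) * A₁ u v) + - 1#
          ≈⟨ +-congʳ (+-congʳ (*-congʳ (+-congʳ (+-congˡ (-‿cong
               (trans (Mult.×-assoc-* semiring r 1# χ) (Mult.×-congʳ semiring r (*-identityˡ χ)))))))) ⟩
        reduced u v ∎

    det-corona : det M ≈ det reduced * x ^ m * det S ^ m
    det-corona = trans eliminate-copies (*-congʳ (begin
      det L
        ≈⟨ det-schur n₁ L (λ u e → - B u e * y) (λ u e → begin
             sum (λ d → - B u d * y * L (n₁ ↑ʳ d) (n₁ ↑ʳ e))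
               ≈⟨ sum-cong (λ d → trans (*-congˡ (L₂₂ d e))
                    (trans (solve 4 (λ b y x i → (:- b) :* y :* (x :* i) := (y :* x) :* ((:- b) :* i)) refl (B u d) y x (I d e))
                      (trans (*-congʳ yx≈1) (*-identityˡ _)))) ⟩
             sum (λ d → - B u d * I d e)  ≈⟨ sum-Iʳ e (λ d → - B u d) ⟩
             - B u e                      ≈⟨ L₁₂ u e ⟨
             L (u ↑ˡ m) (n₁ ↑ʳ e)         ∎) ⟩
      det (λ u v → L (u ↑ˡ m) (v ↑ˡ m) - sum λ e → - B u e * y * L (n₁ ↑ʳ e) (v ↑ˡ m))
        * det (λ d e → L (n₁ ↑ʳ d) (n₁ ↑ʳ e))
        ≈⟨ *-cong (det-cong reduced≈) (trans (det-cong L₂₂) (trans (det-scale x (I {m})) (trans (*-congˡ (det-I m)) (*-identityʳ _)))) ⟩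
      det reduced * x ^ m ∎))

-- The determinant of a I + b A - J and the polynomial P

module Pencils {c ℓ c₂ ℓ₂} (K : Field c ℓ) (L : Field c₂ ℓ₂)
  (h : Field.Carrier K → Field.Carrier L)
  (isHom : Homomorphisms.IsRingHomomorphism (Field.commutativeRing K) (Field.commutativeRing L) h) where

  private module K = Field K
  open Field L hiding (zero)
  open Matrices commutativeRing
  open FiniteSums commutativeRing
  open FiniteProducts commutativeRing
  open BlockDeterminants commutativeRing
  open Homomorphisms K.commutativeRing commutativeRing using (sum-homo)
  open Homomorphisms.IsRingHomomorphism K.commutativeRing commutativeRing isHom using (⟦⟧-cong)
  open CharacteristicMatrices K using (characteristicMatrix; linear; specialise-splitting; module P; module PM; module PD; module PΠ)
  open Exp semiring using (_^_)
  open RingIdentities commutativeRing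
  open SetoidReasoning setoid

  -- Substituting x = - a/b in the splitting and clearing denominators; the case
  -- b = 0 concerns a multiple of the identity matrix.
  det-withOnes-pencil : ∀ {n} (M : Matrices.Matrix K.commutativeRing (suc n)) (λs : Vector K.Carrier n) →
    PM.det (PD.withOnes (characteristicMatrix M)) P.≈ PΠ.product (linear ∘ λs) →
    ∀ a b → det (withOnes λ i j → a * I i j + b * h (M i j)) ≈ product (λ i → a + b * h (λs i))
  det-withOnes-pencil {n} M λs splits a b with b ≟ 0#
  ... | yes b≈0 = begin
    det (withOnes λ i j → a * I i j + b * h (M i j))
      ≈⟨ det-withOnes-cong {M = λ i j → a * I i j + b * h (M i j)} {λ i j → a * I i j} (λ i j → trans (+-congˡ (trans (*-congʳ b≈0) (zeroˡ (h (M i j))))) (+-identityʳ (a * I i j))) ⟩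
    det (withOnes λ (i j : Fin (suc n)) → a * I i j)
      ≈⟨ det-withOnes-scale a (I {suc n}) ⟩
    a ^ n * det (withOnes (I {suc n}))
      ≈⟨ trans (*-congˡ (det-withOnes-I n)) (*-identityʳ (a ^ n)) ⟩
    a ^ n
      ≈⟨ product-replicate n ⟨
    product {n} (const a)
      ≈⟨ product-cong (λ i → trans (+-congˡ (trans (*-congʳ b≈0) (zeroˡ (h (λs i))))) (+-identityʳ a)) ⟨
    product (λ i → a + b * h (λs i)) ∎
  ... | no b≉0 = begin
    det (withOnes λ i j → a * I i j + b * h (M i j))
      ≈⟨ det-withOnes-cong (λ i j → homogenise (I i j) (h (M i j))) ⟩
    det (withOnes λ i j → - b * (t * I i j - h (M i j)))
      ≈⟨ det-withOnes-scale (- b) (λ i j → t * I i j - h (M i j)) ⟩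
    (- b) ^ n * det (withOnes λ i j → t * I i j - h (M i j))
      ≈⟨ *-congˡ (specialise-splitting commutativeRing h isHom t M λs splits) ⟩
    (- b) ^ n * product (λ i → t - h (λs i))
      ≈⟨ *-congʳ (product-replicate n) ⟨
    product {n} (const (- b)) * product (λ i → t - h (λs i))
      ≈⟨ product-* (const (- b)) (λ i → t - h (λs i)) ⟨
    product (λ i → - b * (t - h (λs i)))
      ≈⟨ product-cong (λ i → trans (+-congʳ (sym (*-identityʳ a))) (trans (homogenise 1# (h (λs i))) (*-congˡ (+-congʳ (*-identityʳ t))))) ⟨
    product (λ i → a + b * h (λs i)) ∎
    where
    t : Carrier
    t = - (a / b)

    -- Used for the entries of matrices, and with e = 1 for the linear factors.
    homogenise : ∀ e m → a * e + b * m ≈ - b * (t * e - m)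
    homogenise e m = begin
      a * e + b * m
        ≈⟨ +-congʳ (*-congʳ (trans (sym (*-identityʳ a)) (*-congˡ (sym (*-inverseʳ b≉0))))) ⟩
      a * (b * b ⁻¹) * e + b * m
        ≈⟨ solve 5 (λ a b c e m → a :* (b :* c) :* e :+ b :* m := (:- b) :* ((:- (a :* c)) :* e :- m)) refl a b (b ⁻¹) e m ⟩
      - b * (t * e - m) ∎

  det-pencil-J : ∀ {n} (M : Matrices.Matrix K.commutativeRing (suc n)) {r}
    (λs : Vector K.Carrier n) →
    (∀ j → FiniteSums.sum K.commutativeRing (λ i → M i j) K.≈ r) →
    PM.det (PD.withOnes (characteristicMatrix M)) P.≈ PΠ.product (linear ∘ λs) →
    ∀ a b → det (λ i j → (a * I i j + b * h (M i j)) + - 1#)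
            ≈ ((a + b * h r) + sum {suc n} (const (- 1#))) * product (λ i → a + b * h (λs i))
  det-pencil-J {n} M {r} λs sums splits a b = begin
    det (λ i j → (a * I i j + b * h (M i j)) + - 1#)
      ≈⟨ det-+J (λ i j → a * I i j + b * h (M i j)) (- 1#) (λ j → trans (sum-pencil a b (λ i j → h (M i j)) j)
           (+-congˡ (*-congˡ (trans (sym (sum-homo isHom (λ i → M i j))) (⟦⟧-cong (sums j)))))) ⟩
    ((a + b * h r) + sum {suc n} (const (- 1#))) * det (withOnes λ i j → a * I i j + b * h (M i j))
      ≈⟨ *-congˡ (det-withOnes-pencil M λs splits a b) ⟩
    ((a + b * h r) + sum {suc n} (const (- 1#))) * product (λ i → a + b * h (λs i)) ∎

-- The values of the polynomial P at the eigenvalues: its factor for the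
-- eigenvalue θ is 1 at r and 0 at θ.
module PValues {c ℓ₁ ℓ₂} (K : OrderedField c ℓ₁ ℓ₂) where

  open OrderedField K hiding (zero)
  open Spectra K using (P)
  open Mult semiring using () renaming (_×_ to _•_)
  open RingProperties ring using (x≈y⇒x∙y⁻¹≈ε; x∙y⁻¹≈ε⇒x≈y)

  private
    listProduct : ∀ {a} {A : Set a} → (A → Carrier) → List A → Carrier
    listProduct g xs = List.foldr _*_ 1# (List.map g xs)

    listProduct≈0 : ∀ {a} {A : Set a} (g : A → Carrier) {xs} → Any (λ x → g x ≈ 0#) xs → listProduct g xs ≈ 0#
    listProduct≈0 g (here gx≈0) = trans (*-congʳ gx≈0) (zeroˡ _)
    listProduct≈0 g (there any) = trans (*-congˡ (listProduct≈0 g any)) (zeroʳ _)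

    listProduct≈1 : ∀ {a} {A : Set a} (g : A → Carrier) {xs} → All (λ x → g x ≈ 1#) xs → listProduct g xs ≈ 1#
    listProduct≈1 g []           = refl
    listProduct≈1 g (gx≈1 ∷ all) = trans (*-cong gx≈1 (listProduct≈1 g all)) (*-identityˡ 1#)

    -- The distinct eigenvalues other than r.
    others : ∀ {n} → Carrier → Vector Carrier n → List Carrier
    others r λs = filter (λ θ → ¬? (θ ≟ r)) (deduplicate _≟_ (tabulate λs))

  P-regular : ∀ {n} r (λs : Vector Carrier n) {x} → x ≈ r • 1# → P r λs x ≈ n • 1#
  P-regular {n} r λs {x} x≈r = trans (*-congˡ (listProduct≈1 _ (factors (others (r • 1#) λs)
    (All.all-filter (λ θ → ¬? (θ ≟ r • 1#)) (deduplicate _≟_ (tabulate λs)))))) (*-identityʳ _)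
    where
    factors : ∀ θs → All (λ θ → θ ≉ r • 1#) θs → All (λ θ → (x - θ) / (r • 1# - θ) ≈ 1#) θs
    factors []       []          = []
    factors (θ ∷ θs) (θ≉r ∷ all) =
      trans (*-congʳ (+-congʳ x≈r)) (*-inverseʳ λ r-θ≈0 → θ≉r (sym (x∙y⁻¹≈ε⇒x≈y (r • 1#) θ r-θ≈0))) ∷ factors θs all

  P-other : ∀ {n} r (λs : Vector Carrier n) i → λs i ≉ r • 1# → P r λs (λs i) ≈ 0#
  P-other {n} r λs i λ≉r = trans (*-congˡ (listProduct≈0 (λ θ → (λs i - θ) / (r • 1# - θ))
    (Any.map (λ λ≈θ → trans (*-congʳ (x≈y⇒x∙y⁻¹≈ε λ≈θ)) (zeroˡ _)) λ∈θs))) (zeroʳ _)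
    where
    λ∈θs : Any (λs i ≈_) (others (r • 1#) λs)
    λ∈θs = Membership.∈-filter⁺ setoid (λ θ → ¬? (θ ≟ r • 1#)) (λ x≈y x≉r y≈r → x≉r (trans x≈y y≈r))
      (Membership.∈-deduplicate⁺ setoid _≟_ (λ z≈y x≈y → trans x≈y (sym z≈y)) (Membership.∈-tabulate⁺ setoid i)) λ≉r

-- The characteristic polynomial of the corona

-- The formula over any field L with a homomorphism C from K, at any nonzero
-- element X of L at which X I - A (G₂) has an inverse N; the coronal is the sum
-- of the entries of N.
module Assembly {c ℓ₁ ℓ₂ c′ ℓ′} (K : OrderedField c ℓ₁ ℓ₂) (L : Field c′ ℓ′)
  (C : OrderedField.Carrier K → Field.Carrier L)
  (isHom : Homomorphisms.IsRingHomomorphism (OrderedField.commutativeRing K) (Field.commutativeRing L) C) where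

  private
    module K  = OrderedField K
    module KK = Mult K.semiring
    module KM = Matrices K.commutativeRing
    module KΣ = FiniteSums K.commutativeRing
    module KD = BlockDeterminants K.commutativeRing
    module C  = Homomorphisms.IsRingHomomorphism K.commutativeRing (Field.commutativeRing L) isHom
  open Field L hiding (zero)
  open Spectra K using (P)
  open Matrices commutativeRing
  open CharacteristicMatrices K.baseField using (splits-withOnes; specialise-splitting; linear; characteristicMatrix; module P; module PM; module PD; module PΠ)
  open Homomorphisms K.commutativeRing commutativeRing using (×1-homo)
  open FiniteProducts commutativeRing using (product; product-cong; product-remove; product-^)
  open FiniteSums commutativeRing using (sum; sum-cong; sum-replicate; *-distribˡ-sum)
  open Determinants commutativeRing using (I-sym; det-cong)
  open BlockDeterminants commutativeRing using (symmetric-invertible)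
  open Exp semiring using (_^_; ^-congˡ)
  open Mult semiring using () renaming (_×_ to _•_)
  open RingProperties ring using (-1*x≈-x; -0#≈0#)
  open RingProperties K.ring using () renaming (x≈y⇒x∙y⁻¹≈ε to x≈y⇒x-y≈0)
  open SetoidReasoning setoid

  A : ∀ {n} → Graph (Fin n) → Matrices.Matrix K.commutativeRing n
  A = adjacencyMatrix K.commutativeRing

  C-A : ∀ {n} (G : Graph (Fin n)) i j → C (A G i j) ≈ adjacencyMatrix commutativeRing G i j
  C-A G i j with Graph._~?_ G i j
  ... | yes _ = C.1#-homo
  ... | no  _ = C.0#-homo


  -- The eigenvalue r of a connected r-regular graph occurs exactly once, namely
  -- at index i₀, and det (withOnes (x I - A)) is the product of the x - λ over
  -- the eigenvalues λ at the other indices.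
  module SimpleEigenvalue {n r} (G : Graph (Fin (suc n))) (connected : Connected G) (regular : Regular G r)
    (λs : Vector K.Carrier (suc n))
    (splitting : PM.det (characteristicMatrix (A G)) P.≈ PΠ.product (linear ∘ λs)) where

    r′ : K.Carrier
    r′ = r KK.× K.1#

    columnSums : ∀ j → KΣ.sum (λ i → A G i j) K.≈ r′
    columnSums = GraphMatrices.columnSums K.commutativeRing G regular

    factorisation : Σ[ i ∈ Fin (suc n) ] (λs i K.≈ r′ ×
      PM.det (PD.withOnes (characteristicMatrix (A G))) P.≈ PΠ.product (linear ∘ λs ∘ punchIn i))
    factorisation = splits-withOnes (A G) columnSums λs splitting

    i₀ : Fin (suc n)
    i₀ = proj₁ factorisation

    λ-i₀ : λs i₀ K.≈ r′
    λ-i₀ = proj₁ (proj₂ factorisation)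

    splits : PM.det (PD.withOnes (characteristicMatrix (A G))) P.≈ PΠ.product (linear ∘ λs ∘ punchIn i₀)
    splits = proj₂ (proj₂ factorisation)

    -- Otherwise det (r I - A), row 0 replaced by ones, would vanish, and with
    -- it det (r I - A + J).
    λ-others : ∀ i → λs (punchIn i₀ i) K.≉ r′
    λ-others i λ≈r = Laplacian.det-rI-A+J≉0 K G regular connected (K.trans
      (KD.det-+J (λ i j → r′ K.* KM.I i j K.- A G i j) K.1#
        (λ j → K.trans (KD.sum-characteristic r′ (A G) j) (K.+-congˡ (K.-‿cong (columnSums j)))))
      (K.trans (K.*-congˡ (K.trans
        (specialise-splitting K.commutativeRing id (Identity.isRingHomomorphism K.rawRing K.refl) r′ (A G) (λs ∘ punchIn i₀) splits)
        (FiniteProducts.product-zero K.commutativeRing (λ i → r′ K.- λs (punchIn i₀ i)) i (x≈y⇒x-y≈0 (K.sym λ≈r)))))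
        (K.zeroʳ _)))

    -- P takes the value suc n at λs i₀, which accounts for J, and the value 0 at
    -- the other eigenvalues.
    det-pencil : ∀ a b → det (λ i j → (a * I i j + b * C (A G i j)) + - 1#)
                       ≈ product (λ i → (a - C (P r λs (λs i))) + b * C (λs i))
    det-pencil a b = begin
      det (λ i j → (a * I i j + b * C (A G i j)) + - 1#)
        ≈⟨ Pencils.det-pencil-J K.baseField L C isHom (A G) (λs ∘ punchIn i₀) columnSums splits a b ⟩
      ((a + b * C r′) + sum {suc n} (const (- 1#))) * product (λ i → a + b * C (λs (punchIn i₀ i)))
        ≈⟨ *-cong factor-i₀ (product-cong factor-other) ⟩
      ((a - C (P r λs (λs i₀))) + b * C (λs i₀))
        * product (λ i → (a - C (P r λs (λs (punchIn i₀ i)))) + b * C (λs (punchIn i₀ i)))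
        ≈⟨ product-remove {i = i₀} (λ i → (a - C (P r λs (λs i))) + b * C (λs i)) ⟨
      product (λ i → (a - C (P r λs (λs i))) + b * C (λs i)) ∎
      where
      C-P-i₀ : C (P r λs (λs i₀)) ≈ suc n • 1#
      C-P-i₀ = trans (C.⟦⟧-cong (PValues.P-regular K r λs λ-i₀)) (×1-homo isHom (suc n))

      -1s : sum {suc n} (const (- 1#)) ≈ - C (P r λs (λs i₀))
      -1s = begin
        sum {suc n} (const (- 1#))        ≈⟨ sum-cong {suc n} (λ _ → *-identityʳ (- 1#)) ⟨
        sum {suc n} (const (- 1# * 1#))   ≈⟨ *-distribˡ-sum {suc n} (- 1#) (const 1#) ⟨
        - 1# * sum {suc n} (const 1#)     ≈⟨ -1*x≈-x _ ⟩
        - sum {suc n} (const 1#)          ≈⟨ -‿cong (trans (sum-replicate (suc n)) (sym C-P-i₀)) ⟩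
        - C (P r λs (λs i₀))              ∎

      factor-i₀ : (a + b * C r′) + sum {suc n} (const (- 1#)) ≈ (a - C (P r λs (λs i₀))) + b * C (λs i₀)
      factor-i₀ = begin
        (a + b * C r′) + sum {suc n} (const (- 1#))      ≈⟨ +-cong (+-congˡ (*-congˡ (C.⟦⟧-cong (K.sym λ-i₀)))) -1s ⟩
        (a + b * C (λs i₀)) + - C (P r λs (λs i₀))       ≈⟨ trans (+-assoc _ _ _) (trans (+-congˡ (+-comm _ _)) (sym (+-assoc _ _ _))) ⟩
        (a - C (P r λs (λs i₀))) + b * C (λs i₀)         ∎

      factor-other : ∀ i → a + b * C (λs (punchIn i₀ i)) ≈ (a - C (P r λs (λs (punchIn i₀ i)))) + b * C (λs (punchIn i₀ i))
      factor-other i = +-congʳ (begin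
        a                                         ≈⟨ +-identityʳ a ⟨
        a + 0#                                    ≈⟨ +-congˡ -0#≈0# ⟨
        a - 0#                                    ≈⟨ +-congˡ (-‿cong (trans (C.⟦⟧-cong (PValues.P-other K r λs (punchIn i₀ i) (λ-others i))) C.0#-homo)) ⟨
        a - C (P r λs (λs (punchIn i₀ i)))        ∎)

  module _ (X : Carrier) (X≉0 : X ≉ 0#) where

    -- The matrix X I - A (G) over L.
    xI-A : ∀ {n} → Graph (Fin n) → Matrix n
    xI-A G i j = X * I i j - C (A G i j)

    xI-A≈ : ∀ {n} (G : Graph (Fin n)) i j → xI-A G i j ≈ X * I i j - adjacencyMatrix commutativeRing G i j
    xI-A≈ G i j = +-congˡ (-‿cong (C-A G i j))

    resolvent : ∀ {n} (G : Graph (Fin n)) → det (xI-A G) ≉ 0# → InvertibleMatrix (xI-A G)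
    resolvent G det≉0 = symmetric-invertible (xI-A G) (det (xI-A G) ⁻¹) (*-inverseʳ det≉0)
      (λ i j → +-cong (*-congˡ (I-sym i j)) (-‿cong (C.⟦⟧-cong (GraphMatrices.A-sym K.commutativeRing G i j))))

    det-⊡ : ∀ {n₁ n₂ r} (G₁ : Graph (Fin n₁)) (G₂ : Graph (Fin n₂)) → Connected G₁ → Regular G₁ r →
      (λ₁ : Vector K.Carrier n₁) → PM.det (characteristicMatrix (A G₁)) P.≈ PΠ.product (linear ∘ λ₁) →
      (λ₂ : Vector K.Carrier n₂) → det (xI-A G₂) ≈ product (λ j → X - C (λ₂ j)) →
      ((N , _) : InvertibleMatrix (xI-A G₂)) →
      det (xI-A (G₁ ⊡ G₂)) ≈
        X ^ size G₁ * product (λ j → (X - C (λ₂ j)) ^ size G₁)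
        * product (λ i →
            ((X + 1# - r • entrySum N - (r • 1#) / X) - C (P r λ₁ (λ₁ i)))
            + (1# - entrySum N - 1# / X) * C (λ₁ i))
    det-⊡ {zero} G₁ G₂ connected = contradiction (Connected.nonempty connected) λ ()
    det-⊡ {suc n} {n₂} {r} G₁ G₂ connected regular λ₁ splitting₁ λ₂ splits₂ (N , N-inverseˡ , _) = begin
      det (xI-A (G₁ ⊡ G₂))
        ≈⟨ det-cong (xI-A≈ (G₁ ⊡ G₂)) ⟩
      det Reduction.M
        ≈⟨ Reduction.det-corona N-inverse ⟩
      det (Reduction.reduced N-inverse) * X ^ m * det Reduction.S ^ m
        ≈⟨ *-cong (*-congʳ (trans (det-cong reduced≈) (SimpleEigenvalue.det-pencil G₁ connected regular λ₁ splitting₁ a b)))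
                  (trans (^-congˡ m (trans (sym (det-cong (xI-A≈ G₂))) splits₂))
                         (product-^ (λ j → X - C (λ₂ j)) m)) ⟩
      ∏₁ * X ^ m * ∏₂
        ≈⟨ trans (*-assoc ∏₁ (X ^ m) ∏₂) (*-comm ∏₁ (X ^ m * ∏₂)) ⟩
      X ^ m * ∏₂ * ∏₁ ∎
      where
      m : ℕ
      m = size G₁

      module Reduction = Corona commutativeRing G₁ G₂ regular X (X ⁻¹)
        (trans (*-comm (X ⁻¹) X) (*-inverseʳ X≉0)) N

      N-inverse : ∀ i j → sum (λ k → N i k * Reduction.S k j) ≈ I i j
      N-inverse i j = trans (sum-cong λ k → *-congˡ (sym (xI-A≈ G₂ k j))) (N-inverseˡ i j)

      a b ∏₁ ∏₂ : Carrier
      a  = X + 1# - r • entrySum N - (r • 1#) / X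
      b  = 1# - entrySum N - 1# / X
      ∏₁ = product (λ i → (a - C (P r λ₁ (λ₁ i))) + b * C (λ₁ i))
      ∏₂ = product (λ j → (X - C (λ₂ j)) ^ m)

      reduced≈ : ∀ i j → Reduction.reduced N-inverse i j ≈ (a * I i j + b * C (A G₁ i j)) + - 1#
      reduced≈ i j = +-congʳ (+-congˡ (*-congˡ (sym (C-A G₁ i j))))

module _ {c ℓ₁ ℓ₂} (K : OrderedField c ℓ₁ ℓ₂) where

  private module K = OrderedField K
  open Spectra K
  open Polynomials K.commutativeRing using (at)
  open CharacteristicMatrices K.baseField using (embed-isRingHomomorphism; embed-injective; linear-≉0; module Specialisation)
  open Specialisation commutativeRing (Fractions.embed polynomialDomain) embed-isRingHomomorphism using (specialise-linear)

  X≉0 : X ≉ 0#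
  X≉0 X≈0 = K.1≉0 (at (embed-injective X≈0) 1)

  X-C≉0 : ∀ a → X - C a ≉ 0#
  X-C≉0 a X-a≈0 = linear-≉0 a (embed-injective (trans (specialise-linear a) X-a≈0))

  -- A product of nonzero factors X - C λ.
  f≉0 : ∀ {n} (M : Matrices.Matrix K.commutativeRing n) {λs} → IsSpectrum M λs → f M ≉ 0#
  f≉0 M {λs} spectrum f≈0 = Domains.product-≉0 (fieldDomain rationalFunctionField) (λ i → X - C (λs i)) (X-C≉0 ∘ λs)
    (trans (sym (IsSpectrum.splits spectrum)) f≈0)

theorem5p1 : ∀ {c ℓ₁ ℓ₂} (K : OrderedField c ℓ₁ ℓ₂) →
    let open Spectra K
        module K = OrderedField K
        A : ∀ {n} → Graph (Fin n) → Matrices.Matrix K.commutativeRing n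
        A = adjacencyMatrix K.commutativeRing
    in
    ∀ {n₁ n₂ r₁ : ℕ} (G₁ : Graph (Fin n₁)) (G₂ : Graph (Fin n₂)) →
    Connected G₁ → Connected G₂ → Regular G₁ r₁ →
    (λ₁ : Fin n₁ → K.Carrier) → IsSpectrum (A G₁) λ₁ →
    (λ₂ : Fin n₂ → K.Carrier) → IsSpectrum (A G₂) λ₂ →
    let m₁ = size G₁ in
    Σ[ R₂ ∈ Resolvent (A G₂) ]
      f (A (G₁ ⊡ G₂)) ≈
        X ^ m₁
        * product (λ j → (X - C (λ₂ j)) ^ m₁)
        * product (λ i →
            ((X + 1# - r₁ • χ R₂ - (r₁ • 1#) / X)
              - C (P r₁ λ₁ (λ₁ i)))
            + (1# - χ R₂ - 1# / X) * C (λ₁ i))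
theorem5p1 K G₁ G₂ connected₁ _ regular λ₁ spectrum₁ λ₂ spectrum₂ =
  R₂ , det-⊡ X (X≉0 K) G₁ G₂ connected₁ regular λ₁
         (splits-polynomial (A G₁) λ₁ (IsSpectrum.splits spectrum₁)) λ₂ (IsSpectrum.splits spectrum₂) R₂
  where
  open Spectra K
  open CharacteristicMatrices (OrderedField.baseField K) using (C-isRingHomomorphism; splits-polynomial)
  open Assembly K rationalFunctionField C C-isRingHomomorphism using (A; resolvent; det-⊡)
  R₂ : Resolvent (A G₂)
  R₂ = resolvent X (X≉0 K) G₂ (f≉0 K (A G₂) spectrum₂)
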